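{- Let $q$ be a prime power and let $m,l,k$ be positive integers satisfying $3\le k\le \min\{m+1,l\}$. Let $w\in\{0,1\}$ and, for each $2\le r\le k-1$ and each positive divisor $u$ of $\gcd(r+1,l)$, let $w_{r,u}$ be an integer with $0\le w_{r,u}\le n_{r+1,u}^l$. Then there exists a simple $(ml,l,k,\lambda)_q$-GDD on $\mathrm{GF}(q)^{ml}$ whose set of groups is the Desarguesian $l$-spread $\mathcal G$ and which admits $\mathrm{GL}(m,q^l)$ as an automorphism group, where $$\lambda=\sum_{r=2}^{k-1}\ \sum_{u\mid\gcd(r+1,l)} w_{r,u}\,\frac{(q^k-1)(q^k-q)\prod_{j=2}^{k-2}(q^{ml}-q^{jl})}{(q^{u}-1)\prod_{j=r+1}^{k-1}(q^k-q^j)}\;+\;w\,q^{(l-1)\left(\binom{k}{2}-1\right)}\prod_{j=2}^{k-1}\frac{q^{(m-j)l}-1}{q^{k-j}-1}.$$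
   Context: Empty products equal $1$. An $i$-subspace is an $i$-dimensional $\mathrm{GF}(q)$-subspace. A $(v,g,k,\lambda)_q$-GDD ($q$-analog of a group divisible design) is a triple $(V,\mathcal G,\mathcal B)$ where $V$ is a $v$-dimensional vector space over $\mathrm{GF}(q)$, $\mathcal G$ (the set of groups) is a set of $g$-subspaces partitioning the set of $1$-subspaces of $V$, and $\mathcal B$ (the blocks) is a collection, possibly with repetition, of $k$-subspaces of $V$ such that: (i) $\dim_{\mathrm{GF}(q)}(B\cap W)\le 1$ for all $W\in\mathcal G$, $B\in\mathcal B$; (ii) every $2$-subspace of $V$ not contained in any group is contained in exactly $\lambda$ blocks. It is simple if $\mathcal B$ has no repeated blocks. It admits a subgroup of $\mathrm{GL}(V)$ as an automorphism group if every element of that subgroup preserves $\mathcal B$ (and $\mathcal G$). Identify $\mathrm{GF}(q)^{ml}$ with $\mathrm{GF}(q^l)^m$ regarded as a $\mathrm{GF}(q)$-space; $\mathrm{GL}(m,q^l)$ acts on it by $\mathrm{GF}(q^l)$-linear maps. The Desarguesian $l$-spread $\mathcal G$ is the set of all $1$-dimensional $\mathrm{GF}(q^l)$-subspaces, regarded as $l$-subspaces over $\mathrm{GF}(q)$. For $u\mid\gcd(d,l)$, $$n_{d,u}^l=\frac{q^u-1}{q^l-1}\sum_{t:\,u\mid t\mid\gcd(d,l)}\mu(t/u)\begin{bmatrix} l/t\\ d/t\end{bmatrix}_{q^t},$$ where $\mu$ is the Möbius function and $\begin{bmatrix} a\\ b\end{bmatrix}_{Q}$ is the Gaussian binomial coefficient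 (the number of $b$-dimensional subspaces of a space of dimension $a$ over the field with $Q$ elements). It equals the number of orbits of the multiplicative group $H=\mathrm{GF}(q^l)^*$, acting by multiplication on the $d$-dimensional $\mathrm{GF}(q)$-subspaces of $\mathrm{GF}(q^l)$, for which the stabilizer of a subspace in the orbit is $\mathrm{GF}(q^u)^*$. -}

module Defs where

open import Level using (Level; 0ℓ) renaming (suc to lsuc)
open import Algebra.Bundles using (Ring; CommutativeRing)
open import Algebra.Core using (Op₁; Op₂)
open import Algebra.Module.Bundles using (LeftModule)
open import Algebra.Module.Morphism.Structures using (module LeftModuleMorphisms)
open import Algebra.Morphism.Structures using (module RingMorphisms)
open import Algebra.Structures using (IsCommutativeRing)
import Algebra.Properties.CommutativeMonoid.Sum as MonoidSum
open import Data.Bool.Base using (if_then_else_)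
open import Data.Fin.Base using (Fin)
open import Data.Integer.Base as ℤ using (ℤ; +_; 0ℤ; 1ℤ; -1ℤ)
open import Data.List.Base using (List; []; _∷_; map; foldr; length; upTo)
open import Data.List.Relation.Unary.All using (All)
import Data.List.Relation.Binary.Permutation.Setoid as Permutation
import Data.List.Relation.Unary.Unique.Setoid as UniqueSetoid
open import Data.Nat.Base as ℕ using (ℕ; suc; NonZero; _∸_; _^_)
open import Data.Nat.Combinatorics using (_C_)
import Data.Nat.DivMod as ℕ
open import Data.Nat.Divisibility using (_∣?_)
open import Data.Nat.GCD using (gcd)
open import Data.Nat.Primality using (Prime)
open import Data.Nat.Primality.Factorisation using (factorise; factors)
import Data.Nat.Properties as ℕ
open import Data.List.Relation.Unary.Unique.DecPropositional ℕ._≟_ using (unique?)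
open import Data.Product.Base using (Σ-syntax; ∃; ∃-syntax; ∃₂; _×_; _,_; proj₁; proj₂)
open import Data.Rational as ℚ using (ℚ; 0ℚ; 1ℚ; _+_; _-_; _*_; _/_)
open import Data.Unit.Base using (⊤; tt)
open import Data.Vec.Base as Vec using (Vec; []; _∷_; replicate; zipWith)
open import Data.Vec.Properties
  using (zipWith-assoc; zipWith-comm; zipWith-identityˡ; zipWith-identityʳ; zipWith-inverseˡ; zipWith-inverseʳ)
open import Function.Bundles using (_↔_; _⇔_)
open import Relation.Binary.Bundles using (Setoid)
open import Relation.Binary.Definitions using (_Respects_)
open import Relation.Binary.PropositionalEquality
  using (_≡_; _≢_; refl; cong; cong₂; isEquivalence)
open import Relation.Nullary using (¬_; does; yes; no)
open import Relation.Unary using (Pred; _∈_; _⊆_; _≐_; _∩_)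
open import Relation.Unary.Properties using (≐-refl; ≐-sym; ≐-trans)

IsPrimePower : ℕ → Set
IsPrimePower q = ∃₂ λ p n → Prime p × 1 ℕ.≤ n × q ≡ p ^ n

-- Every finite field is isomorphic to one whose equality is _≡_, so no
-- setoid equality is carried.
record FiniteField (q : ℕ) : Set₁ where
  field
    Carrier           : Set
    _⊕_ _⊗_           : Op₂ Carrier
    ⊖_                : Op₁ Carrier
    𝟘 𝟙               : Carrier
    isCommutativeRing : IsCommutativeRing _≡_ _⊕_ _⊗_ ⊖_ 𝟘 𝟙
    𝟘≢𝟙               : 𝟘 ≢ 𝟙
    inverse           : ∀ x → x ≢ 𝟘 → ∃[ y ] y ⊗ x ≡ 𝟙
    enumeration       : Carrier ↔ Fin q

  commutativeRing : CommutativeRing 0ℓ 0ℓ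
  commutativeRing = record { isCommutativeRing = isCommutativeRing }

  open CommutativeRing commutativeRing public using (ring; rawRing)

record _↪_ {q Q : ℕ} (F : FiniteField q) (L : FiniteField Q) : Set where
  open RingMorphisms (FiniteField.rawRing F) (FiniteField.rawRing L)
  field
    ⟦_⟧               : FiniteField.Carrier F → FiniteField.Carrier L
    isRingHomomorphism : IsRingHomomorphism ⟦_⟧

module _ {R : Ring 0ℓ 0ℓ} (V : LeftModule R 0ℓ 0ℓ) where
  open Ring R using (Carrier; _≈_; 0#)
  open LeftModule V
  open MonoidSum +ᴹ-commutativeMonoid using (sum)

  record Subspace : Set₁ where
    field
      carrier   : Pred Carrierᴹ 0ℓ
      resp      : carrier Respects _≈ᴹ_
      0-closed  : 0ᴹ ∈ carrier
      +-closed  : ∀ {x y} → x ∈ carrier → y ∈ carrier → x +ᴹ y ∈ carrier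
      *-closed  : ∀ a {x} → x ∈ carrier → a *ₗ x ∈ carrier

  subspaceSetoid : Setoid (lsuc 0ℓ) 0ℓ
  subspaceSetoid = record
    { Carrier       = Subspace
    ; _≈_           = λ S T → Subspace.carrier S ≐ Subspace.carrier T
    ; isEquivalence = record
      { refl  = ≐-refl
      ; sym   = ≐-sym
      ; trans = ≐-trans
      }
    }

  whole : Subspace
  whole = record
    { carrier  = λ _ → ⊤
    ; resp     = λ _ _ → tt
    ; 0-closed = tt
    ; +-closed = λ _ _ → tt
    ; *-closed = λ _ _ → tt
    }

  linearCombination : ∀ {n} → (Fin n → Carrier) → (Fin n → Carrierᴹ) → Carrierᴹ
  linearCombination a b = sum (λ i → a i *ₗ b i)

  record IsBasis {n} (S : Subspace) (b : Fin n → Carrierᴹ) : Set where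
    field
      member      : ∀ i → b i ∈ Subspace.carrier S
      independent : ∀ a → linearCombination a b ≈ᴹ 0ᴹ → ∀ i → a i ≈ 0#
      spanning    : ∀ {x} → x ∈ Subspace.carrier S → ∃[ a ] x ≈ᴹ linearCombination a b

  HasDim : Subspace → ℕ → Set
  HasDim S n = Σ[ b ∈ (Fin n → Carrierᴹ) ] IsBasis S b

module _ {R : Ring 0ℓ 0ℓ} {V : LeftModule R 0ℓ 0ℓ} where
  open LeftModule V
  open Setoid (subspaceSetoid V) public using () renaming (_≈_ to _≐ₛ_)

  _⊆ₛ_ : Subspace V → Subspace V → Set
  S ⊆ₛ T = Subspace.carrier S ⊆ Subspace.carrier T

  _∩ₛ_ : Subspace V → Subspace V → Subspace V
  S ∩ₛ T = record
    { carrier  = S.carrier ∩ T.carrier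
    ; resp     = λ x≈y (s , t) → S.resp x≈y s , T.resp x≈y t
    ; 0-closed = S.0-closed , T.0-closed
    ; +-closed = λ (s , t) (s′ , t′) → S.+-closed s s′ , T.+-closed t t′
    ; *-closed = λ a (s , t) → S.*-closed a s , T.*-closed a t
    }
    where
    module S = Subspace S
    module T = Subspace T

module _ {R : Ring 0ℓ 0ℓ} (V : LeftModule R 0ℓ 0ℓ) where
  open LeftModule V
  open LeftModuleMorphisms rawLeftModule rawLeftModule

  record GL : Set where
    field
      apply         : Carrierᴹ → Carrierᴹ
      isIsomorphism : IsLeftModuleIsomorphism apply

    open IsLeftModuleIsomorphism isIsomorphism public

image : {R : Ring 0ℓ 0ℓ} {V : LeftModule R 0ℓ 0ℓ} → GL V → Subspace V → Subspace V
image {V = V} g S = record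
  { carrier  = λ y → ∃[ x ] x ∈ S.carrier × y ≈ᴹ g.apply x
  ; resp     = λ y≈z (x , s , e) → x , s , ≈ᴹ-trans (≈ᴹ-sym y≈z) e
  ; 0-closed = 0ᴹ , S.0-closed , ≈ᴹ-sym g.0ᴹ-homo
  ; +-closed = λ (x , s , e) (x′ , s′ , e′) →
      x +ᴹ x′ , S.+-closed s s′ , ≈ᴹ-trans (+ᴹ-cong e e′) (≈ᴹ-sym (g.+ᴹ-homo x x′))
  ; *-closed = λ a (x , s , e) →
      a *ₗ x , S.*-closed a s , ≈ᴹ-trans (*ₗ-congˡ e) (≈ᴹ-sym (g.*ₗ-homo a x))
  }
  where
  open LeftModule V
  module S = Subspace S
  module g = GL g

data Exactly {a p} {A : Set a} (P : Pred A p) : ℕ → List A → Set (a Level.⊔ p) where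
  []   : Exactly P 0 []
  hit  : ∀ {n x xs} → P x   → Exactly P n xs → Exactly P (suc n) (x ∷ xs)
  miss : ∀ {n x xs} → ¬ P x → Exactly P n xs → Exactly P n       (x ∷ xs)

module _ {q : ℕ} {F : FiniteField q} {V : LeftModule (FiniteField.ring F) 0ℓ 0ℓ} where
  private
    module U = UniqueSetoid (subspaceSetoid V)
    module P = Permutation (subspaceSetoid V)

  -- The groups form a set of subspaces and the blocks a finite multiset,
  -- represented by a list; subspaces are identified when they have the same
  -- elements.
  record IsGDD (v g k Λ : ℕ)
               (𝒢 : Pred (Subspace V) (lsuc 0ℓ)) (ℬ : List (Subspace V)) : Set₁ where
    field
      dim-V           : HasDim V (whole V) v
      groups-resp     : 𝒢 Respects _≐ₛ_
      groups-dim      : ∀ {W} → W ∈ 𝒢 → HasDim V W g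
      groups-cover    : ∀ P → HasDim V P 1 → ∃[ W ] W ∈ 𝒢 × P ⊆ₛ W
      groups-disjoint : ∀ P → HasDim V P 1 → ∀ {W W′} → W ∈ 𝒢 → W′ ∈ 𝒢 →
                        P ⊆ₛ W → P ⊆ₛ W′ → W ≐ₛ W′
      blocks-dim      : All (λ B → HasDim V B k) ℬ
      block∩group     : All (λ B → ∀ {W} → W ∈ 𝒢 →
                               ∃[ d ] d ℕ.≤ 1 × HasDim V (B ∩ₛ W) d) ℬ
      balanced        : ∀ T → HasDim V T 2 → (∀ {W} → W ∈ 𝒢 → ¬ (T ⊆ₛ W)) →
                        Exactly (λ B → T ⊆ₛ B) Λ ℬ

  IsSimple : List (Subspace V) → Set₁
  IsSimple = U.Unique

  record AdmitsAutomorphisms (H : Pred (GL V) 0ℓ)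
           (𝒢 : Pred (Subspace V) (lsuc 0ℓ)) (ℬ : List (Subspace V)) : Set₁ where
    field
      preserves-groups : ∀ {g} → g ∈ H → ∀ W → W ∈ 𝒢 ⇔ image g W ∈ 𝒢
      preserves-blocks : ∀ {g} → g ∈ H → map (image g) ℬ P.↭ ℬ

module _ {Q : ℕ} (L : FiniteField Q) where
  open FiniteField L
  private module R = Ring ring

  space : ℕ → LeftModule ring 0ℓ 0ℓ
  space m = record
    { Carrierᴹ     = Vec Carrier m
    ; _≈ᴹ_         = _≡_
    ; _+ᴹ_         = zipWith _⊕_
    ; _*ₗ_         = λ a → Vec.map (a ⊗_)
    ; 0ᴹ           = replicate m 𝟘
    ; -ᴹ_          = Vec.map ⊖_
    ; isLeftModule = record
      { isLeftSemimodule = record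
        { +ᴹ-isCommutativeMonoid = record
          { isMonoid = record
            { isSemigroup = record
              { isMagma = record { isEquivalence = isEquivalence ; ∙-cong = cong₂ _ }
              ; assoc   = zipWith-assoc R.+-assoc
              }
            ; identity = zipWith-identityˡ R.+-identityˡ , zipWith-identityʳ R.+-identityʳ
            }
          ; comm = zipWith-comm R.+-comm
          }
        ; isPreleftSemimodule = record
          { *ₗ-cong      = cong₂ _
          ; *ₗ-zeroˡ     = scale-zeroˡ
          ; *ₗ-distribʳ  = scale-distribʳ
          ; *ₗ-identityˡ = scale-identity
          ; *ₗ-assoc     = λ a b → scale-assoc a b
          ; *ₗ-zeroʳ     = λ a → scale-zeroʳ a m
          ; *ₗ-distribˡ  = λ a → scale-distribˡ a
          }
        }
      ; -ᴹ‿cong    = cong _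
      ; -ᴹ‿inverse = zipWith-inverseˡ R.-‿inverseˡ , zipWith-inverseʳ R.-‿inverseʳ
      }
    }
    where

    scale-zeroˡ : ∀ {n} (x : Vec Carrier n) → Vec.map (𝟘 ⊗_) x ≡ replicate n 𝟘
    scale-zeroˡ []      = refl
    scale-zeroˡ (a ∷ x) = cong₂ _∷_ (R.zeroˡ a) (scale-zeroˡ x)

    scale-zeroʳ : ∀ a n → Vec.map (a ⊗_) (replicate n 𝟘) ≡ replicate n 𝟘
    scale-zeroʳ a ℕ.zero  = refl
    scale-zeroʳ a (suc n) = cong₂ _∷_ (R.zeroʳ a) (scale-zeroʳ a n)

    scale-identity : ∀ {n} (x : Vec Carrier n) → Vec.map (𝟙 ⊗_) x ≡ x
    scale-identity []      = refl
    scale-identity (a ∷ x) = cong₂ _∷_ (R.*-identityˡ a) (scale-identity x)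

    scale-assoc : ∀ a b {n} (x : Vec Carrier n) →
                  Vec.map ((a ⊗ b) ⊗_) x ≡ Vec.map (a ⊗_) (Vec.map (b ⊗_) x)
    scale-assoc a b []      = refl
    scale-assoc a b (c ∷ x) = cong₂ _∷_ (R.*-assoc a b c) (scale-assoc a b x)

    scale-distribʳ : ∀ {n} (x : Vec Carrier n) a b →
                     Vec.map ((a ⊕ b) ⊗_) x ≡ zipWith _⊕_ (Vec.map (a ⊗_) x) (Vec.map (b ⊗_) x)
    scale-distribʳ []      a b = refl
    scale-distribʳ (c ∷ x) a b = cong₂ _∷_ (R.distribʳ c a b) (scale-distribʳ x a b)

    scale-distribˡ : ∀ a {n} (x y : Vec Carrier n) →
                     Vec.map (a ⊗_) (zipWith _⊕_ x y) ≡ zipWith _⊕_ (Vec.map (a ⊗_) x) (Vec.map (a ⊗_) y)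
    scale-distribˡ a []      []      = refl
    scale-distribˡ a (b ∷ x) (c ∷ y) = cong₂ _∷_ (R.distribˡ a b c) (scale-distribˡ a x y)

module _ {q Q : ℕ} {F : FiniteField q} {L : FiniteField Q} (φ : F ↪ L) where
  open _↪_ φ
  open RingMorphisms (FiniteField.rawRing F) (FiniteField.rawRing L)
  open IsRingHomomorphism isRingHomomorphism

  restrict : LeftModule (FiniteField.ring L) 0ℓ 0ℓ → LeftModule (FiniteField.ring F) 0ℓ 0ℓ
  restrict M = record
    { Carrierᴹ     = Carrierᴹ
    ; _≈ᴹ_         = _≈ᴹ_
    ; _+ᴹ_         = _+ᴹ_
    ; _*ₗ_         = λ a → ⟦ a ⟧ *ₗ_
    ; 0ᴹ           = 0ᴹ
    ; -ᴹ_          = -ᴹ_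
    ; isLeftModule = record
      { isLeftSemimodule = record
        { +ᴹ-isCommutativeMonoid = +ᴹ-isCommutativeMonoid
        ; isPreleftSemimodule = record
          { *ₗ-cong      = λ a≡b → *ₗ-cong (⟦⟧-cong a≡b)
          ; *ₗ-zeroˡ     = λ x → ≈ᴹ-trans (*ₗ-congʳ 0#-homo) (*ₗ-zeroˡ x)
          ; *ₗ-distribʳ  = λ x a b → ≈ᴹ-trans (*ₗ-congʳ (+-homo a b)) (*ₗ-distribʳ x ⟦ a ⟧ ⟦ b ⟧)
          ; *ₗ-identityˡ = λ x → ≈ᴹ-trans (*ₗ-congʳ 1#-homo) (*ₗ-identityˡ x)
          ; *ₗ-assoc     = λ a b x → ≈ᴹ-trans (*ₗ-congʳ (*-homo a b)) (*ₗ-assoc ⟦ a ⟧ ⟦ b ⟧ x)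
          ; *ₗ-zeroʳ     = λ a → *ₗ-zeroʳ ⟦ a ⟧
          ; *ₗ-distribˡ  = λ a → *ₗ-distribˡ ⟦ a ⟧
          }
        }
      ; -ᴹ‿cong    = -ᴹ‿cong
      ; -ᴹ‿inverse = -ᴹ‿inverse
      }
    }
    where open LeftModule M

  restrictSubspace : {M : LeftModule (FiniteField.ring L) 0ℓ 0ℓ} →
                     Subspace M → Subspace (restrict M)
  restrictSubspace S = record
    { carrier  = S.carrier
    ; resp     = S.resp
    ; 0-closed = S.0-closed
    ; +-closed = S.+-closed
    ; *-closed = λ a → S.*-closed ⟦ a ⟧
    }
    where module S = Subspace S

  Desarguesian : ∀ m → Pred (Subspace (restrict (space L m))) (lsuc 0ℓ)
  Desarguesian m W = ∃[ X ] HasDim (space L m) X 1 × W ≐ₛ restrictSubspace X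

  -- GL(m,qˡ) as a subgroup of GL(V), where V is the GF(q)-space GF(qˡ)ᵐ.
  GeneralLinear : ∀ m → Pred (GL (restrict (space L m))) 0ℓ
  GeneralLinear m g = IsLeftModuleIsomorphism (GL.apply g)
    where
    open LeftModule (space L m) using (rawLeftModule)
    open LeftModuleMorphisms rawLeftModule rawLeftModule

infixl 7 _÷₀_

-- Division by zero yields zero; for q ≥ 2 no denominator below vanishes.
_÷₀_ : ℚ → ℚ → ℚ
x ÷₀ y with y ℚ.≟ 0ℚ
... | yes _   = 0ℚ
... | no  y≢0 = ℚ._÷_ x y {{ℚ.≢-nonZero y≢0}}

fromℤ : ℤ → ℚ
fromℤ z = z / 1

fromℕ : ℕ → ℚ
fromℕ n = fromℤ (+ n)

-- Half-open: b is excluded.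
_⋯<_ : ℕ → ℕ → List ℕ
a ⋯< b = map (a ℕ.+_) (upTo (b ∸ a))

∑ ∏ : {A : Set} → List A → (A → ℚ) → ℚ
∑ xs f = foldr _+_ 0ℚ (map f xs)
∏ xs f = foldr _*_ 1ℚ (map f xs)

infix 5 ∑ ∏
syntax ∑ xs (λ x → e) = ∑[ x ∈ xs ] e
syntax ∏ xs (λ x → e) = ∏[ x ∈ xs ] e

-- Only correct for n ≥ 1, since candidate divisors run over 1, …, n.
∑-divisors : (n : ℕ) → ((u : ℕ) → .{{_ : NonZero u}} → ℚ) → ℚ
∑-divisors n f = ∑[ i ∈ upTo n ] (if does (suc i ∣? n) then f (suc i) else 0ℚ)

-- Zero when a prime factor is repeated; the value at 0 is junk.
μ : ℕ → ℤ
μ 0         = 0ℤ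
μ n@(suc _) = if does (unique? ps) then -1ℤ ℤ.^ length ps else 0ℤ
  where ps = factors (factorise n)

-- The factor with i = a vanishes when b > a.
gaussian : (Q a b : ℕ) → ℚ
gaussian Q a b = ∏[ i ∈ 0 ⋯< b ]
  ((fromℕ (Q ^ (a ∸ i)) - 1ℚ) ÷₀ (fromℕ (Q ^ (b ∸ i)) - 1ℚ))

module _ (q l : ℕ) where

  -- n^l_{d,u}, meaningful for u ∣ gcd d l.
  orbitNumber : (d u : ℕ) → .{{_ : NonZero u}} → ℚ
  orbitNumber d u =
    ((fromℕ (q ^ u) - 1ℚ) ÷₀ (fromℕ (q ^ l) - 1ℚ)) *
    ∑-divisors (gcd d l) (λ t → if does (u ∣? t) then term t else 0ℚ)
    where
    term : (t : ℕ) → .{{_ : NonZero t}} → ℚ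
    term t = fromℤ (μ (t ℕ./ u)) * gaussian (q ^ t) (l ℕ./ t) (d ℕ./ t)

module _ (q m l k : ℕ) where

  private
    q^ : ℕ → ℚ
    q^ n = fromℕ (q ^ n)

  -- λ, with w_{r,u} = ws r u; only 2 ≤ r < k and u ∣ gcd (r+1) l are used.
  multiplicity : (w : ℕ) (ws : ℕ → ℕ → ℤ) → ℚ
  multiplicity w ws =
    (∑[ r ∈ 2 ⋯< k ]
       ∑-divisors (gcd (suc r) l) (λ u →
         fromℤ (ws r u) *
         (((q^ k - 1ℚ) * (q^ k - q^ 1) * (∏[ j ∈ 2 ⋯< (k ∸ 1) ] (q^ (m ℕ.* l) - q^ (j ℕ.* l))))
          ÷₀ ((q^ u - 1ℚ) * (∏[ j ∈ suc r ⋯< k ] (q^ k - q^ j))))))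
    + fromℕ w * q^ ((l ∸ 1) ℕ.* (k C 2 ∸ 1)) *
      (∏[ j ∈ 2 ⋯< k ] ((q^ ((m ∸ j) ℕ.* l) - 1ℚ) ÷₀ (q^ (k ∸ j) - 1ℚ)))

{-# OPTIONS --safe #-}

-- A k-tuple x of vectors of V = GF(q^l)^m is called good if it is independent over GF(q^l) (only when w = 1), or if its
-- relations over GF(q^l) are exactly the multiples of one vector a whose entries span a GF(q)-space of dimension r + 1 ≥ 3
-- lying in one of w_{r,u} chosen orbits of H with stabilizer GF(q^u)*. Changing the basis of the GF(q)-span U of x over
-- GF(q) does not change the span of the entries of a, so goodness is a property of U; the blocks are the spans of good
-- tuples. Goodness is invariant under GL(m, q^l), and as a is never supported on two entries, two vectors of a block which
-- are independent over GF(q) are independent over GF(q^l). Given such a pair t, the good tuples extending t are counted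
-- directly; each block through t contains (q^k - q^2) ... (q^k - q^(k-1)) of them, which gives λ. That enough orbits exist
-- is the formula for n_{d,u}: the d-subspaces closed under GF(q^t) are counted by Gaussian binomials, and Möbius
-- inversion extracts those with stabilizer exactly GF(q^u)*. The subfield GF(q^t) is the set of fixed points of the
-- q^t-power map, whose additivity and number of fixed points follow from bounds on the number of roots of polynomials.
-- All counts of subspaces are made through the tuples spanning them.

module Submission where

open import Defs
open import Level using (Level; 0ℓ)
open import Algebra.Bundles using (CommutativeRing; CommutativeMonoid)
import Algebra.Module.Construct.TensorUnit as TensorUnit
open import Algebra.Module.Bundles using (LeftModule)
open import Algebra.Module.Structures using (IsLeftModule)
open import Data.Bool.Base using (if_then_else_)
open import Data.Empty using (⊥; ⊥-elim)
open import Data.Fin.Base using (Fin; zero; suc)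
open import Data.Integer.Base as ℤ using (ℤ; +_; 0ℤ; 1ℤ; -1ℤ)
import Data.Integer.Properties as ℤ
open import Data.List.Base as List using (List; []; _∷_; map; _++_; concatMap; filter; length; upTo; take; allFin; foldr)
import Data.List.Properties as List
open import Data.List.Membership.Propositional using (_∈_; find; lose)
open import Data.List.Membership.Propositional.Properties using (∈-map⁺; ∈-map⁻; ∈-concat⁺′; ∈-concatMap⁻; ∈-filter⁺; ∈-filter⁻; ∈-upTo⁺; ∈-upTo⁻; ∈-allFin)
open import Data.List.Relation.Unary.All as All using (All; []; _∷_)
import Data.List.Relation.Unary.All.Properties as All
open import Data.List.Relation.Unary.AllPairs as AllPairs using (AllPairs; []; _∷_)
import Data.List.Relation.Unary.AllPairs.Properties as AllPairs
open import Data.List.Relation.Unary.Any as Any using (Any; here; there)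
import Data.List.Relation.Unary.Any.Properties as Any
open import Data.List.Relation.Unary.Unique.Propositional using (Unique)
import Data.List.Relation.Unary.Unique.Propositional.Properties as Unique
open import Data.Nat.Base as ℕ using (ℕ; zero; suc; _+_; _*_; _∸_; _^_; _⊓_; _≤_; _<_; z≤n; s≤s; z<s; NonZero)
import Data.Nat.Properties as ℕ
open import Data.Nat.Divisibility as ∣ using (_∣_; _∣?_; divides)
import Data.Nat.DivMod as ℕ
import Data.Nat.Solver as ℕ
open import Data.Product.Base using (Σ-syntax; ∃; ∃-syntax; ∃₂; _×_; _,_; proj₁; proj₂)
open import Data.Rational as ℚ using (ℚ; 0ℚ; 1ℚ)
import Data.Rational.Properties as ℚ
open import Data.Sum.Base using (_⊎_; inj₁; inj₂)
open import Data.Unit.Base using (⊤; tt)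
open import Data.Vec.Base as Vec using (Vec; []; _∷_)
import Data.Vec.Properties as Vec
open import Data.Vec.Relation.Unary.All as VAll using ([]; _∷_) renaming (All to VAll)
open import Function.Base using (_∘_; id; flip)
open import Function.Bundles using (_⇔_; Inverse; mk⇔)
open import Relation.Binary.Bundles using (Setoid)
open import Relation.Binary.Definitions using (DecidableEquality; tri<; tri≈; tri>)
open import Relation.Binary.PropositionalEquality
open import Relation.Nullary using (¬_; Dec; yes; no; does; contradiction; ¬?; _×-dec_; _→-dec_; _⊎-dec_)
import Relation.Nullary.Decidable as Dec
open import Relation.Unary using (Pred; Decidable)
import Algebra.Solver.Ring.NaturalCoefficients.Default as SemiringSolver
import Algebra.Properties.Ring as RingProperties
open import Algebra.Structures using (IsCommutativeRing)
import Data.Fin.Properties as Fin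
import Data.List.Relation.Binary.Permutation.Setoid as Permutation
import Data.List.Relation.Binary.Permutation.Setoid.Properties as PermutationProperties
import Data.List.Membership.Setoid as Membership
import Data.List.Membership.Setoid.Properties as MembershipProperties
import Data.List.Relation.Unary.Unique.Setoid as UniqueSetoid
open import Data.Nat.GCD using (gcd; gcd-greatest; gcd[m,n]∣m; gcd[m,n]∣n; gcd[m,n]≡0⇒n≡0)
import Data.Rational.Solver as ℚ
import Data.Rational.Unnormalised.Base as ℚᵘ
import Data.Rational.Unnormalised.Properties as ℚᵘ
open import Data.List.Relation.Binary.Permutation.Propositional using (_↭_; ↭-sym; ↭⇒↭ₛ)
import Data.List.Relation.Binary.Permutation.Propositional.Properties as ↭
open import Data.Nat.Primality using (Prime; prime⇒irreducible; prime⇒nonTrivial)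
open import Data.Nat.Primality.Factorisation using (PrimeFactorisation; factorise; factors; factorisationHasAllPrimeFactors; factorisationUnique)
import Data.Nat.ListAction as ℕ
import Data.Nat.ListAction.Properties as ℕ
open import Data.List.Relation.Unary.Unique.DecPropositional ℕ._≟_ using (unique?)
open import Data.Nat.Coprimality using (Coprime; coprime-divisor)
open import Data.Nat.Combinatorics using (_C_; nCk+nC[k+1]≡[n+1]C[k+1]; nC1≡n)
import Data.Integer.Base as Int
import Data.Rational.Base as Rat

-- A relation of a tuple is determined only up to a factor from GF(q^l), so the space spanned by its
-- entries is determined only up to H; hence whole orbits are chosen. Relation vectors have k
-- entries, so the subspaces of GF(q^l) enter as spans of k-tuples, and the number of k-tuples
-- spanning one of them cancels at the end.
--
-- λ is constant because rank at least 3 puts a nonzero coefficient of a outside the two positions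
-- of t: one vector of the prefix is forced, the other k - 3 only have to avoid a span of known
-- dimension, and the number of choices depends on neither a nor t. With Q = q^l this gives λ E (Q -
-- 1) = w A (Q - 1) + N B, where N is the number of chosen vectors a, A and B count the prefixes
-- independent over GF(q^l) and those with a given relation, and E counts the prefixes of t within
-- one block. Counts stay in ℕ with denominators cleared; the quotients of the formula arise when E
-- (Q - 1) is cancelled in ℚ.
--
-- Cardinalities replace dimension theory: a subspace as large as one containing it is equal to it,
-- and subfields are compared by their orders.

private
  variable
    ℓp ℓr : Level
    X Y : Set
    Φ Ψ : Set ℓp

-- Indicators and counting over lists

⟦_⟧ : Dec Φ → ℕ
⟦ yes _ ⟧ = 1
⟦ no _  ⟧ = 0

⟦⟧-yes : (p? : Dec Φ) → Φ → ⟦ p? ⟧ ≡ 1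
⟦⟧-yes (yes _) p = refl
⟦⟧-yes (no ¬p) p = contradiction p ¬p

⟦⟧-no : (p? : Dec Φ) → ¬ Φ → ⟦ p? ⟧ ≡ 0
⟦⟧-no (yes p) ¬p = contradiction p ¬p
⟦⟧-no (no _)  ¬p = refl

⟦⟧-cong : (p? : Dec Φ) (p′? : Dec Ψ) → (Φ → Ψ) → (Ψ → Φ) → ⟦ p? ⟧ ≡ ⟦ p′? ⟧
⟦⟧-cong (yes p) p′? f g = sym (⟦⟧-yes p′? (f p))
⟦⟧-cong (no ¬p) p′? f g = sym (⟦⟧-no p′? (¬p ∘ g))

-- The usual end of a double count: a row has exactly one witness when `Φ` holds and none otherwise,
-- so it counts as the indicator of `Φ`.
⟦⟧-unique : (p? : Dec Φ) {n : ℕ} → (Φ → n ≡ 1) → (¬ Φ → n ≡ 0) → n ≡ ⟦ p? ⟧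
⟦⟧-unique (yes p) f g = f p
⟦⟧-unique (no ¬p) f g = g ¬p

⟦⟧-× : (p? : Dec Φ) (p′? : Dec Ψ) → ⟦ p? ×-dec p′? ⟧ ≡ ⟦ p? ⟧ * ⟦ p′? ⟧
⟦⟧-× (yes _) (yes _) = refl
⟦⟧-× (yes _) (no _)  = refl
⟦⟧-× (no _)  _       = refl

⟦⟧-*-cong : (p? : Dec Φ) {m n : ℕ} → (Φ → m ≡ n) → ⟦ p? ⟧ * m ≡ ⟦ p? ⟧ * n
⟦⟧-*-cong (yes p) f = cong (1 *_) (f p)
⟦⟧-*-cong (no _)  f = refl

sumOver : List X → (X → ℕ) → ℕ
sumOver []       f = 0
sumOver (x ∷ xs) f = f x + sumOver xs f

#_∈_ : {P : Pred X ℓp} → Decidable P → List X → ℕ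
# P? ∈ xs = sumOver xs (λ x → ⟦ P? x ⟧)

sumOver-cong∈ : (xs : List X) {f g : X → ℕ} → (∀ {x} → x ∈ xs → f x ≡ g x) → sumOver xs f ≡ sumOver xs g
sumOver-cong∈ []       e = refl
sumOver-cong∈ (x ∷ xs) e = cong₂ _+_ (e (here refl)) (sumOver-cong∈ xs (e ∘ there))

sumOver-cong : (xs : List X) {f g : X → ℕ} → (∀ x → f x ≡ g x) → sumOver xs f ≡ sumOver xs g
sumOver-cong xs e = sumOver-cong∈ xs (λ {x} _ → e x)

sumOver-0 : (xs : List X) → sumOver xs (λ _ → 0) ≡ 0
sumOver-0 []       = refl
sumOver-0 (x ∷ xs) = sumOver-0 xs

sumOver-const : (xs : List X) (c : ℕ) → sumOver xs (λ _ → c) ≡ length xs * c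
sumOver-const []       c = refl
sumOver-const (x ∷ xs) c = cong (_+_ c) (sumOver-const xs c)

sumOver-+ : (xs : List X) (f g : X → ℕ) → sumOver xs (λ x → f x + g x) ≡ sumOver xs f + sumOver xs g
sumOver-+ []       f g = refl
sumOver-+ (x ∷ xs) f g = trans (cong (_+_ (f x + g x)) (sumOver-+ xs f g)) (interchange (f x) (g x) _ _)
  where
  interchange : ∀ a b c d → (a + b) + (c + d) ≡ (a + c) + (b + d)
  interchange = solve 4 (λ a b c d → (a :+ b) :+ (c :+ d) := (a :+ c) :+ (b :+ d)) refl
    where open ℕ.+-*-Solver

sumOver-*ʳ : (xs : List X) (f : X → ℕ) (c : ℕ) → sumOver xs (λ x → f x * c) ≡ sumOver xs f * c
sumOver-*ʳ []       f c = refl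
sumOver-*ʳ (x ∷ xs) f c = trans (cong (_+_ (f x * c)) (sumOver-*ʳ xs f c)) (sym (ℕ.*-distribʳ-+ c (f x) _))

sumOver-*ˡ : (xs : List X) (f : X → ℕ) (c : ℕ) → sumOver xs (λ x → c * f x) ≡ c * sumOver xs f
sumOver-*ˡ xs f c = trans (sumOver-cong xs (λ x → ℕ.*-comm c (f x))) (trans (sumOver-*ʳ xs f c) (ℕ.*-comm _ c))

sumOver-++ : (xs ys : List X) (f : X → ℕ) → sumOver (xs ++ ys) f ≡ sumOver xs f + sumOver ys f
sumOver-++ []       ys f = refl
sumOver-++ (x ∷ xs) ys f = trans (cong (_+_ (f x)) (sumOver-++ xs ys f)) (sym (ℕ.+-assoc (f x) _ _))

sumOver-map : (h : Y → X) (xs : List Y) (f : X → ℕ) → sumOver (map h xs) f ≡ sumOver xs (f ∘ h)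
sumOver-map h []       f = refl
sumOver-map h (x ∷ xs) f = cong (_+_ (f (h x))) (sumOver-map h xs f)

sumOver-concatMap : (h : Y → List X) (xs : List Y) (f : X → ℕ) →
                    sumOver (concatMap h xs) f ≡ sumOver xs (λ x → sumOver (h x) f)
sumOver-concatMap h []       f = refl
sumOver-concatMap h (x ∷ xs) f = trans (sumOver-++ (h x) _ f) (cong (_+_ (sumOver (h x) f)) (sumOver-concatMap h xs f))

sumOver-swap : (xs : List X) (ys : List Y) (f : X → Y → ℕ) →
               sumOver xs (λ x → sumOver ys (f x)) ≡ sumOver ys (λ y → sumOver xs (λ x → f x y))
sumOver-swap []       ys f = sym (sumOver-0 ys)
sumOver-swap (x ∷ xs) ys f = trans (cong (_+_ (sumOver ys (f x))) (sumOver-swap xs ys f)) (sym (sumOver-+ ys (f x) _))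

-- Takes the place of explicit bijections: a count is transferred between two lists through a
-- decidable relation whose rows and columns are evaluated separately.
doubleCount : (xs : List X) (ys : List Y) {R : X → Y → Set ℓr} (R? : ∀ x y → Dec (R x y))
              {f : X → ℕ} {g : Y → ℕ} →
              (∀ {x} → x ∈ xs → # R? x ∈ ys ≡ f x) →
              (∀ {y} → y ∈ ys → # (λ x → R? x y) ∈ xs ≡ g y) →
              sumOver xs f ≡ sumOver ys g
doubleCount xs ys R? ef eg =
  trans (sym (sumOver-cong∈ xs ef)) (trans (sumOver-swap xs ys _) (sumOver-cong∈ ys eg))

sumOver-mono : (xs : List X) {f g : X → ℕ} → (∀ x → f x ≤ g x) → sumOver xs f ≤ sumOver xs g
sumOver-mono []       f≤g = z≤n
sumOver-mono (x ∷ xs) f≤g = ℕ.+-mono-≤ (f≤g x) (sumOver-mono xs f≤g)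

#-cong : {P P′ : Pred X ℓp} (P? : Decidable P) (P′? : Decidable P′) (xs : List X) →
         (∀ x → P x → P′ x) → (∀ x → P′ x → P x) → # P? ∈ xs ≡ # P′? ∈ xs
#-cong P? P′? xs f g = sumOver-cong xs (λ x → ⟦⟧-cong (P? x) (P′? x) (f x) (g x))

#-none : {P : Pred X ℓp} (P? : Decidable P) (xs : List X) → (∀ {x} → x ∈ xs → ¬ P x) → # P? ∈ xs ≡ 0
#-none P? xs ¬P = trans (sumOver-cong∈ xs (λ x∈ → ⟦⟧-no (P? _) (¬P x∈))) (sumOver-0 xs)

#-all : {P : Pred X ℓp} (P? : Decidable P) (xs : List X) → (∀ x → P x) → # P? ∈ xs ≡ length xs
#-all P? xs p = trans (sumOver-cong xs (λ x → ⟦⟧-yes (P? x) (p x))) (trans (sumOver-const xs 1) (ℕ.*-identityʳ _))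

#-filter : {P : Pred X ℓp} (P? : Decidable P) (xs : List X) → length (filter P? xs) ≡ # P? ∈ xs
#-filter P? []       = refl
#-filter P? (x ∷ xs) with P? x
... | yes _ = cong suc (#-filter P? xs)
... | no  _ = #-filter P? xs

sumOver-filter : {P : Pred X ℓp} (P? : Decidable P) (xs : List X) (f : X → ℕ) →
                 sumOver (filter P? xs) f ≡ sumOver xs (λ x → ⟦ P? x ⟧ * f x)
sumOver-filter P? []       f = refl
sumOver-filter P? (x ∷ xs) f with P? x
... | yes _ = cong₂ _+_ (sym (ℕ.+-identityʳ (f x))) (sumOver-filter P? xs f)
... | no  _ = sumOver-filter P? xs f

#-¬ : {P : Pred X ℓp} (P? : Decidable P) (xs : List X) → # P? ∈ xs + # (¬? ∘ P?) ∈ xs ≡ length xs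
#-¬ P? []       = refl
#-¬ P? (x ∷ xs) with P? x
... | yes _ = cong suc (#-¬ P? xs)
... | no  _ = trans (ℕ.+-suc _ _) (cong suc (#-¬ P? xs))

#-one : {P : Pred X ℓp} (P? : Decidable P) {xs : List X} {x : X} → Unique xs → x ∈ xs → P x →
        (∀ {y} → y ∈ xs → P y → y ≡ x) → # P? ∈ xs ≡ 1
#-one P? {x ∷ xs} (x∉ ∷ u) (here refl) px h =
  cong₂ _+_ (⟦⟧-yes (P? x) px) (#-none P? xs (λ y∈ py → All.lookup x∉ y∈ (sym (h (there y∈) py))))
#-one P? {z ∷ xs} (z∉ ∷ u) (there x∈) px h =
  cong₂ _+_ (⟦⟧-no (P? z) (λ pz → All.lookup z∉ x∈ (h (here refl) pz))) (#-one P? u x∈ px (h ∘ there))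

#-witness : {P : Pred X ℓp} (P? : Decidable P) (xs : List X) → 0 < # P? ∈ xs → ∃[ x ] x ∈ xs × P x
#-witness P? (x ∷ xs) pos with P? x
... | yes px = x , here refl , px
... | no  _  = let y , y∈ , py = #-witness P? xs pos in y , there y∈ , py

#-⊆ : {P : Pred X ℓp} {P′ : Pred X ℓr} (P? : Decidable P) (P′? : Decidable P′) (xs : List X) → (∀ x → P x → P′ x) →
      # P? ∈ xs ≤ # P′? ∈ xs
#-⊆ P? P′? xs P⊆P′ = sumOver-mono xs (λ x → mono (P? x) (P′? x) (P⊆P′ x))
  where
  mono : {P : Set ℓp} {P′ : Set ℓr} (p? : Dec P) (p′? : Dec P′) → (P → P′) → ⟦ p? ⟧ ≤ ⟦ p′? ⟧
  mono (yes p) p′? f = ℕ.≤-reflexive (sym (⟦⟧-yes p′? (f p)))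
  mono (no _)  p′? f = z≤n

-- A point of `P′` outside `P` would leave more points of `P` than of `P′` in the rest of the list.
-- This turns equal cardinalities into equality of sets, for subspaces as for subfields.
#-⊆-≡ : {P : Pred X ℓp} {P′ : Pred X ℓr} (P? : Decidable P) (P′? : Decidable P′) (xs : List X) → (∀ x → P x → P′ x) →
        # P′? ∈ xs ≤ # P? ∈ xs → ∀ {x} → x ∈ xs → P′ x → P x
#-⊆-≡ P? P′? (y ∷ ys) P⊆P′ le x∈ p′ with P? y | P′? y
#-⊆-≡ P? P′? (y ∷ ys) P⊆P′ le (here refl) p′ | yes p | _ = p
#-⊆-≡ P? P′? (y ∷ ys) P⊆P′ le (there x∈)  p′ | yes p | yes _ = #-⊆-≡ P? P′? ys P⊆P′ (ℕ.s≤s⁻¹ le) x∈ p′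
#-⊆-≡ P? P′? (y ∷ ys) P⊆P′ le x∈          p′ | yes p | no ¬p′ = contradiction (P⊆P′ y p) ¬p′
#-⊆-≡ P? P′? (y ∷ ys) P⊆P′ le x∈          p′ | no _  | yes _ = contradiction (ℕ.≤-trans le (#-⊆ P? P′? ys P⊆P′)) ℕ.1+n≰n
#-⊆-≡ P? P′? (y ∷ ys) P⊆P′ le (here refl) p′ | no _  | no ¬p′ = contradiction p′ ¬p′
#-⊆-≡ P? P′? (y ∷ ys) P⊆P′ le (there x∈)  p′ | no _  | no _ = #-⊆-≡ P? P′? ys P⊆P′ le x∈ p′

-- Finite types and tuples

record Finite (A : Set) : Set where
  infix 4 _≟_
  field
    elems    : List A
    complete : ∀ x → x ∈ elems
    unique   : Unique elems
    _≟_      : DecidableEquality A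

  size : ℕ
  size = length elems

  ∃? : {P : Pred A ℓp} → Decidable P → Dec (∃ P)
  ∃? P? = Dec.map′ (λ a → let x , _ , p = find a in x , p) (λ (x , p) → lose (complete x) p) (Any.any? P? elems)

  ∀? : {P : Pred A ℓp} → Decidable P → Dec (∀ x → P x)
  ∀? P? = Dec.map′ (λ a x → All.lookup a (complete x)) (λ p → All.tabulate (λ {x} _ → p x)) (All.all? P? elems)

  count : {P : Pred A ℓp} → Decidable P → ℕ
  count P? = # P? ∈ elems

  count-one : {P : Pred A ℓp} (P? : Decidable P) {x : A} → P x → (∀ y → P y → y ≡ x) → count P? ≡ 1
  count-one P? px h = #-one P? unique (complete _) px (λ {y} _ → h y)

module _ {A : Set} (fin : Finite A) where
  open Finite fin

  tuples : ∀ n → List (Vec A n)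
  tuples zero    = [] ∷ []
  tuples (suc n) = concatMap (λ xs → map (_∷ xs) elems) (tuples n)

  sumOver-tuples : ∀ n (f : Vec A (suc n) → ℕ) →
                   sumOver (tuples (suc n)) f ≡ sumOver (tuples n) (λ xs → sumOver elems (λ x → f (x ∷ xs)))
  sumOver-tuples n f = trans (sumOver-concatMap _ (tuples n) f) (sumOver-cong (tuples n) (λ xs → sumOver-map (_∷ xs) elems f))

  finiteVec : ∀ n → Finite (Vec A n)
  finiteVec n = record { elems = tuples n ; complete = complete′ ; unique = unique′ n ; _≟_ = Vec.≡-dec _≟_ }
    where
    complete′ : ∀ {n} (xs : Vec A n) → xs ∈ tuples n
    complete′ []       = here refl
    complete′ (x ∷ xs) = ∈-concat⁺′ (∈-map⁺ (_∷ xs) (complete x)) (∈-map⁺ _ (complete′ xs))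

    unique′ : ∀ n → Unique (tuples n)
    unique′ zero    = [] ∷ []
    unique′ (suc n) = Unique.concat⁺
      (All.map⁺ (All.tabulate (λ {xs} _ → Unique.map⁺ Vec.∷-injectiveˡ unique)))
      (AllPairs.map⁺ (AllPairs.map (λ xs≢ys {_} (p , r) → xs≢ys (disjoint p r)) (unique′ n)))
      where
      disjoint : ∀ {v} {xs ys : Vec A n} → v ∈ map (_∷ xs) elems → v ∈ map (_∷ ys) elems → xs ≡ ys
      disjoint p r with ∈-map⁻ _ p | ∈-map⁻ _ r
      ... | _ , _ , refl | _ , _ , refl = refl

  length-tuples : ∀ n → length (tuples n) ≡ size ^ n
  length-tuples n = trans (sym (ones (tuples n))) (total n)
    where
    ones : {B : Set} (xs : List B) → sumOver xs (λ _ → 1) ≡ length xs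
    ones xs = trans (sumOver-const xs 1) (ℕ.*-identityʳ _)

    total : ∀ n → sumOver (tuples n) (λ _ → 1) ≡ size ^ n
    total zero    = refl
    total (suc n) = trans (sumOver-tuples n _)
      (trans (sumOver-cong (tuples n) (λ _ → trans (ones elems) (sym (ℕ.*-identityʳ size))))
      (trans (sumOver-*ˡ (tuples n) (λ _ → 1) size) (cong (size *_) (total n))))

  #-VAll : {P : Pred A ℓp} (P? : Decidable P) (n : ℕ) → # VAll.all? P? ∈ tuples n ≡ count P? ^ n
  #-VAll P? zero    = refl
  #-VAll P? (suc n) = trans (sumOver-tuples n _)
    (trans (sumOver-cong (tuples n) (λ xs → trans
      (sumOver-cong elems (λ x → trans
        (⟦⟧-cong (VAll.all? P? (x ∷ xs)) (P? x ×-dec VAll.all? P? xs) VAll.uncons (λ (p , ps) → p ∷ ps))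
        (⟦⟧-× (P? x) (VAll.all? P? xs))))
      (sumOver-*ʳ elems _ _)))
    (trans (sumOver-*ˡ (tuples n) _ (count P?)) (cong (count P? *_) (#-VAll P? n))))

-- Representatives of equivalence classes

module Representatives {A : Set} {_~_ : A → A → Set} (~? : ∀ x y → Dec (x ~ y))
                       (~-refl : ∀ {x} → x ~ x) (~-sym : ∀ {x y} → x ~ y → y ~ x)
                       (~-trans : ∀ {x y z} → x ~ y → y ~ z → x ~ z) where

  -- Filtering the representatives of the tail, rather than the tail itself, keeps the recursion
  -- structural.
  reps : List A → List A
  reps []       = []
  reps (x ∷ xs) = x ∷ filter (¬? ∘ ~? x) (reps xs)

  reps-⊆ : ∀ {x} xs → x ∈ reps xs → x ∈ xs
  reps-⊆ (y ∷ xs) (here e)   = here e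
  reps-⊆ (y ∷ xs) (there x∈) = there (reps-⊆ xs (proj₁ (∈-filter⁻ (¬? ∘ ~? y) x∈)))

  reps-cover : ∀ {x} xs → x ∈ xs → ∃[ y ] y ∈ reps xs × x ~ y
  reps-cover (x ∷ xs) (here refl) = x , here refl , ~-refl
  reps-cover (z ∷ xs) (there x∈) with reps-cover xs x∈
  ... | y , y∈ , x~y with ~? z y
  ... | yes z~y = z , here refl , ~-trans x~y (~-sym z~y)
  ... | no ¬z~y = y , there (∈-filter⁺ (¬? ∘ ~? z) y∈ ¬z~y) , x~y

  Inequivalent : List A → Set
  Inequivalent = AllPairs (λ x y → ¬ (x ~ y))

  reps-inequivalent : ∀ xs → Inequivalent (reps xs)
  reps-inequivalent []       = []
  reps-inequivalent (x ∷ xs) = All.all-filter (¬? ∘ ~? x) (reps xs) ∷ AllPairs.filter⁺ (¬? ∘ ~? x) (reps-inequivalent xs)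

  #-inequivalent : ∀ x {ys} → Inequivalent ys → # ~? x ∈ ys ≡ ⟦ Any.any? (~? x) ys ⟧
  #-inequivalent x {ys} ne = ⟦⟧-unique (Any.any? (~? x) ys) (one ne) (λ ¬any → #-none (~? x) ys (λ y∈ x~y → ¬any (lose y∈ x~y)))
    where
    one : ∀ {ys} → Inequivalent ys → Any (x ~_) ys → # ~? x ∈ ys ≡ 1
    one {y ∷ ys} (y≁ ∷ ne) (here x~y) = cong₂ _+_ (⟦⟧-yes (~? x y) x~y)
      (#-none (~? x) ys (λ z∈ x~z → All.lookup y≁ z∈ (~-trans (~-sym x~y) x~z)))
    one {y ∷ ys} (y≁ ∷ ne) (there any) = cong₂ _+_
      (⟦⟧-no (~? x y) (λ x~y → let z , z∈ , x~z = find any in All.lookup y≁ z∈ (~-trans (~-sym x~y) x~z)))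
      (one ne any)

module _ {a ℓ} (S : Setoid a ℓ) where
  open Setoid S using (_≈_) renaming (trans to ≈-trans; sym to ≈-sym)
  open Permutation S using (↭-reflexive-≋; prep; ↭-reflexive) renaming (_↭_ to _↭ₛ_; ↭-trans to ↭ₛ-trans; ↭-sym to ↭ₛ-sym)
  open Membership S using () renaming (_∈_ to _∈ₛ_)

  -- Pigeonhole by removing one matching element of `ys` at a time; uniqueness of `xs` keeps the
  -- later elements in what remains. An injective map of a finite list into itself is thereby a
  -- permutation, which serves both Fermat's theorem and the invariance of the blocks.
  unique-⊆⇒↭ : ∀ {xs ys} → UniqueSetoid.Unique S xs → (∀ {x} → x ∈ xs → x ∈ₛ ys) → length ys ≤ length xs → xs ↭ₛ ys
  unique-⊆⇒↭ {[]}     {[]} _ _ _ = ↭-reflexive refl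
  unique-⊆⇒↭ {x ∷ xs} {ys} (x∉xs ∷ u) xs⊆ys le with MembershipProperties.∈-∃++ S (xs⊆ys (here refl))
  ... | as , bs , y , x≈y , ys≋ = ↭ₛ-trans (prep x≈y (unique-⊆⇒↭ u xs⊆ le′)) (↭ₛ-sym ys↭)
    where
    ys↭ : ys ↭ₛ y ∷ as ++ bs
    ys↭ = ↭ₛ-trans (↭-reflexive-≋ ys≋) (PermutationProperties.↭-shift S as bs)

    le′ : length (as ++ bs) ≤ length xs
    le′ = ℕ.s≤s⁻¹ (subst (_≤ suc (length xs)) (PermutationProperties.xs↭ys⇒|xs|≡|ys| S ys↭) le)

    xs⊆ : ∀ {z} → z ∈ xs → z ∈ₛ as ++ bs
    xs⊆ z∈ with PermutationProperties.∈-resp-↭ S ys↭ (xs⊆ys (there z∈))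
    ... | here z≈y  = contradiction (≈-trans x≈y (≈-sym z≈y)) (All.lookup x∉xs z∈)
    ... | there z∈′ = z∈′

-- Arithmetic and polynomial functions

module FieldTheory {Q : ℕ} (L : FiniteField Q) where
  open FiniteField L hiding (commutativeRing)
  open FiniteField L using (commutativeRing)
  open CommutativeRing commutativeRing public
    using (+-assoc; +-comm; +-identityˡ; +-identityʳ; -‿inverseˡ; -‿inverseʳ; *-assoc; *-comm; *-identityˡ; *-identityʳ;
           distribˡ; distribʳ; zeroˡ; zeroʳ)
  open RingProperties ring public using (-‿distribˡ-*; -‿distribʳ-*; -1*x≈-x; -‿involutive; -0#≈0#; -‿+-comm)
  module Solver = SemiringSolver (CommutativeRing.commutativeSemiring commutativeRing)

  finite : Finite Carrier
  finite = record
    { elems    = map from (allFin Q)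
    ; complete = λ x → subst (_∈ map from (allFin Q)) (strictlyInverseʳ x) (∈-map⁺ from (∈-allFin (to x)))
    ; unique   = Unique.map⁺ (λ {i} {j} e → trans (sym (strictlyInverseˡ i)) (trans (cong to e) (strictlyInverseˡ j))) (Unique.allFin⁺ Q)
    ; _≟_      = λ x y → Dec.map′ (λ e → trans (sym (strictlyInverseʳ x)) (trans (cong from e) (strictlyInverseʳ y))) (cong to) (to x Fin.≟ to y)
    }
    where open Inverse enumeration

  open Finite finite public

  size≡ : size ≡ Q
  size≡ = trans (List.length-map _ (allFin Q)) (List.length-tabulate id)

  count-nonzero : count (λ x → ¬? (x ≟ 𝟘)) ≡ Q ∸ 1
  count-nonzero = cong (_∸ 1) (trans (cong (_+ count (λ x → ¬? (x ≟ 𝟘))) (sym (count-one (_≟ 𝟘) refl (λ _ e → e)))) (trans (#-¬ (_≟ 𝟘) elems) size≡))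

  infixl 6 _⊖_
  _⊖_ : Carrier → Carrier → Carrier
  x ⊖ y = x ⊕ (⊖ y)

  ⊖-⊕ : ∀ x y → (x ⊖ y) ⊕ y ≡ x
  ⊖-⊕ x y = trans (+-assoc x _ y) (trans (cong (x ⊕_) (-‿inverseˡ y)) (+-identityʳ x))

  ⊕-⊖ : ∀ x y → (x ⊕ y) ⊖ y ≡ x
  ⊕-⊖ x y = trans (+-assoc x y _) (trans (cong (x ⊕_) (-‿inverseʳ y)) (+-identityʳ x))

  ⊕-cancelʳ : ∀ {x y} z → x ⊕ z ≡ y ⊕ z → x ≡ y
  ⊕-cancelʳ {x} {y} z e = trans (sym (⊕-⊖ x z)) (trans (cong (_⊖ z) e) (⊕-⊖ y z))

  ⊖≡0 : ∀ {x y} → x ⊖ y ≡ 𝟘 → x ≡ y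
  ⊖≡0 {x} {y} e = trans (sym (⊖-⊕ x y)) (trans (cong (_⊕ y) e) (+-identityˡ y))

  𝟙≢𝟘 : 𝟙 ≢ 𝟘
  𝟙≢𝟘 = 𝟘≢𝟙 ∘ sym

  ⊗≡0 : ∀ {x y} → x ≢ 𝟘 → x ⊗ y ≡ 𝟘 → y ≡ 𝟘
  ⊗≡0 {x} {y} x≢0 e with inverse x x≢0
  ... | x⁻¹ , e′ = trans (sym (*-identityˡ y)) (trans (cong (_⊗ y) (sym e′))
                   (trans (*-assoc x⁻¹ x y) (trans (cong (x⁻¹ ⊗_) e) (zeroʳ x⁻¹))))

  ⊗≢0 : ∀ {x y} → x ≢ 𝟘 → y ≢ 𝟘 → x ⊗ y ≢ 𝟘
  ⊗≢0 x≢0 y≢0 e = y≢0 (⊗≡0 x≢0 e)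

  ⊗-cancelˡ : ∀ {x y z} → x ≢ 𝟘 → x ⊗ y ≡ x ⊗ z → y ≡ z
  ⊗-cancelˡ {x} {y} {z} x≢0 e = ⊖≡0 (⊗≡0 x≢0 (trans (distribˡ x y (⊖ z))
    (trans (cong₂ _⊕_ e (sym (-‿distribʳ-* x z))) (-‿inverseʳ (x ⊗ z)))))

  ⊗-inverse : ∀ {x x⁻¹} → x⁻¹ ⊗ x ≡ 𝟙 → ∀ y → x ⊗ (x⁻¹ ⊗ y) ≡ y
  ⊗-inverse {x} {x⁻¹} e y = trans (sym (*-assoc x x⁻¹ y)) (trans (cong (_⊗ y) (trans (*-comm x x⁻¹) e)) (*-identityˡ y))

  inverse≢0 : ∀ {x y} → y ⊗ x ≡ 𝟙 → y ≢ 𝟘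
  inverse≢0 {x} e refl = 𝟘≢𝟙 (trans (sym (zeroˡ x)) e)

  infixr 8 _↑_
  _↑_ : Carrier → ℕ → Carrier
  x ↑ zero  = 𝟙
  x ↑ suc n = x ⊗ (x ↑ n)

  𝟙↑ : ∀ n → 𝟙 ↑ n ≡ 𝟙
  𝟙↑ zero    = refl
  𝟙↑ (suc n) = trans (*-identityˡ _) (𝟙↑ n)

  𝟘↑ : ∀ {n} → 0 < n → 𝟘 ↑ n ≡ 𝟘
  𝟘↑ {suc n} _ = zeroˡ _

  ⊗-↑ : ∀ x y n → (x ⊗ y) ↑ n ≡ (x ↑ n) ⊗ (y ↑ n)
  ⊗-↑ x y zero    = sym (*-identityˡ 𝟙)
  ⊗-↑ x y (suc n) = trans (cong ((x ⊗ y) ⊗_) (⊗-↑ x y n))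
    (solve 4 (λ x y u v → (x :* y) :* (u :* v) := (x :* u) :* (y :* v)) refl x y (x ↑ n) (y ↑ n))
    where open Solver

  ↑-+ : ∀ x m n → x ↑ (m + n) ≡ (x ↑ m) ⊗ (x ↑ n)
  ↑-+ x zero    n = sym (*-identityˡ _)
  ↑-+ x (suc m) n = trans (cong (x ⊗_) (↑-+ x m n)) (sym (*-assoc x _ _))

  ↑-* : ∀ x m n → x ↑ (m * n) ≡ (x ↑ m) ↑ n
  ↑-* x zero    n = sym (𝟙↑ n)
  ↑-* x (suc m) n = trans (↑-+ x n (m * n)) (trans (cong ((x ↑ n) ⊗_) (↑-* x m n)) (sym (⊗-↑ x (x ↑ m) n)))

  -- Polynomial functions of degree below n in Horner form. They are functions rather than
  -- coefficient lists because only values and roots are compared.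
  Deg< : ℕ → (Carrier → Carrier) → Set
  Deg< zero    f = ∀ x → f x ≡ 𝟘
  Deg< (suc n) f = ∃₂ λ c g → Deg< n g × (∀ x → f x ≡ c ⊕ (x ⊗ g x))

  Deg<-weaken : ∀ n {f} → Deg< n f → Deg< (suc n) f
  Deg<-weaken zero    {f} d = 𝟘 , f , d , λ x → trans (d x) (sym (trans (+-identityˡ _) (trans (cong (x ⊗_) (d x)) (zeroʳ x))))
  Deg<-weaken (suc n) (c , g , d , e) = c , g , Deg<-weaken n d , e

  Deg<-weaken-≤ : ∀ {m n f} → m ≤ n → Deg< m f → Deg< n f
  Deg<-weaken-≤ {m} m≤n d with ℕ.≤⇒≤′ m≤n
  ... | ℕ.≤′-reflexive refl = d
  ... | ℕ.≤′-step m≤′n      = Deg<-weaken _ (Deg<-weaken-≤ (ℕ.≤′⇒≤ m≤′n) d)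

  Deg<-shift : ∀ {n f} → Deg< n f → Deg< (suc n) (λ x → x ⊗ f x)
  Deg<-shift {f = f} d = 𝟘 , f , d , λ x → sym (+-identityˡ _)

  Deg<-const : ∀ c → Deg< 1 (λ _ → c)
  Deg<-const c = c , (λ _ → 𝟘) , (λ _ → refl) , λ x → sym (trans (cong (c ⊕_) (zeroʳ x)) (+-identityʳ c))

  Deg<-↑ : ∀ n → Deg< (suc n) (_↑ n)
  Deg<-↑ zero    = Deg<-const 𝟙
  Deg<-↑ (suc n) = Deg<-shift (Deg<-↑ n)

  Deg<-+ : ∀ n {f g} → Deg< n f → Deg< n g → Deg< n (λ x → f x ⊕ g x)
  Deg<-+ zero    d e = λ x → trans (cong₂ _⊕_ (d x) (e x)) (+-identityˡ 𝟘)
  Deg<-+ (suc n) (c , f , d , p) (c′ , g , e , r) = c ⊕ c′ , _ , Deg<-+ n d e , λ x → trans (cong₂ _⊕_ (p x) (r x))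
    (solve 5 (λ x c c′ u v → (c :+ x :* u) :+ (c′ :+ x :* v) := (c :+ c′) :+ x :* (u :+ v)) refl x c c′ (f x) (g x))
    where open Solver

  Deg<-* : ∀ n a {f} → Deg< n f → Deg< n (λ x → a ⊗ f x)
  Deg<-* zero    a d = λ x → trans (cong (a ⊗_) (d x)) (zeroʳ a)
  Deg<-* (suc n) a (c , f , d , p) = a ⊗ c , _ , Deg<-* n a d , λ x → trans (cong (a ⊗_) (p x))
    (solve 4 (λ x a c u → a :* (c :+ x :* u) := a :* c :+ x :* (a :* u)) refl x a c (f x))
    where open Solver

  -- Synthetic division by x - r in Horner form; the remainder is the value at r.
  Deg<-divide : ∀ n {f} r → Deg< (suc n) f → ∃[ h ] Deg< n h × (∀ x → f x ≡ f r ⊕ ((x ⊖ r) ⊗ h x))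
  Deg<-divide zero {f} r (c , g , d , e) = g , d , λ x → trans (const≡ x) (sym (trans (cong₂ _⊕_ (const≡ r) (trans (cong ((x ⊖ r) ⊗_) (d x)) (zeroʳ _))) (+-identityʳ c)))
    where
    const≡ : ∀ x → f x ≡ c
    const≡ x = trans (e x) (trans (cong (c ⊕_) (trans (cong (x ⊗_) (d x)) (zeroʳ x))) (+-identityʳ c))
  Deg<-divide (suc n) {f} r (c , g , d , e) with Deg<-divide n r d
  ... | h , d′ , e′ = (λ x → g r ⊕ (x ⊗ h x)) , (g r , h , d′ , λ _ → refl) , λ x → begin
    f x ≡⟨ e x ⟩
    c ⊕ (x ⊗ g x) ≡⟨ cong₂ (λ u v → c ⊕ (u ⊗ v)) (sym (⊖-⊕ x r)) (e′ x) ⟩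
    c ⊕ (((x ⊖ r) ⊕ r) ⊗ (g r ⊕ ((x ⊖ r) ⊗ h x))) ≡⟨ expand c (x ⊖ r) r (g r) (h x) ⟩
    (c ⊕ (r ⊗ g r)) ⊕ ((x ⊖ r) ⊗ (g r ⊕ (((x ⊖ r) ⊕ r) ⊗ h x))) ≡⟨ cong₂ (λ u v → u ⊕ ((x ⊖ r) ⊗ (g r ⊕ (v ⊗ h x)))) (sym (e r)) (⊖-⊕ x r) ⟩
    f r ⊕ ((x ⊖ r) ⊗ (g r ⊕ (x ⊗ h x)))                           ∎
    where
    open ≡-Reasoning
    -- Here x has been replaced by δ + r with δ = x - r, which leaves an identity of commutative
    -- semirings.
    expand : ∀ c δ r g h → c ⊕ ((δ ⊕ r) ⊗ (g ⊕ (δ ⊗ h))) ≡ (c ⊕ (r ⊗ g)) ⊕ (δ ⊗ (g ⊕ ((δ ⊕ r) ⊗ h)))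
    expand = solve 5 (λ c δ r g h → c :+ (δ :+ r) :* (g :+ δ :* h) := (c :+ r :* g) :+ δ :* (g :+ (δ :+ r) :* h)) refl
      where open Solver

  -- Each root splits off one linear factor, and the other roots, being different, are roots of the
  -- cofactor; after n roots the cofactor is the zero function.
  rootBound : ∀ n {f} → Deg< n f → ∀ rs → Unique rs → All (λ r → f r ≡ 𝟘) rs → n ≤ length rs → ∀ x → f x ≡ 𝟘
  rootBound zero    d rs u z le = d
  rootBound (suc n) {f} d (r ∷ rs) (r∉ ∷ u) (z ∷ zs) (s≤s le) x with Deg<-divide n r d
  ... | h , d′ , e = trans (e′ x) (trans (cong ((x ⊖ r) ⊗_) (rootBound n d′ rs u roots le x)) (zeroʳ _))
    where
    e′ : ∀ x → f x ≡ (x ⊖ r) ⊗ h x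
    e′ x = trans (e x) (trans (cong (_⊕ _) z) (+-identityˡ _))

    roots : All (λ r → h r ≡ 𝟘) rs
    roots = All.tabulate λ {s} s∈ → ⊗≡0 (λ s⊖r≡0 → All.lookup r∉ s∈ (sym (⊖≡0 s⊖r≡0))) (trans (sym (e′ s)) (All.lookup zs s∈))

  #roots≤ : ∀ n {f} → Deg< (suc n) f → ∀ {x} → f x ≢ 𝟘 → count (λ x → f x ≟ 𝟘) ≤ n
  #roots≤ n {f} d {x} fx≢0 = ℕ.≮⇒≥ λ n< → fx≢0 (rootBound (suc n) d (filter root? elems) (Unique.filter⁺ root? unique)
    (All.all-filter root? elems) (subst (suc n ≤_) (sym (#-filter root? elems)) n<) x)
    where root? = λ x → f x ≟ 𝟘

  product : List Carrier → Carrier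
  product = foldr _⊗_ 𝟙

  -- Multiplication by x permutes the nonzero elements of M, so the product of these absorbs a power of x.
  fermat : {M : Pred Carrier 0ℓ} (M? : Decidable M) → (∀ {x y} → M x → M y → M (x ⊗ y)) →
           ∀ {n} → count M? ≡ suc n → M 𝟘 → ∀ {x} → M x → x ≢ 𝟘 → x ↑ n ≡ 𝟙
  fermat {M} M? closed {n} size M0 {x} Mx x≢0 = ⊗-cancelˡ p≢0 (trans (*-comm _ _) (trans (sym (subst (λ k → product (map (x ⊗_) nz) ≡ (x ↑ k) ⊗ product nz) len (product-map nz)))
    (trans (PermutationProperties.foldr-commMonoid (setoid Carrier) *-isCommutativeMonoid nz↭) (sym (*-identityʳ _)))))
    where
    open IsCommutativeRing isCommutativeRing using (*-isCommutativeMonoid)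
    nonzero? : Decidable (λ y → M y × y ≢ 𝟘)
    nonzero? y = M? y ×-dec ¬? (y ≟ 𝟘)

    nz : List Carrier
    nz = filter nonzero? elems

    split : ∀ {y} (m? : Dec (M y)) (z? : Dec (y ≡ 𝟘)) → ⟦ m? ⟧ ≡ ⟦ m? ×-dec ¬? z? ⟧ + ⟦ z? ⟧
    split (yes _)  (yes _)    = refl
    split (yes _)  (no _)     = refl
    split (no ¬My) (yes refl) = contradiction M0 ¬My
    split (no _)   (no _)     = refl

    len : length nz ≡ n
    len = trans (#-filter nonzero? elems) (ℕ.+-cancelʳ-≡ 1 _ n (begin
      count nonzero? + 1 ≡⟨ cong (_+_ (count nonzero?)) (count-one (_≟ 𝟘) refl (λ _ e → e)) ⟨
      count nonzero? + count (_≟ 𝟘) ≡⟨ sumOver-+ elems _ _ ⟨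
      _ ≡⟨ sumOver-cong elems (λ y → split (M? y) (y ≟ 𝟘)) ⟨
      count M? ≡⟨ size ⟩
      suc n ≡⟨ ℕ.+-comm 1 n ⟩
      n + 1                         ∎))
      where open ≡-Reasoning

    product-map : ∀ ys → product (map (x ⊗_) ys) ≡ (x ↑ length ys) ⊗ product ys
    product-map []       = sym (*-identityˡ 𝟙)
    product-map (y ∷ ys) = trans (cong ((x ⊗ y) ⊗_) (product-map ys))
      (solve 4 (λ x y u v → (x :* y) :* (u :* v) := (x :* u) :* (y :* v)) refl x y (x ↑ length ys) (product ys))
      where open Solver

    p≢0 : product nz ≢ 𝟘
    p≢0 = go nz (All.all-filter nonzero? elems)
      where
      go : ∀ ys → All (λ y → M y × y ≢ 𝟘) ys → product ys ≢ 𝟘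
      go []       []                = 𝟙≢𝟘
      go (y ∷ ys) ((_ , y≢0) ∷ all) = ⊗≢0 y≢0 (go ys all)

    nz↭ : Permutation._↭_ (setoid Carrier) (map (x ⊗_) nz) nz
    nz↭ = unique-⊆⇒↭ (setoid Carrier) (Unique.map⁺ (⊗-cancelˡ x≢0) (Unique.filter⁺ nonzero? unique)) sub (ℕ.≤-reflexive (sym (List.length-map _ nz)))
      where
      sub : ∀ {z} → z ∈ map (x ⊗_) nz → z ∈ nz
      sub z∈ with ∈-map⁻ (x ⊗_) z∈
      ... | y , y∈ , refl with ∈-filter⁻ nonzero? {xs = elems} y∈
      ... | _ , My , y≢0 = ∈-filter⁺ nonzero? (complete _) (closed Mx My , ⊗≢0 x≢0 y≢0)

-- A subfield is given by a subset closed under the ring operations; finiteness makes it closed under inversion.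
record Subfield {Q : ℕ} (L : FiniteField Q) : Set₁ where
  open FiniteField L
  field
    Mem       : Pred Carrier 0ℓ
    mem?      : Decidable Mem
    𝟘-closed  : Mem 𝟘
    𝟙-closed  : Mem 𝟙
    ⊕-closed  : ∀ {x y} → Mem x → Mem y → Mem (x ⊕ y)
    ⊗-closed  : ∀ {x y} → Mem x → Mem y → Mem (x ⊗ y)
    ⊖-closed  : ∀ {x} → Mem x → Mem (⊖ x)

  open FieldTheory L hiding (_⊖_)

  card : ℕ
  card = count mem?

  1<card : 1 < card
  1<card = ℕ.≰⇒> λ card≤1 → 𝟙≢𝟘 (#-⊆-≡ (_≟ 𝟘) mem? elems (λ { _ refl → 𝟘-closed })
    (subst (card ≤_) (sym (count-one (_≟ 𝟘) refl (λ _ e → e))) card≤1) (complete 𝟙) 𝟙-closed)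

  ↑-closed : ∀ {x} n → Mem x → Mem (x ↑ n)
  ↑-closed zero    _ = 𝟙-closed
  ↑-closed (suc n) m = ⊗-closed m (↑-closed n m)

  card-1 : ∃[ n ] card ≡ suc (suc n)
  card-1 with card | 1<card
  ... | suc (suc n) | _ = n , refl
  ... | suc zero    | s≤s ()

  -- By Fermat's theorem in the subfield, of order n + 2, the inverse of x is the power x^n, a
  -- product of members.
  inverse-closed : ∀ {x y} → Mem x → y ⊗ x ≡ 𝟙 → Mem y
  inverse-closed {x} {y} m e with card-1
  ... | n , card≡ = subst Mem x↑n≡y (↑-closed n m)
    where
    open ≡-Reasoning
    x↑n≡y : x ↑ n ≡ y
    x↑n≡y = begin
      x ↑ n ≡⟨ *-identityˡ _ ⟨
      𝟙 ⊗ (x ↑ n) ≡⟨ cong (_⊗ (x ↑ n)) e ⟨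
      (y ⊗ x) ⊗ (x ↑ n) ≡⟨ *-assoc y x _ ⟩
      y ⊗ (x ↑ suc n) ≡⟨ cong (y ⊗_) (fermat mem? ⊗-closed card≡ 𝟘-closed m (inverse≢0 (trans (*-comm x y) e))) ⟩
      y ⊗ 𝟙 ≡⟨ *-identityʳ y ⟩
      y                  ∎

  -1-closed : Mem (⊖ 𝟙)
  -1-closed = ⊖-closed 𝟙-closed

  ^-cancel-≡ : ∀ {a b} → card ^ a ≡ card ^ b → a ≡ b
  ^-cancel-≡ {a} {b} e with ℕ.<-cmp a b
  ... | tri< a<b _ _ = contradiction e (ℕ.<⇒≢ (ℕ.^-monoʳ-< card 1<card a<b))
  ... | tri≈ _ a≡b _ = a≡b
  ... | tri> _ _ b<a = contradiction (sym e) (ℕ.<⇒≢ (ℕ.^-monoʳ-< card 1<card b<a))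

record FinModule {Q : ℕ} (L : FiniteField Q) : Set₁ where
  infixl 6 _+ᴹ_
  infixr 7 _*ₗ_
  field
    Carrierᴹ     : Set
    _+ᴹ_         : Carrierᴹ → Carrierᴹ → Carrierᴹ
    _*ₗ_         : FiniteField.Carrier L → Carrierᴹ → Carrierᴹ
    0ᴹ           : Carrierᴹ
    -ᴹ_          : Carrierᴹ → Carrierᴹ
    isLeftModule : IsLeftModule (FiniteField.ring L) _≡_ _+ᴹ_ 0ᴹ -ᴹ_ _*ₗ_
    finiteᴹ      : Finite Carrierᴹ

lineModule : {Q : ℕ} (L : FiniteField Q) → FinModule L
lineModule L = record
  { isLeftModule = LeftModule.isLeftModule (TensorUnit.leftModule {R = FiniteField.ring L})
  ; finiteᴹ = FieldTheory.finite L
  }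

spaceModule : {Q : ℕ} (L : FiniteField Q) → ℕ → FinModule L
spaceModule L m = record
  { isLeftModule = LeftModule.isLeftModule (space L m)
  ; finiteᴹ = finiteVec (FieldTheory.finite L) m
  }

-- The number of ways of prefixing j vectors of an N-dimensional space over a field with c elements
-- to s independent ones, keeping independence.
extensions : (c N s j : ℕ) → ℕ
extensions c N s zero    = 1
extensions c N s (suc j) = extensions c N s j * (c ^ N ∸ c ^ (j + s))

-- The number of k-tuples which together with s given independent vectors span an N-dimensional space.
spanningTuples : (c N k s : ℕ) → ℕ
spanningTuples c N zero    s = ⟦ s ℕ.≟ N ⟧
spanningTuples c N (suc k) s = c ^ s * spanningTuples c N k s + (c ^ N ∸ c ^ s) * spanningTuples c N k (suc s)

-- Linear combinations

module Linear {Q : ℕ} {L : FiniteField Q} (M : FinModule L) where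
  open FiniteField L
  open FieldTheory L hiding (_⊖_)
  open FinModule M public
  open IsLeftModule isLeftModule public
    using (+ᴹ-assoc; +ᴹ-comm; +ᴹ-identityˡ; +ᴹ-identityʳ; *ₗ-zeroˡ; *ₗ-zeroʳ; *ₗ-distribˡ; *ₗ-distribʳ; *ₗ-assoc; *ₗ-identityˡ; -ᴹ‿inverseˡ; -ᴹ‿inverseʳ)
  module V = Finite finiteᴹ

  +ᴹ-commutativeMonoid : CommutativeMonoid 0ℓ 0ℓ
  +ᴹ-commutativeMonoid = record { isCommutativeMonoid = IsLeftModule.+ᴹ-isCommutativeMonoid isLeftModule }

  open import Algebra.Properties.CommutativeSemigroup (CommutativeMonoid.commutativeSemigroup +ᴹ-commutativeMonoid) public
    using () renaming (interchange to +ᴹ-interchange; x∙yz≈y∙xz to +ᴹ-exchange)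

  +ᴹ-cancelʳ : ∀ {x y} z → x +ᴹ z ≡ y +ᴹ z → x ≡ y
  +ᴹ-cancelʳ {x} {y} z e = trans (sym (drop x)) (trans (cong (_+ᴹ (-ᴹ z)) e) (drop y))
    where
    drop : ∀ x → x +ᴹ z +ᴹ (-ᴹ z) ≡ x
    drop x = trans (+ᴹ-assoc x z _) (trans (cong (x +ᴹ_) (-ᴹ‿inverseʳ z)) (+ᴹ-identityʳ x))

  -1*ₗ-inverseˡ : ∀ x → (⊖ 𝟙) *ₗ x +ᴹ x ≡ 0ᴹ
  -1*ₗ-inverseˡ x = trans (cong ((⊖ 𝟙) *ₗ x +ᴹ_) (sym (*ₗ-identityˡ x)))
    (trans (sym (*ₗ-distribʳ x (⊖ 𝟙) 𝟙)) (trans (cong (_*ₗ x) (-‿inverseˡ 𝟙)) (*ₗ-zeroˡ x)))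

  *ₗ-exchange : ∀ a b x → a *ₗ b *ₗ x ≡ b *ₗ a *ₗ x
  *ₗ-exchange a b x = trans (sym (*ₗ-assoc a b x)) (trans (cong (_*ₗ x) (*-comm a b)) (*ₗ-assoc b a x))

  unscale : ∀ {a a⁻¹} x → a⁻¹ ⊗ a ≡ 𝟙 → a⁻¹ *ₗ a *ₗ x ≡ x
  unscale x e = trans (sym (*ₗ-assoc _ _ x)) (trans (cong (_*ₗ x) e) (*ₗ-identityˡ x))

  *ₗ≡0 : ∀ {a x} → a ≢ 𝟘 → a *ₗ x ≡ 0ᴹ → x ≡ 0ᴹ
  *ₗ≡0 {a} {x} a≢0 e with inverse a a≢0
  ... | a⁻¹ , e′ = trans (sym (unscale x e′)) (trans (cong (a⁻¹ *ₗ_) e) (*ₗ-zeroʳ a⁻¹))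

  lc : ∀ {n} → Vec Carrier n → Vec Carrierᴹ n → Carrierᴹ
  lc []       []       = 0ᴹ
  lc (c ∷ cs) (x ∷ xs) = c *ₗ x +ᴹ lc cs xs

  lc-+ : ∀ {n} (c d : Vec Carrier n) xs → lc (Vec.zipWith _⊕_ c d) xs ≡ lc c xs +ᴹ lc d xs
  lc-+ []       []       []       = sym (+ᴹ-identityˡ 0ᴹ)
  lc-+ (c ∷ cs) (d ∷ ds) (x ∷ xs) = trans (cong₂ _+ᴹ_ (*ₗ-distribʳ x c d) (lc-+ cs ds xs)) (+ᴹ-interchange _ _ _ _)

  lc-* : ∀ {n} a (c : Vec Carrier n) xs → lc (Vec.map (a ⊗_) c) xs ≡ a *ₗ lc c xs
  lc-* a []       []       = sym (*ₗ-zeroʳ a)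
  lc-* a (c ∷ cs) (x ∷ xs) = trans (cong₂ _+ᴹ_ (*ₗ-assoc a c x) (lc-* a cs xs)) (sym (*ₗ-distribˡ a _ _))

  lc-0 : ∀ {n} (xs : Vec Carrierᴹ n) → lc (Vec.replicate n 𝟘) xs ≡ 0ᴹ
  lc-0 []       = refl
  lc-0 (x ∷ xs) = trans (cong₂ _+ᴹ_ (*ₗ-zeroˡ x) (lc-0 xs)) (+ᴹ-identityˡ 0ᴹ)

  lc-0∷ : ∀ {n} (c : Vec Carrier n) x xs → lc (𝟘 ∷ c) (x ∷ xs) ≡ lc c xs
  lc-0∷ c x xs = trans (cong (_+ᴹ lc c xs) (*ₗ-zeroˡ x)) (+ᴹ-identityˡ _)

  lc-++ : ∀ {m n} (c : Vec Carrier m) (d : Vec Carrier n) xs ys → lc (c Vec.++ d) (xs Vec.++ ys) ≡ lc c xs +ᴹ lc d ys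
  lc-++ []       d []       ys = sym (+ᴹ-identityˡ _)
  lc-++ (c ∷ cs) d (x ∷ xs) ys = trans (cong (c *ₗ x +ᴹ_) (lc-++ cs d xs ys)) (sym (+ᴹ-assoc _ _ _))

  -- Vectors stay in the module over GF(q^l) and only the coefficients are restricted. Spans and
  -- independence over GF(q), GF(q^t) and GF(q^l) can thus be compared on the same tuples.
  module Over (E : Subfield L) where
    open Subfield E

    Coef : ∀ {n} → Vec Carrier n → Set
    Coef = VAll Mem

    coef? : ∀ {n} (c : Vec Carrier n) → Dec (Coef c)
    coef? = VAll.all? mem?

    coef-+ : ∀ {n} {c d : Vec Carrier n} → Coef c → Coef d → Coef (Vec.zipWith _⊕_ c d)
    coef-+ []       []       = []
    coef-+ (p ∷ ps) (r ∷ rs) = ⊕-closed p r ∷ coef-+ ps rs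

    coef-* : ∀ {n a} {c : Vec Carrier n} → Mem a → Coef c → Coef (Vec.map (a ⊗_) c)
    coef-* m []       = []
    coef-* m (p ∷ ps) = ⊗-closed m p ∷ coef-* m ps

    coef-0 : ∀ n → Coef (Vec.replicate n 𝟘)
    coef-0 zero    = []
    coef-0 (suc n) = 𝟘-closed ∷ coef-0 n

    Span : ∀ {n} → Vec Carrierᴹ n → Pred Carrierᴹ 0ℓ
    Span xs y = ∃[ c ] Coef c × lc c xs ≡ y

    span? : ∀ {n} (xs : Vec Carrierᴹ n) → Decidable (Span xs)
    span? xs y = Finite.∃? (finiteVec finite _) (λ c → coef? c ×-dec (lc c xs V.≟ y))

    record IsSubspace (P : Pred Carrierᴹ 0ℓ) : Set where
      field
        has-0 : P 0ᴹ
        has-+ : ∀ {x y} → P x → P y → P (x +ᴹ y)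
        has-* : ∀ {a x} → Mem a → P x → P (a *ₗ x)

    span-isSubspace : ∀ {n} (xs : Vec Carrierᴹ n) → IsSubspace (Span xs)
    span-isSubspace xs = record
      { has-0 = _ , coef-0 _ , lc-0 xs
      ; has-+ = λ { (c , p , refl) (d , r , refl) → _ , coef-+ p r , lc-+ c d xs }
      ; has-* = λ { m (c , p , refl) → _ , coef-* m p , lc-* _ c xs }
      }

    span-there : ∀ {n x} {xs : Vec Carrierᴹ n} {y} → Span xs y → Span (x ∷ xs) y
    span-there {x = x} {xs} (c , p , refl) = 𝟘 ∷ c , 𝟘-closed ∷ p , lc-0∷ c x xs

    span-here : ∀ {n x} {xs : Vec Carrierᴹ n} → Span (x ∷ xs) x
    span-here {x = x} {xs} = 𝟙 ∷ Vec.replicate _ 𝟘 , 𝟙-closed ∷ coef-0 _ ,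
      trans (cong₂ _+ᴹ_ (*ₗ-identityˡ x) (lc-0 xs)) (+ᴹ-identityʳ x)

    span-members : ∀ {n} (xs : Vec Carrierᴹ n) → VAll (Span xs) xs
    span-members []       = []
    span-members (x ∷ xs) = span-here ∷ VAll.map span-there (span-members xs)

    module _ {P : Pred Carrierᴹ 0ℓ} (sub : IsSubspace P) where
      open IsSubspace sub

      lc-closed : ∀ {n} {c : Vec Carrier n} {xs} → Coef c → VAll P xs → P (lc c xs)
      lc-closed []       []       = has-0
      lc-closed (m ∷ ms) (p ∷ ps) = has-+ (has-* m p) (lc-closed ms ps)

      span-least : ∀ {n} {xs : Vec Carrierᴹ n} → VAll P xs → ∀ {y} → Span xs y → P y
      span-least ps (c , ms , refl) = lc-closed ms ps

    span-mono : ∀ {m n} {xs : Vec Carrierᴹ m} {ys : Vec Carrierᴹ n} → VAll (Span ys) xs → ∀ {y} → Span xs y → Span ys y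
    span-mono {ys = ys} = span-least (span-isSubspace ys)

    -- Stated entry by entry from the head so that prefixing a vector adds one condition, the step
    -- of all later counts; `coef-zero` and `coef-zero⇒ind` relate it to the usual definition.
    Ind : ∀ {n} → Vec Carrierᴹ n → Set
    Ind []       = ⊤
    Ind (x ∷ xs) = ¬ Span xs x × Ind xs

    ind? : ∀ {n} (xs : Vec Carrierᴹ n) → Dec (Ind xs)
    ind? []       = yes tt
    ind? (x ∷ xs) = ¬? (span? xs x) ×-dec ind? xs

    span-++[] : ∀ {n} (xs : Vec Carrierᴹ n) → VAll (Span xs) (xs Vec.++ [])
    span-++[] []       = []
    span-++[] (x ∷ xs) = span-here ∷ VAll.map span-there (span-++[] xs)

    span-++[]′ : ∀ {n} (xs : Vec Carrierᴹ n) → VAll (Span (xs Vec.++ [])) xs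
    span-++[]′ []       = []
    span-++[]′ (x ∷ xs) = span-here ∷ VAll.map span-there (span-++[]′ xs)

    ind-++[] : ∀ {n} (xs : Vec Carrierᴹ n) → Ind xs → Ind (xs Vec.++ [])
    ind-++[] []       _            = tt
    ind-++[] (x ∷ xs) (x∉ , ind) = x∉ ∘ span-mono (span-++[] xs) , ind-++[] xs ind

    ind-++[]⁻ : ∀ {n} (xs : Vec Carrierᴹ n) → Ind (xs Vec.++ []) → Ind xs
    ind-++[]⁻ []       _            = tt
    ind-++[]⁻ (x ∷ xs) (x∉ , ind) = x∉ ∘ span-mono (span-++[]′ xs) , ind-++[]⁻ xs ind

    -- x = (a - b)⁻¹ (v - u), and a subfield contains the inverse of a - b.
    span-solve : ∀ {n} {xs : Vec Carrierᴹ n} {a b x u v} → Mem a → Mem b → a ≢ b → Span xs u → Span xs v →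
                 a *ₗ x +ᴹ u ≡ b *ₗ x +ᴹ v → Span xs x
    span-solve {xs = xs} {a} {b} {x} {u} {v} ma mb a≢b su sv e with inverse (a FT.⊖ b) (a≢b ∘ ⊖≡0)
      where module FT = FieldTheory L
    ... | d , de = subst (Span xs) (trans (cong (d *ₗ_) (sym dx)) (unscale x de))
      (has-* (inverse-closed (⊕-closed ma (⊖-closed mb)) de) (has-+ sv (has-* -1-closed su)))
      where
      open IsSubspace (span-isSubspace xs)
      module FT = FieldTheory L
      open ≡-Reasoning
      dx : (a FT.⊖ b) *ₗ x ≡ v +ᴹ (⊖ 𝟙) *ₗ u
      dx = +ᴹ-cancelʳ (b *ₗ x +ᴹ u) (begin
        (a FT.⊖ b) *ₗ x +ᴹ (b *ₗ x +ᴹ u) ≡⟨ +ᴹ-assoc _ _ _ ⟨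
        (a FT.⊖ b) *ₗ x +ᴹ b *ₗ x +ᴹ u ≡⟨ cong (_+ᴹ u) (*ₗ-distribʳ x _ b) ⟨
        ((a FT.⊖ b) ⊕ b) *ₗ x +ᴹ u ≡⟨ cong (λ c → c *ₗ x +ᴹ u) (⊖-⊕ a b) ⟩
        a *ₗ x +ᴹ u ≡⟨ e ⟩
        b *ₗ x +ᴹ v ≡⟨ +ᴹ-comm _ v ⟩
        v +ᴹ b *ₗ x ≡⟨ cong (_+ᴹ b *ₗ x) (+ᴹ-identityʳ v) ⟨
        v +ᴹ 0ᴹ +ᴹ b *ₗ x ≡⟨ cong (λ z → v +ᴹ z +ᴹ b *ₗ x) (-1*ₗ-inverseˡ u) ⟨
        v +ᴹ ((⊖ 𝟙) *ₗ u +ᴹ u) +ᴹ b *ₗ x ≡⟨ cong (_+ᴹ b *ₗ x) (+ᴹ-assoc v _ u) ⟨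
        v +ᴹ (⊖ 𝟙) *ₗ u +ᴹ u +ᴹ b *ₗ x ≡⟨ +ᴹ-assoc _ u _ ⟩
        v +ᴹ (⊖ 𝟙) *ₗ u +ᴹ (u +ᴹ b *ₗ x) ≡⟨ cong (v +ᴹ (⊖ 𝟙) *ₗ u +ᴹ_) (+ᴹ-comm u _) ⟩
        v +ᴹ (⊖ 𝟙) *ₗ u +ᴹ (b *ₗ x +ᴹ u)        ∎)

    coef-unique : ∀ {n} {xs : Vec Carrierᴹ n} → Ind xs → ∀ {c d} → Coef c → Coef d → lc c xs ≡ lc d xs → c ≡ d
    coef-unique {xs = []}     _ {[]} {[]} _ _ _ = refl
    coef-unique {xs = x ∷ xs} (x∉ , ind) {c ∷ cs} {d ∷ ds} (m ∷ ms) (m′ ∷ ms′) e with c ≟ d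
    ... | no c≢d   = contradiction (span-solve m m′ c≢d (cs , ms , refl) (ds , ms′ , refl) e) x∉
    ... | yes refl = cong (c ∷_) (coef-unique ind ms ms′
      (+ᴹ-cancelʳ (c *ₗ x) (trans (+ᴹ-comm _ (c *ₗ x)) (trans e (+ᴹ-comm (c *ₗ x) _)))))

    coef-zero : ∀ {n} {xs : Vec Carrierᴹ n} → Ind xs → ∀ {c} → Coef c → lc c xs ≡ 0ᴹ → c ≡ Vec.replicate n 𝟘
    coef-zero {xs = xs} ind m e = coef-unique ind m (coef-0 _) (trans e (sym (lc-0 xs)))

    coef-zero⇒ind : ∀ {n} (xs : Vec Carrierᴹ n) → (∀ {c} → Coef c → lc c xs ≡ 0ᴹ → c ≡ Vec.replicate n 𝟘) → Ind xs
    coef-zero⇒ind []       h = tt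
    coef-zero⇒ind (x ∷ xs) h =
      (λ { (c , m , refl) → 𝟙≢𝟘 (trans (sym (-‿involutive 𝟙)) (trans (cong ⊖_ (Vec.∷-injectiveˡ (h (-1-closed ∷ m) (-1*ₗ-inverseˡ _)))) -0#≈0#)) }) ,
      coef-zero⇒ind xs (λ {c} m e → Vec.∷-injectiveʳ (h (𝟘-closed ∷ m) (trans (lc-0∷ c x xs) e)))

    card-span : ∀ {n} {xs : Vec Carrierᴹ n} → Ind xs → V.count (span? xs) ≡ card ^ n
    card-span {n} {xs} ind = trans
      (doubleCount V.elems (tuples finite n) (λ y c → coef? c ×-dec (lc c xs V.≟ y)) (λ {y} _ → per-y y) (λ {c} _ → per-c c))
      (#-VAll finite mem? n)
      where
      per-y : ∀ y → # (λ c → coef? c ×-dec (lc c xs V.≟ y)) ∈ tuples finite n ≡ ⟦ span? xs y ⟧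
      per-y y = ⟦⟧-unique (span? xs y)
        (λ (c , m , e) → Finite.count-one (finiteVec finite n) _ (m , e) (λ d (m′ , e′) → coef-unique ind m′ m (trans e′ (sym e))))
        (λ ¬s → #-none _ (tuples finite n) (λ {c} _ (m , e) → ¬s (c , m , e)))

      per-c : ∀ c → # (λ y → coef? c ×-dec (lc c xs V.≟ y)) ∈ V.elems ≡ ⟦ coef? c ⟧
      per-c c = ⟦⟧-unique (coef? c)
        (λ m → V.count-one (λ y → coef? c ×-dec (lc c xs V.≟ y)) (m , refl) (λ y (_ , e) → sym e))
        (λ ¬m → #-none _ V.elems (λ _ (m , _) → ¬m m))

    record Basis (P : Pred Carrierᴹ 0ℓ) (n : ℕ) : Set where
      field
        vectors     : Vec Carrierᴹ n
        independent : Ind vectors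
        members     : VAll P vectors
        spanning    : ∀ {y} → P y → Span vectors y

    module _ {P : Pred Carrierᴹ 0ℓ} (P? : Decidable P) (sub : IsSubspace P) where
      open IsSubspace sub

      basis : ∃ (Basis P)
      basis with greedy V.elems
        where
        greedy : (ys : List Carrierᴹ) → ∃[ n ] Σ[ b ∈ Vec Carrierᴹ n ] Ind b × VAll P b × (∀ {y} → y ∈ ys → P y → Span b y)
        greedy []       = 0 , [] , tt , [] , λ ()
        greedy (y ∷ ys) with greedy ys
        ... | n , b , ind , ps , sp with P? y | span? b y
        ... | no ¬p | _     = n , b , ind , ps , λ { (here refl) p → contradiction p ¬p ; (there y∈) → sp y∈ }
        ... | yes _ | yes s = n , b , ind , ps , λ { (here refl) _ → s ; (there y∈) → sp y∈ }
        ... | yes p | no ¬s = suc n , y ∷ b , (¬s , ind) , p ∷ ps , λ { (here refl) _ → span-here ; (there y∈) → span-there ∘ sp y∈ }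
      ... | n , b , ind , ps , sp = n , record { vectors = b ; independent = ind ; members = ps ; spanning = sp (V.complete _) }

      basis-card : ∀ {n} → Basis P n → V.count P? ≡ card ^ n
      basis-card B = trans (#-cong P? (span? vectors) V.elems (λ _ → spanning) (λ _ → span-least sub members)) (card-span independent)
        where open Basis B

      -- The span of n independent vectors already has `card ^ n` elements, so it fills P. This
      -- replaces the exchange lemma.
      independent-spans : ∀ {n} {b : Vec Carrierᴹ n} → Ind b → VAll P b → V.count P? ≡ card ^ n → ∀ {y} → P y → Span b y
      independent-spans {b = b} ind ps size = #-⊆-≡ (span? b) P? V.elems (λ _ → span-least sub ps)
        (ℕ.≤-reflexive (trans size (sym (card-span ind)))) (V.complete _)

    #-∸ : {P P′ : Pred Carrierᴹ 0ℓ} (P? : Decidable P) (P′? : Decidable P′) → (∀ x → P′ x → P x) →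
          V.count (λ x → P? x ×-dec ¬? (P′? x)) ≡ V.count P? ∸ V.count P′?
    #-∸ P? P′? P′⊆P = trans (sym (ℕ.m+n∸n≡m _ (V.count P′?))) (cong (_∸ V.count P′?)
      (trans (sym (sumOver-+ V.elems _ _)) (sumOver-cong V.elems (λ x → split (P? x) (P′? x) (P′⊆P x)))))
      where
      split : ∀ {p q} {A : Set p} {B : Set q} (a? : Dec A) (b? : Dec B) → (B → A) → ⟦ a? ×-dec ¬? b? ⟧ + ⟦ b? ⟧ ≡ ⟦ a? ⟧
      split (yes _) (yes _) _ = refl
      split (yes _) (no _)  _ = refl
      split (no ¬a) (yes b) h = contradiction (h b) ¬a
      split (no _)  (no _)  _ = refl

    independent-subtuple : ∀ {n} (xs : Vec Carrierᴹ n) → ∃[ r ] r ≤ n × (Σ[ b ∈ Vec Carrierᴹ r ] Ind b × VAll (Span b) xs × VAll (Span xs) b)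
    independent-subtuple []       = 0 , z≤n , [] , tt , [] , []
    independent-subtuple (x ∷ xs) with independent-subtuple xs
    ... | r , r≤n , b , ind , xs⊆b , b⊆xs with span? b x
    ... | yes s = r , ℕ.m≤n⇒m≤1+n r≤n , b , ind , s ∷ xs⊆b , VAll.map span-there b⊆xs
    ... | no ¬s = suc r , s≤s r≤n , x ∷ b , (¬s , ind) , span-here ∷ VAll.map span-there xs⊆b , span-here ∷ VAll.map span-there b⊆xs

    card-span-≤ : ∀ {n} (xs : Vec Carrierᴹ n) → V.count (span? xs) ≤ card ^ n
    card-span-≤ {n} xs with independent-subtuple xs
    ... | r , r≤n , b , ind , xs⊆b , b⊆xs = subst (_≤ card ^ n)
      (trans (sym (card-span ind)) (#-cong (span? b) (span? xs) V.elems (λ _ → span-mono b⊆xs) (λ _ → span-mono xs⊆b)))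
      (ℕ.^-monoʳ-≤ card {{ℕ.>-nonZero (ℕ.<-trans z<s 1<card)}} r≤n)

    module _ {P : Pred Carrierᴹ 0ℓ} (P? : Decidable P) (sub : IsSubspace P) {N : ℕ} (dim : V.count P? ≡ card ^ N) where

      extends? : ∀ {s j} (t : Vec Carrierᴹ s) → Decidable (λ (xs : Vec Carrierᴹ j) → Ind (xs Vec.++ t) × VAll P xs)
      extends? t xs = ind? (xs Vec.++ t) ×-dec VAll.all? P? xs

      #-extensions : ∀ {s} {t : Vec Carrierᴹ s} → Ind t → VAll P t → ∀ j → # extends? t ∈ tuples finiteᴹ j ≡ extensions card N s j
      #-extensions {s} {t} ind ps zero    = trans (ℕ.+-identityʳ _) (⟦⟧-yes (extends? t []) (ind , []))
      #-extensions {s} {t} ind ps (suc j) = begin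
        # extends? t ∈ tuples finiteᴹ (suc j) ≡⟨ sumOver-tuples finiteᴹ j _ ⟩
        sumOver (tuples finiteᴹ j) (λ xs → sumOver V.elems (λ x → ⟦ extends? t (x ∷ xs) ⟧)) ≡⟨ sumOver-cong (tuples finiteᴹ j) step ⟩
        sumOver (tuples finiteᴹ j) (λ xs → ⟦ extends? t xs ⟧ * (card ^ N ∸ card ^ (j + s))) ≡⟨ sumOver-*ʳ (tuples finiteᴹ j) _ _ ⟩
        # extends? t ∈ tuples finiteᴹ j * (card ^ N ∸ card ^ (j + s)) ≡⟨ cong (_* _) (#-extensions ind ps j) ⟩
        extensions card N s (suc j)                                                                   ∎
        where
        open ≡-Reasoning
        VAll-++ : ∀ {i} {xs : Vec Carrierᴹ i} → VAll P xs → VAll P (xs Vec.++ t)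
        VAll-++ []       = ps
        VAll-++ (r ∷ rs) = r ∷ VAll-++ rs

        step : ∀ xs → sumOver V.elems (λ x → ⟦ extends? t (x ∷ xs) ⟧) ≡ ⟦ extends? t xs ⟧ * (card ^ N ∸ card ^ (j + s))
        step xs = begin
          sumOver V.elems (λ x → ⟦ extends? t (x ∷ xs) ⟧)
            ≡⟨ sumOver-cong V.elems (λ x → trans
                 (⟦⟧-cong (extends? t (x ∷ xs)) (extends? t xs ×-dec (P? x ×-dec ¬? (span? (xs Vec.++ t) x)))
                   (λ { ((x∉ , i) , p ∷ rs) → (i , rs) , p , x∉ }) (λ { ((i , rs) , p , x∉) → (x∉ , i) , p ∷ rs }))
                 (⟦⟧-× (extends? t xs) _)) ⟩
          sumOver V.elems (λ x → ⟦ extends? t xs ⟧ * ⟦ P? x ×-dec ¬? (span? (xs Vec.++ t) x) ⟧)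
            ≡⟨ sumOver-*ˡ V.elems _ ⟦ extends? t xs ⟧ ⟩
          ⟦ extends? t xs ⟧ * V.count (λ x → P? x ×-dec ¬? (span? (xs Vec.++ t) x))
            ≡⟨ ⟦⟧-*-cong (extends? t xs) (λ (i , rs) → trans
                 (#-∸ P? (span? (xs Vec.++ t)) (λ _ → span-least sub (VAll-++ rs)))
                 (cong₂ _∸_ dim (card-span i))) ⟩
          ⟦ extends? t xs ⟧ * (card ^ N ∸ card ^ (j + s)) ∎

      #-independent : ∀ n → # (λ b → ind? b ×-dec VAll.all? P? b) ∈ tuples finiteᴹ n ≡ extensions card N 0 n
      #-independent n = trans (#-cong _ (extends? []) (tuples finiteᴹ n) (λ b (i , p) → ind-++[] b i , p) (λ b (i , p) → ind-++[]⁻ b i , p))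
        (#-extensions tt [] n)

    module _ {P : Pred Carrierᴹ 0ℓ} (P? : Decidable P) (sub : IsSubspace P) {N : ℕ} (dim : V.count P? ≡ card ^ N) where

      Generates : ∀ {s k} → Vec Carrierᴹ s → Vec Carrierᴹ k → Set
      Generates b as = VAll P as × (∀ y → P y → Span (b Vec.++ as) y)

      generates? : ∀ {s k} (b : Vec Carrierᴹ s) → Decidable (Generates {k = k} b)
      generates? b as = VAll.all? P? as ×-dec V.∀? (λ y → P? y →-dec span? (b Vec.++ as) y)

      private
        members-++ : ∀ {s k} (b : Vec Carrierᴹ s) (as : Vec Carrierᴹ k) →
                     VAll (Span (b Vec.++ as)) b × VAll (Span (b Vec.++ as)) as
        members-++ []      as = [] , span-members as
        members-++ (x ∷ b) as = let p , r = members-++ b as in span-here ∷ VAll.map span-there p , VAll.map span-there r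

        VAll-++ : ∀ {s k} {b : Vec Carrierᴹ s} {as : Vec Carrierᴹ k} {R : Pred Carrierᴹ 0ℓ} → VAll R b → VAll R as → VAll R (b Vec.++ as)
        VAll-++ []       rs = rs
        VAll-++ (p ∷ ps) rs = p ∷ VAll-++ ps rs

        shift : ∀ {s k a} {b : Vec Carrierᴹ s} {as : Vec Carrierᴹ k} {y} → Span (b Vec.++ a ∷ as) y → Span (a ∷ b Vec.++ as) y
        shift {b = b} {as} = let p , r = members-++ b as in
          span-mono (VAll-++ (VAll.map span-there p) (span-here ∷ VAll.map span-there r))

        unshift : ∀ {s k a} {b : Vec Carrierᴹ s} {as : Vec Carrierᴹ k} {y} → Span (a ∷ b Vec.++ as) y → Span (b Vec.++ a ∷ as) y
        unshift {a = a} {b} {as} with members-++ b (a ∷ as)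
        ... | p , (m ∷ r) = span-mono (m ∷ VAll-++ p r)

        absorb : ∀ {s k a} {b : Vec Carrierᴹ s} {as : Vec Carrierᴹ k} {y} → Span b a → Span (a ∷ b Vec.++ as) y → Span (b Vec.++ as) y
        absorb {b = b} {as} sa = let p , r = members-++ b as in span-mono (span-mono p sa ∷ VAll-++ p r)

      -- The first entry either lies in the span of b, with `card ^ s` possibilities, and adds
      -- nothing, or is one of the remaining vectors of P and joins b as a further independent
      -- vector. Spanning k-tuples are counted instead of bases because relation vectors have k
      -- entries whatever their rank.
      #-spanningTuples : ∀ {s} {b : Vec Carrierᴹ s} → Ind b → VAll P b → ∀ k → # generates? b ∈ tuples finiteᴹ k ≡ spanningTuples card N k s
      #-spanningTuples {s} {b} ind ps zero = trans (ℕ.+-identityʳ _) (⟦⟧-cong (generates? b []) (s ℕ.≟ N) to from)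
        where
        to : Generates b [] → s ≡ N
        to (_ , g) = ^-cancel-≡ (trans (sym (card-span ind)) (trans
          (#-cong (span? b) P? V.elems (λ _ → span-least sub ps) (λ y p → span-mono (span-++[] b) (g y p))) dim))

        from : s ≡ N → Generates b []
        from refl = [] , λ y p → span-mono (span-++[]′ b) (independent-spans P? sub ind ps dim p)
      #-spanningTuples {s} {b} ind ps (suc k) = begin
        # generates? b ∈ tuples finiteᴹ (suc k) ≡⟨ sumOver-tuples finiteᴹ k _ ⟩
        sumOver (tuples finiteᴹ k) (λ as → sumOver V.elems (λ a → ⟦ generates? b (a ∷ as) ⟧)) ≡⟨ sumOver-swap (tuples finiteᴹ k) V.elems _ ⟩
        sumOver V.elems (λ a → # (λ as → generates? b (a ∷ as)) ∈ tuples finiteᴹ k) ≡⟨ sumOver-cong V.elems (λ a → step (P? a) (span? b a)) ⟩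
        sumOver V.elems (λ a → ⟦ span? b a ⟧ * S + ⟦ fresh? a ⟧ * S′) ≡⟨ sumOver-+ V.elems _ _ ⟩
        sumOver V.elems (λ a → ⟦ span? b a ⟧ * S) + sumOver V.elems (λ a → ⟦ fresh? a ⟧ * S′) ≡⟨ cong₂ _+_ (sumOver-*ʳ V.elems _ S) (sumOver-*ʳ V.elems _ S′) ⟩
        V.count (span? b) * S + V.count fresh? * S′ ≡⟨ cong₂ (λ m n → m * S + n * S′) (card-span ind)
                                                                                                 (trans (#-∸ P? (span? b) (λ _ → span-least sub ps)) (cong₂ _∸_ dim (card-span ind))) ⟩
        spanningTuples card N (suc k) s                                                           ∎
        where
        open ≡-Reasoning
        S  = spanningTuples card N k s
        S′ = spanningTuples card N k (suc s)

        fresh? : Decidable (λ a → P a × ¬ Span b a)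
        fresh? a = P? a ×-dec ¬? (span? b a)

        step : ∀ {a} (p? : Dec (P a)) (s? : Dec (Span b a)) →
               # (λ as → generates? b (a ∷ as)) ∈ tuples finiteᴹ k ≡ ⟦ s? ⟧ * S + ⟦ p? ×-dec ¬? s? ⟧ * S′
        step (no ¬p) (yes s) = contradiction (span-least sub ps s) ¬p
        step (no ¬p) (no _)  = #-none _ (tuples finiteᴹ k) (λ { _ (p ∷ _ , _) → ¬p p })
        step (yes p) (yes s) = trans (trans (#-cong _ (generates? b) (tuples finiteᴹ k)
          (λ { as (_ ∷ rs , g) → rs , λ y p → absorb s (shift {b = b} (g y p)) })
          (λ { as (rs , g) → p ∷ rs , λ y p → unshift {b = b} (span-there (g y p)) }))
          (#-spanningTuples ind ps k)) (sym (trans (ℕ.+-identityʳ _) (ℕ.+-identityʳ S)))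
        step {a} (yes p) (no ¬s) = trans (trans (#-cong _ (generates? (a ∷ b)) (tuples finiteᴹ k)
          (λ { as (_ ∷ rs , g) → rs , λ y p → shift {b = b} (g y p) })
          (λ { as (rs , g) → p ∷ rs , λ y p → unshift {b = b} (g y p) }))
          (#-spanningTuples {b = a ∷ b} (¬s , ind) (p ∷ ps) k)) (sym (ℕ.+-identityʳ S′))

-- Subfields and stabilizers

module SubfieldProperties {Q : ℕ} {L : FiniteField Q} (E : Subfield L) where
  open FiniteField L
  open FieldTheory L
  open Subfield E

  ↑-card : ∀ {x} → Mem x → x ↑ card ≡ x
  ↑-card {x} m with card-1 | x ≟ 𝟘
  ... | n , card≡ | yes refl = 𝟘↑ (ℕ.<-trans z<s 1<card)
  ... | n , card≡ | no x≢0   = begin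
    x ↑ card ≡⟨ cong (x ↑_) card≡ ⟩
    x ⊗ (x ↑ suc n) ≡⟨ cong (x ⊗_) (fermat mem? ⊗-closed card≡ 𝟘-closed m x≢0) ⟩
    x ⊗ 𝟙 ≡⟨ *-identityʳ x ⟩
    x                 ∎
    where open ≡-Reasoning

  module line = Linear.Over (lineModule L) E

  count-power : {P : Pred Carrier 0ℓ} (P? : Decidable P) → line.IsSubspace P → ∃[ n ] count P? ≡ card ^ n
  count-power P? sub = let n , B = line.basis P? sub in n , line.basis-card P? sub B

  subspace : (E′ : Subfield L) → (∀ {x} → Mem x → Subfield.Mem E′ x) → line.IsSubspace (Subfield.Mem E′)
  subspace E′ E⊆E′ = record { has-0 = E′.𝟘-closed ; has-+ = E′.⊕-closed ; has-* = λ m → E′.⊗-closed (E⊆E′ m) }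
    where module E′ = Subfield E′

  -- For nonzero c, mapping P into itself means mapping it onto itself, as P is finite. With 0
  -- included, the stabilizer in the multiplicative group becomes a subfield.
  stabilizer : {P : Pred Carrier 0ℓ} → Decidable P → line.IsSubspace P → Subfield L
  stabilizer {P} P? sub = record
    { Mem      = λ c → ∀ y → P y → P (c ⊗ y)
    ; mem?     = λ c → ∀? (λ y → P? y →-dec P? (c ⊗ y))
    ; 𝟘-closed = λ y _ → subst P (sym (zeroˡ y)) has-0
    ; 𝟙-closed = λ y p → subst P (sym (*-identityˡ y)) p
    ; ⊕-closed = λ {a} {b} f g y p → subst P (sym (distribʳ y a b)) (has-+ (f y p) (g y p))
    ; ⊗-closed = λ {a} {b} f g y p → subst P (sym (*-assoc a b y)) (f _ (g y p))
    ; ⊖-closed = λ {a} f y p → subst P (trans (-1*x≈-x _) (-‿distribˡ-* a y)) (has-* -1-closed (f y p))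
    }
    where open line.IsSubspace sub

wholeField : {Q : ℕ} (L : FiniteField Q) → Subfield L
wholeField L = record
  { Mem = λ _ → ⊤ ; mem? = λ _ → yes tt ; 𝟘-closed = tt ; 𝟙-closed = tt
  ; ⊕-closed = λ _ _ → tt ; ⊗-closed = λ _ _ → tt ; ⊖-closed = λ _ → tt }

whole-card : {Q : ℕ} (L : FiniteField Q) → Subfield.card (wholeField L) ≡ Q
whole-card L = trans (#-all _ (FieldTheory.elems L) (λ _ → tt)) (FieldTheory.size≡ L)

-- e is the sum of (n + 1)^i over i < s, so the quotient of (n + 1)^s - 1 by n is obtained without
-- subtraction or division.
geometric : ∀ n s → ∃[ e ] suc n ^ s ≡ suc (e * n)
geometric n zero    = 0 , refl
geometric n (suc s) with geometric n s
... | e , eq = e + suc (e * n) , trans (cong (suc n *_) eq) (solve 2 (λ n e → (con 1 :+ n) :* (con 1 :+ e :* n) := con 1 :+ (e :+ (con 1 :+ e :* n)) :* n) refl n e)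
  where open ℕ.+-*-Solver

-- The extension GF(q^l) of GF(q) and its intermediate fields

module Extension {q l : ℕ} {F : FiniteField q} {L : FiniteField (q ^ l)} (φ : F ↪ L) where
  open FiniteField L
  open FieldTheory L
  private
    module F  = FiniteField F
    module FT = FieldTheory F
  open _↪_ φ renaming (⟦_⟧ to φ⟦_⟧)
  open import Algebra.Morphism.Structures using (module RingMorphisms)
  open RingMorphisms F.rawRing rawRing
  open IsRingHomomorphism isRingHomomorphism using (+-homo; *-homo; 0#-homo; 1#-homo; -‿homo)

  φ-≢0 : ∀ {a} → a ≢ F.𝟘 → φ⟦ a ⟧ ≢ 𝟘
  φ-≢0 {a} a≢0 e with F.inverse a a≢0
  ... | a⁻¹ , e′ = 𝟙≢𝟘 (trans (sym 1#-homo) (trans (cong φ⟦_⟧ (sym e′)) (trans (*-homo a⁻¹ a) (trans (cong (φ⟦ a⁻¹ ⟧ ⊗_) e) (zeroʳ _)))))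

  φ-injective : ∀ {a b} → φ⟦ a ⟧ ≡ φ⟦ b ⟧ → a ≡ b
  φ-injective {a} {b} e with (a FT.⊖ b) FT.≟ F.𝟘
  ... | yes a-b≡0 = FT.⊖≡0 a-b≡0
  ... | no  a-b≢0 = contradiction (trans (+-homo a _) (trans (cong₂ _⊕_ e (-‿homo b)) (-‿inverseʳ _))) (φ-≢0 a-b≢0)

  baseField : Subfield L
  baseField = record
    { Mem      = λ x → ∃[ a ] φ⟦ a ⟧ ≡ x
    ; mem?     = λ x → FT.∃? (λ a → φ⟦ a ⟧ ≟ x)
    ; 𝟘-closed = _ , 0#-homo
    ; 𝟙-closed = _ , 1#-homo
    ; ⊕-closed = λ { (a , refl) (b , refl) → _ , +-homo a b }
    ; ⊗-closed = λ { (a , refl) (b , refl) → _ , *-homo a b }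
    ; ⊖-closed = λ { (a , refl) → _ , -‿homo a }
    }

  module Base = Subfield baseField
  module BaseProperties = SubfieldProperties baseField

  base-card : Base.card ≡ q
  base-card = trans (doubleCount elems FT.elems (λ x a → φ⟦ a ⟧ ≟ x)
    (λ {x} _ → ⟦⟧-unique (Base.mem? x)
      (λ (a , e) → FT.count-one (λ a → φ⟦ a ⟧ ≟ x) e (λ b e′ → φ-injective (trans e′ (sym e))))
      (λ ¬m → #-none _ FT.elems (λ {a} _ e → ¬m (a , e))))
    (λ {a} _ → count-one (φ⟦ a ⟧ ≟_) refl (λ _ → sym)))
    (trans (sumOver-const FT.elems 1) (trans (ℕ.*-identityʳ _) FT.size≡))

  1<q : 1 < q
  1<q = subst (1 <_) base-card Base.1<card

  instance
    q≢0 : NonZero q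
    q≢0 = ℕ.>-nonZero (ℕ.<-trans z<s 1<q)

  φ-fixed : ∀ a → φ⟦ a ⟧ ↑ q ≡ φ⟦ a ⟧
  φ-fixed a = subst (λ n → φ⟦ a ⟧ ↑ n ≡ φ⟦ a ⟧) base-card (BaseProperties.↑-card (a , refl))

  -- For fixed y, removing the leading term x^n from (x + y)^n leaves degree below n in x; the
  -- binomial coefficients are never named.
  ↑-binomial : ∀ n y → ∃[ d ] Deg< n d × (∀ x → (x ⊕ y) ↑ n ≡ (x ↑ n) ⊕ d x)
  ↑-binomial zero    y = (λ _ → 𝟘) , (λ _ → refl) , λ _ → sym (+-identityʳ 𝟙)
  ↑-binomial (suc n) y with ↑-binomial n y
  ... | d , deg , e = (λ x → (y ⊗ (x ↑ n)) ⊕ ((x ⊗ d x) ⊕ (y ⊗ d x))) ,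
    Deg<-+ (suc n) (Deg<-* (suc n) y (Deg<-↑ n)) (Deg<-+ (suc n) (Deg<-shift deg) (Deg<-weaken n (Deg<-* n y deg))) ,
    λ x → trans (cong ((x ⊕ y) ⊗_) (e x))
      (solve 4 (λ x y u v → (x :+ y) :* (u :+ v) := x :* u :+ (y :* u :+ (x :* v :+ y :* v))) refl x y (x ↑ n) (d x))
    where open Solver

  -- For y ≠ 0 the difference of the two sides is, in x, of degree below q and vanishes on the q multiples of y by elements of F.
  ⊕-↑q : ∀ x y → (x ⊕ y) ↑ q ≡ (x ↑ q) ⊕ (y ↑ q)
  ⊕-↑q x y with y ≟ 𝟘
  ... | yes refl = trans (cong (_↑ q) (+-identityʳ x)) (sym (trans (cong ((x ↑ q) ⊕_) (𝟘↑ (ℕ.<-trans z<s 1<q))) (+-identityʳ _)))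
  ... | no  y≢0 with ↑-binomial q y
  ... | d , deg , e = trans (e x) (cong ((x ↑ q) ⊕_) (⊖≡0 (rootBound q
          (Deg<-+ q deg (Deg<-weaken-≤ (ℕ.<⇒≤ 1<q) (Deg<-const _)))
          (map (λ a → φ⟦ a ⟧ ⊗ y) FT.elems)
          (Unique.map⁺ (λ {a} {b} e → φ-injective (⊗-cancelˡ y≢0 (trans (*-comm y _) (trans e (*-comm _ y))))) FT.unique)
          (All.map⁺ (All.tabulate (λ {a} _ → trans (cong (_⊕ _) (root a)) (-‿inverseʳ _))))
          (ℕ.≤-reflexive (sym (trans (List.length-map _ FT.elems) FT.size≡))) x)))
    where
    open ≡-Reasoning
    root : ∀ a → d (φ⟦ a ⟧ ⊗ y) ≡ y ↑ q
    root a = ⊕-cancelʳ ((φ⟦ a ⟧ ⊗ y) ↑ q) (begin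
      d (φ⟦ a ⟧ ⊗ y) ⊕ ((φ⟦ a ⟧ ⊗ y) ↑ q) ≡⟨ +-comm _ _ ⟩
      ((φ⟦ a ⟧ ⊗ y) ↑ q) ⊕ d (φ⟦ a ⟧ ⊗ y) ≡⟨ e _ ⟨
      ((φ⟦ a ⟧ ⊗ y) ⊕ y) ↑ q ≡⟨ cong (_↑ q) factor ⟩
      (φ⟦ a F.⊕ F.𝟙 ⟧ ⊗ y) ↑ q ≡⟨ ⊗-↑ _ y q ⟩
      (φ⟦ a F.⊕ F.𝟙 ⟧ ↑ q) ⊗ (y ↑ q) ≡⟨ cong (_⊗ (y ↑ q)) (φ-fixed _) ⟩
      φ⟦ a F.⊕ F.𝟙 ⟧ ⊗ (y ↑ q) ≡⟨ cong (_⊗ (y ↑ q)) (trans (+-homo a F.𝟙) (+-comm _ _)) ⟩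
      (φ⟦ F.𝟙 ⟧ ⊕ φ⟦ a ⟧) ⊗ (y ↑ q) ≡⟨ cong (λ u → (u ⊕ φ⟦ a ⟧) ⊗ (y ↑ q)) 1#-homo ⟩
      (𝟙 ⊕ φ⟦ a ⟧) ⊗ (y ↑ q) ≡⟨ trans (distribʳ _ _ _) (cong (_⊕ (φ⟦ a ⟧ ⊗ (y ↑ q))) (*-identityˡ _)) ⟩
      (y ↑ q) ⊕ (φ⟦ a ⟧ ⊗ (y ↑ q)) ≡⟨ cong (λ u → (y ↑ q) ⊕ (u ⊗ (y ↑ q))) (φ-fixed a) ⟨
      (y ↑ q) ⊕ ((φ⟦ a ⟧ ↑ q) ⊗ (y ↑ q)) ≡⟨ cong ((y ↑ q) ⊕_) (⊗-↑ _ y q) ⟨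
      (y ↑ q) ⊕ ((φ⟦ a ⟧ ⊗ y) ↑ q)           ∎)
      where
      factor : (φ⟦ a ⟧ ⊗ y) ⊕ y ≡ φ⟦ a F.⊕ F.𝟙 ⟧ ⊗ y
      factor = sym (trans (cong (_⊗ y) (+-homo a F.𝟙)) (trans (distribʳ y _ _) (cong ((φ⟦ a ⟧ ⊗ y) ⊕_) (trans (cong (_⊗ y) 1#-homo) (*-identityˡ y)))))

  ↑-q^suc : ∀ x t → x ↑ (q ^ suc t) ≡ (x ↑ (q ^ t)) ↑ q
  ↑-q^suc x t = trans (cong (x ↑_) (ℕ.*-comm q (q ^ t))) (↑-* x (q ^ t) q)

  ⊕-↑q^ : ∀ t x y → (x ⊕ y) ↑ (q ^ t) ≡ (x ↑ (q ^ t)) ⊕ (y ↑ (q ^ t))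
  ⊕-↑q^ zero    x y = trans (*-identityʳ _) (sym (cong₂ _⊕_ (*-identityʳ x) (*-identityʳ y)))
  ⊕-↑q^ (suc t) x y = trans (↑-q^suc _ t) (trans (cong (_↑ q) (⊕-↑q^ t x y)) (trans (⊕-↑q _ _) (cong₂ _⊕_ (sym (↑-q^suc x t)) (sym (↑-q^suc y t)))))

  q^>0 : ∀ t → 0 < q ^ t
  q^>0 t = ℕ.m^n>0 q t

  fixedField : ℕ → Subfield L
  fixedField t = record
    { Mem      = λ x → x ↑ (q ^ t) ≡ x
    ; mem?     = λ x → (x ↑ (q ^ t)) ≟ x
    ; 𝟘-closed = 𝟘↑ (q^>0 t)
    ; 𝟙-closed = 𝟙↑ (q ^ t)
    ; ⊕-closed = λ {x} {y} p r → trans (⊕-↑q^ t x y) (cong₂ _⊕_ p r)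
    ; ⊗-closed = λ {x} {y} p r → trans (⊗-↑ x y (q ^ t)) (cong₂ _⊗_ p r)
    ; ⊖-closed = λ {x} p → ⊕-cancelʳ x (trans (trans (cong (((⊖ x) ↑ (q ^ t)) ⊕_) (sym p))
                   (trans (sym (⊕-↑q^ t (⊖ x) x)) (trans (cong (_↑ (q ^ t)) (-‿inverseˡ x)) (𝟘↑ (q^>0 t))))) (sym (-‿inverseˡ x)))
    }

  module Fixed t = Subfield (fixedField t)

  -- Raising to the e-th power, where q^l - 1 = e (q^t - 1), maps the nonzero elements at most e-to-one to (q^t - 1)-st roots of unity.
  fixed-card : ∀ {t} → 0 < t → t ∣ l → Fixed.card t ≡ q ^ t
  fixed-card {t} 0<t (divides s refl) with q ^ t in N≡ | ℕ.^-monoʳ-< q 1<q 0<t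
  ... | suc zero        | s≤s ()
  ... | suc n@(suc n-1) | _ with geometric n s
  ... | e , Q≡ = trans card≡ (cong suc (ℕ.≤-antisym upper lower))
    where
    open ≡-Reasoning
    q^l≡ : q ^ (s * t) ≡ suc (e * n)
    q^l≡ = trans (cong (q ^_) (ℕ.*-comm s t)) (trans (sym (ℕ.^-*-assoc q t s)) (trans (cong (_^ s) N≡) Q≡))

    root? : Decidable (λ y → y ↑ n ≡ 𝟙)
    root? y = (y ↑ n) ≟ 𝟙

    card≡ : count (λ y → (y ↑ suc n) ≟ y) ≡ suc (count root?)
    card≡ = begin
      count (λ y → (y ↑ suc n) ≟ y) ≡⟨ sumOver-cong elems (λ y → split ((y ↑ suc n) ≟ y) (y ≟ 𝟘) (root? y)) ⟩
      _ ≡⟨ sumOver-+ elems _ _ ⟩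
      count (_≟ 𝟘) + count root? ≡⟨ cong (_+ count root?) (count-one (_≟ 𝟘) refl (λ _ e → e)) ⟩
      suc (count root?)                 ∎
      where
      split : ∀ {y} (f : Dec (y ↑ suc n ≡ y)) (z : Dec (y ≡ 𝟘)) (r : Dec (y ↑ n ≡ 𝟙)) → ⟦ f ⟧ ≡ ⟦ z ⟧ + ⟦ r ⟧
      split f (yes refl) r = trans (⟦⟧-yes f (zeroˡ _)) (cong suc (sym (⟦⟧-no r (λ e → 𝟘≢𝟙 (trans (sym (zeroˡ _)) e)))))
      split {y} f (no y≢0) r = ⟦⟧-cong f r (λ e → ⊗-cancelˡ y≢0 (trans e (sym (*-identityʳ y)))) (λ e → trans (cong (y ⊗_) e) (*-identityʳ y))

    Deg<-↑-const : ∀ m c → Deg< (suc m) (λ y → (y ↑ m) ⊖ c)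
    Deg<-↑-const m c = Deg<-+ (suc m) (Deg<-↑ m) (Deg<-weaken-≤ (s≤s z≤n) (Deg<-const (⊖ c)))

    #powers≤ : ∀ m {c} → 0 < m → c ≢ 𝟘 → count (λ y → (y ↑ m) ≟ c) ≤ m
    #powers≤ m {c} 0<m c≢0 = ℕ.≤-trans
      (#-⊆ (λ y → (y ↑ m) ≟ c) (λ y → ((y ↑ m) ⊖ c) ≟ 𝟘) elems (λ { y refl → -‿inverseʳ _ }))
      (#roots≤ m (Deg<-↑-const m c) {𝟘} (λ e → c≢0 (sym (trans (sym (𝟘↑ 0<m)) (⊖≡0 e)))))

    upper : count root? ≤ n
    upper = #powers≤ n z<s 𝟙≢𝟘

    positive : ∀ e → q ^ (s * t) ≡ suc (e * n) → 0 < e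
    positive zero    eq = contradiction (trans (whole-card L) eq) (ℕ.<⇒≢ (Subfield.1<card (wholeField L)) ∘ sym)
    positive (suc _) _  = z<s

    0<e : 0 < e
    0<e = positive e q^l≡

    power-root : ∀ {y} → y ≢ 𝟘 → (y ↑ e) ↑ n ≡ 𝟙
    power-root {y} y≢0 = trans (sym (↑-* y e n)) (fermat (λ _ → yes tt) (λ _ _ → tt) (trans (whole-card L) q^l≡) tt tt y≢0)

    nonzero-count : e * n ≡ count (λ y → ¬? (y ≟ 𝟘))
    nonzero-count = sym (trans count-nonzero (cong (_∸ 1) q^l≡))

    fibre? : ∀ y z → Dec (y ≢ 𝟘 × y ↑ e ≡ z)
    fibre? y z = ¬? (y ≟ 𝟘) ×-dec ((y ↑ e) ≟ z)

    lower : n ≤ count root?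
    lower = ℕ.*-cancelˡ-≤ e {{ℕ.>-nonZero 0<e}} (subst₂ _≤_
      (trans (sym (doubleCount elems elems fibre?
        (λ {y} _ → ⟦⟧-unique (¬? (y ≟ 𝟘)) (λ y≢0 → count-one (fibre? y) (y≢0 , refl) (λ _ (_ , e) → sym e))
                                           (λ y≡0 → #-none _ elems (λ _ (y≢0 , _) → y≡0 y≢0)))
        (λ _ → refl))) (sym nonzero-count))
      (trans (sumOver-*ˡ elems _ e) refl)
      (sumOver-mono elems (λ z → bound z (root? z))))
      where
      bound : ∀ z (r : Dec (z ↑ n ≡ 𝟙)) → count (λ y → fibre? y z) ≤ e * ⟦ r ⟧
      bound z (yes r) = ℕ.≤-trans (#-⊆ (λ y → fibre? y z) (λ y → (y ↑ e) ≟ z) elems (λ _ → proj₂))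
        (ℕ.≤-trans (#powers≤ e 0<e (λ { refl → 𝟘≢𝟙 (trans (sym (zeroˡ _)) r) })) (ℕ.≤-reflexive (sym (ℕ.*-identityʳ e))))
      bound z (no ¬r) = subst (_≤ e * 0) (sym (#-none _ elems (λ { _ (y≢0 , refl) → ¬r (power-root y≢0) }))) z≤n

  q^-cancel : ∀ {a b} → q ^ a ≡ q ^ b → a ≡ b
  q^-cancel {a} {b} = subst (λ c → c ^ a ≡ c ^ b → a ≡ b) base-card Base.^-cancel-≡

  base⊆fixed : ∀ t {x} → Base.Mem x → Fixed.Mem t x
  base⊆fixed zero    (a , refl) = *-identityʳ _
  base⊆fixed (suc t) (a , refl) = trans (↑-q^suc _ t) (trans (cong (_↑ q) (base⊆fixed t (a , refl))) (φ-fixed a))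

  fixed-⊆ : ∀ {t s} → t ∣ s → ∀ {x} → Fixed.Mem t x → Fixed.Mem s x
  fixed-⊆ {t} (divides n refl) {x} m = iterate n
    where
    iterate : ∀ n → x ↑ (q ^ (n * t)) ≡ x
    iterate zero    = *-identityʳ x
    iterate (suc n) = trans (cong (x ↑_) (ℕ.^-distribˡ-+-* q t (n * t))) (trans (↑-* x (q ^ t) _) (trans (cong (_↑ (q ^ (n * t))) m) (iterate n)))

  module _ (E : Subfield L) {s : ℕ} (card≡ : Subfield.card E ≡ q ^ s) where
    private
      module E = Subfield E
      module EP = SubfieldProperties E

    -- The order of a vector space over E is a power of the order q^s of E.
    dimension-∣ : {P : Pred Carrier 0ℓ} (P? : Decidable P) → EP.line.IsSubspace P → ∀ {d} → count P? ≡ q ^ d → s ∣ d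
    dimension-∣ P? sub size with EP.count-power P? sub
    ... | n , eq = divides n (q^-cancel (trans (sym size) (trans eq (trans (cong (_^ n) card≡) (trans (ℕ.^-*-assoc q s n) (cong (q ^_) (ℕ.*-comm s n)))))))

    degree-∣ : s ∣ l
    degree-∣ = dimension-∣ (λ _ → yes tt) (record { has-0 = tt ; has-+ = λ _ _ → tt ; has-* = λ _ _ → tt }) (whole-card L)

    degree>0 : 0 < s
    degree>0 = ℕ.n≢0⇒n>0 (λ { refl → ℕ.<⇒≢ E.1<card (sym card≡) })

    subfield⊆fixed : ∀ {x} → E.Mem x → Fixed.Mem s x
    subfield⊆fixed {x} m = subst (λ n → x ↑ n ≡ x) card≡ (EP.↑-card m)

    -- Every member of E is fixed and both sets have q^s elements; a subfield is thus determined by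
    -- its order.
    fixed⊆subfield : ∀ {x} → Fixed.Mem s x → E.Mem x
    fixed⊆subfield {x} = #-⊆-≡ E.mem? (Fixed.mem? s) elems (λ _ → subfield⊆fixed)
      (ℕ.≤-reflexive (trans (fixed-card degree>0 degree-∣) (sym card≡))) (complete x)

    -- E is a vector space over GF(q^t), so q^s is a power of q^t.
    fixed⊆subfield⇒∣ : ∀ {t} → 0 < t → t ∣ l → (∀ {x} → Fixed.Mem t x → E.Mem x) → t ∣ s
    fixed⊆subfield⇒∣ {t} 0<t t∣l K⊆E with SubfieldProperties.count-power (fixedField t) E.mem? (SubfieldProperties.subspace (fixedField t) E K⊆E)
    ... | n , eq = divides n (q^-cancel (trans (sym card≡) (trans eq (trans (cong (_^ n) (fixed-card 0<t t∣l)) (trans (ℕ.^-*-assoc q t n) (cong (q ^_) (ℕ.*-comm t n)))))))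

    ∣⇒fixed⊆subfield : ∀ {t} → t ∣ s → ∀ {x} → Fixed.Mem t x → E.Mem x
    ∣⇒fixed⊆subfield t∣s m = fixed⊆subfield (fixed-⊆ t∣s m)

  subfield-card : (E : Subfield L) → (∀ {x} → Base.Mem x → Subfield.Mem E x) → ∃[ s ] Subfield.card E ≡ q ^ s
  subfield-card E F⊆E = let n , eq = BaseProperties.count-power (Subfield.mem? E) (BaseProperties.subspace E F⊆E)
                        in n , trans eq (cong (_^ n) base-card)

-- Orbits of the multiplicative group on the spans of k-tuples

module Orbits {q l : ℕ} {F : FiniteField q} {L : FiniteField (q ^ l)} (φ : F ↪ L) (k : ℕ) where
  open FiniteField L
  open FieldTheory L hiding (_⊖_)
  open Extension {q} {l} φ
  open BaseProperties.line using (Span; span?; IsSubspace; span-isSubspace; span-least; span-members; span-mono; Ind; ind?; card-span;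
    generates?; #-spanningTuples)

  Tuple : Set
  Tuple = Vec Carrier k

  stabilizerOf : Tuple → Subfield L
  stabilizerOf a = BaseProperties.stabilizer (span? a) (span-isSubspace a)

  module Stab a = Subfield (stabilizerOf a)

  rank? : ∀ d (a : Tuple) → Dec (count (span? a) ≡ q ^ d)
  rank? d a = count (span? a) ℕ.≟ q ^ d

  HasType : ℕ → ℕ → Tuple → Set
  HasType d u a = count (span? a) ≡ q ^ d × Stab.card a ≡ q ^ u

  hasType? : ∀ d u → Decidable (HasType d u)
  hasType? d u a = rank? d a ×-dec (Stab.card a ℕ.≟ q ^ u)

  -- For nonzero c this says that c times the span of a is the span of b; stated through the
  -- preimage, it involves no inverse of c. Tuples enter only through their spans, so `_~_` is the
  -- orbit relation of H on spans.
  Scaled : Carrier → Tuple → Tuple → Set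
  Scaled c a b = ∀ y → (Span a y → Span b (c ⊗ y)) × (Span b (c ⊗ y) → Span a y)

  infix 4 _~_
  _~_ : Tuple → Tuple → Set
  a ~ b = ∃[ c ] c ≢ 𝟘 × Scaled c a b

  scaled? : ∀ c a b → Dec (c ≢ 𝟘 × Scaled c a b)
  scaled? c a b = ¬? (c ≟ 𝟘) ×-dec ∀? (λ y → (span? a y →-dec span? b (c ⊗ y)) ×-dec (span? b (c ⊗ y) →-dec span? a y))

  _~?_ : ∀ a b → Dec (a ~ b)
  a ~? b = ∃? (λ c → scaled? c a b)

  ~-refl : ∀ {a} → a ~ a
  ~-refl {a} = 𝟙 , 𝟙≢𝟘 , λ y → subst (Span a) (sym (*-identityˡ y)) , subst (Span a) (*-identityˡ y)

  ~-sym : ∀ {a b} → a ~ b → b ~ a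
  ~-sym {a} {b} (c , c≢0 , h) with inverse c c≢0
  ... | d , dc = d , inverse≢0 dc , λ y →
    (λ s → proj₂ (h (d ⊗ y)) (subst (Span b) (sym (⊗-inverse dc y)) s)) ,
    (λ s → subst (Span b) (⊗-inverse dc y) (proj₁ (h (d ⊗ y)) s))

  ~-trans : ∀ {a b c} → a ~ b → b ~ c → a ~ c
  ~-trans {c = c} (x , x≢0 , h) (y , y≢0 , h′) = y ⊗ x , ⊗≢0 y≢0 x≢0 , λ z →
    (λ s → subst (Span c) (sym (*-assoc y x z)) (proj₁ (h′ _) (proj₁ (h z) s))) ,
    (λ s → proj₂ (h z) (proj₂ (h′ _) (subst (Span c) (*-assoc y x z) s)))

  module Reps = Representatives _~?_ ~-refl ~-sym ~-trans

  preimage : Carrier → Tuple → Pred Carrier 0ℓ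
  preimage c a y = Span a (c ⊗ y)

  preimage? : ∀ c a → Decidable (preimage c a)
  preimage? c a y = span? a (c ⊗ y)

  preimage-isSubspace : ∀ c a → IsSubspace (preimage c a)
  preimage-isSubspace c a = record
    { has-0 = subst (Span a) (sym (zeroʳ c)) has-0
    ; has-+ = λ p r → subst (Span a) (sym (distribˡ c _ _)) (has-+ p r)
    ; has-* = λ {b} {x} m p → subst (Span a) (exchange b x) (has-* m p)
    }
    where
    open IsSubspace (span-isSubspace a)
    exchange : ∀ b x → b ⊗ (c ⊗ x) ≡ c ⊗ (b ⊗ x)
    exchange b x = trans (sym (*-assoc b c x)) (trans (cong (_⊗ x) (*-comm b c)) (*-assoc c b x))

  preimage-count : ∀ {c} a → c ≢ 𝟘 → count (preimage? c a) ≡ count (span? a)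
  preimage-count {c} a c≢0 with inverse c c≢0
  ... | d , dc = doubleCount elems elems (λ y z → span? a z ×-dec (c ⊗ y ≟ z))
    (λ {y} _ → ⟦⟧-unique (preimage? c a y) (λ s → count-one _ (s , refl) (λ _ (_ , e) → sym e))
      (λ ¬s → #-none _ elems (λ { _ (s , refl) → ¬s s })))
    (λ {z} _ → ⟦⟧-unique (span? a z) (λ s → count-one (λ y → span? a z ×-dec (c ⊗ y ≟ z)) {d ⊗ z} (s , ⊗-inverse dc z) (λ y (_ , e) → ⊗-cancelˡ c≢0 (trans e (sym (⊗-inverse dc z)))))
      (λ ¬s → #-none _ elems (λ _ (s , _) → ¬s s)))

  ~-rank : ∀ {a b} → a ~ b → count (span? a) ≡ count (span? b)
  ~-rank {a} {b} (c , c≢0 , h) = trans (#-cong (span? a) (preimage? c b) elems (proj₁ ∘ h) (proj₂ ∘ h)) (preimage-count b c≢0)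

  ~-stab-⊆ : ∀ {a b} → a ~ b → ∀ x → Stab.Mem a x → Stab.Mem b x
  ~-stab-⊆ {a} {b} (c , c≢0 , h) x m y s with inverse c c≢0
  ... | d , dc = subst (Span b) (trans (sym (*-assoc c x _)) (trans (cong (_⊗ (d ⊗ y)) (*-comm c x)) (trans (*-assoc x c _) (cong (x ⊗_) (⊗-inverse dc y)))))
      (proj₁ (h _) (m (d ⊗ y) (proj₂ (h (d ⊗ y)) (subst (Span b) (sym (⊗-inverse dc y)) s))))

  ~-hasType : ∀ d u {a b} → a ~ b → HasType d u a → HasType d u b
  ~-hasType d u {a} {b} r (e , e′) = trans (sym (~-rank r)) e ,
    trans (#-cong (Stab.mem? b) (Stab.mem? a) elems (~-stab-⊆ (~-sym r)) (~-stab-⊆ r)) e′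

  #-spanning : {P : Pred Carrier 0ℓ} (P? : Decidable P) → IsSubspace P → ∀ d → count P? ≡ q ^ d →
               {R : Tuple → Set} (R? : Decidable R) →
               (∀ a → (∀ y → (Span a y → P y) × (P y → Span a y)) → R a) →
               (∀ a → R a → ∀ y → (Span a y → P y) × (P y → Span a y)) →
               # R? ∈ tuples finite k ≡ spanningTuples q d k 0
  #-spanning P? sub d size R? to from = trans
    (#-cong R? (generates? P? sub {d} size′ []) (tuples finite k)
      (λ a r → VAll.map (λ {y} → proj₁ (from a r y)) (span-members a) , λ y → proj₂ (from a r y))
      (λ a (ps , g) → to a (λ y → span-least sub ps , g y)))
    (trans (#-spanningTuples P? sub {d} size′ tt [] k) (cong (λ c → spanningTuples c d k 0) base-card))
    where size′ = trans size (cong (_^ d) (sym base-card))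

  -- Orbit-stabilizer with denominators cleared. The pairs of a nonzero c and a tuple a with c Span
  -- a = Span a₀ are counted: each c leaves the k-tuples spanning c⁻¹ Span a₀, and each a in the
  -- class has a coset of the stabilizer, that is q^u - 1 scalars.
  class-size : ∀ d u {a₀} → HasType d u a₀ → # (_~? a₀) ∈ tuples finite k * (q ^ u ∸ 1) ≡ (q ^ l ∸ 1) * spanningTuples q d k 0
  class-size d u {a₀} (rank , stab) = trans (sym (sumOver-*ʳ (tuples finite k) _ (q ^ u ∸ 1)))
    (trans (doubleCount (tuples finite k) elems (λ a c → scaled? c a a₀) (λ {a} _ → per-a a (a ~? a₀)) (λ {c} _ → per-c c (¬? (c ≟ 𝟘))))
    (trans (sumOver-*ʳ elems _ (spanningTuples q d k 0)) (cong (_* spanningTuples q d k 0) count-nonzero)))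
    where
    per-c : ∀ c (n : Dec (c ≢ 𝟘)) → # (λ a → scaled? c a a₀) ∈ tuples finite k ≡ ⟦ n ⟧ * spanningTuples q d k 0
    per-c c (no c≡0)  = #-none _ (tuples finite k) (λ _ (c≢0 , _) → c≡0 c≢0)
    per-c c (yes c≢0) = trans (#-spanning (preimage? c a₀) (preimage-isSubspace c a₀) d (trans (preimage-count a₀ c≢0) rank)
      (λ a → scaled? c a a₀) (λ a h → c≢0 , h) (λ a → proj₂)) (sym (ℕ.+-identityʳ _))

    nonzeroStab? : Decidable (λ e → e ≢ 𝟘 × Stab.Mem a₀ e)
    nonzeroStab? e = ¬? (e ≟ 𝟘) ×-dec Stab.mem? a₀ e

    #nonzeroStab : count nonzeroStab? ≡ q ^ u ∸ 1
    #nonzeroStab = trans (#-cong nonzeroStab? (λ e → Stab.mem? a₀ e ×-dec ¬? (e ≟ 𝟘)) elems (λ _ (x , y) → y , x) (λ _ (x , y) → y , x))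
      (trans (Linear.Over.#-∸ (lineModule L) baseField (Stab.mem? a₀) (_≟ 𝟘) (λ { _ refl → Stab.𝟘-closed a₀ }))
      (cong₂ _∸_ stab (count-one (_≟ 𝟘) refl (λ _ e → e))))

    per-a : ∀ a (r : Dec (a ~ a₀)) → count (λ c → scaled? c a a₀) ≡ ⟦ r ⟧ * (q ^ u ∸ 1)
    per-a a (no ¬r) = #-none _ elems (λ {c} _ p → ¬r (c , p))
    per-a a (yes (c₀ , c₀≢0 , h₀)) with inverse c₀ c₀≢0
    ... | d₀ , d₀c₀ = trans (doubleCount elems elems (λ c e → scaled? c a a₀ ×-dec (c ≟ e ⊗ c₀))
      (λ {c} _ → ⟦⟧-unique (scaled? c a a₀)
        (λ s → count-one (λ e → scaled? c a a₀ ×-dec (c ≟ e ⊗ c₀)) {c ⊗ d₀} (s , sym (c-d c))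
          (λ e (_ , c≡) → ⊗-cancelˡ c₀≢0 (trans (*-comm c₀ e) (trans (sym c≡) (trans (sym (c-d c)) (*-comm _ c₀))))))
        (λ ¬s → #-none _ elems (λ _ (s , _) → ¬s s)))
      (λ {e} _ → ⟦⟧-unique (nonzeroStab? e)
        (λ n → count-one (λ c → scaled? c a a₀ ×-dec (c ≟ e ⊗ c₀)) (to-scaled n , refl) (λ _ → proj₂))
        (λ ¬n → #-none _ elems (λ { _ (s , refl) → ¬n (from-scaled s) }))))
      (trans #nonzeroStab (sym (ℕ.+-identityʳ _)))
      where
      c-d : ∀ y → (y ⊗ d₀) ⊗ c₀ ≡ y
      c-d y = trans (*-assoc y d₀ c₀) (trans (cong (y ⊗_) d₀c₀) (*-identityʳ y))

      to-scaled : ∀ {e} → e ≢ 𝟘 × Stab.Mem a₀ e → (e ⊗ c₀) ≢ 𝟘 × Scaled (e ⊗ c₀) a a₀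
      to-scaled {e} (e≢0 , m) with inverse e e≢0
      ... | e⁻¹ , e⁻¹e = ⊗≢0 e≢0 c₀≢0 , λ y →
        (λ s → subst (Span a₀) (sym (*-assoc e c₀ y)) (m _ (proj₁ (h₀ y) s))) ,
        (λ s → proj₂ (h₀ y) (subst (Span a₀) (trans (cong (e⁻¹ ⊗_) (*-assoc e c₀ y)) (trans (sym (*-assoc e⁻¹ e _)) (trans (cong (_⊗ (c₀ ⊗ y)) e⁻¹e) (*-identityˡ _))))
          (Stab.inverse-closed a₀ m e⁻¹e _ s)))

      from-scaled : ∀ {e} → (e ⊗ c₀) ≢ 𝟘 × Scaled (e ⊗ c₀) a a₀ → e ≢ 𝟘 × Stab.Mem a₀ e
      from-scaled {e} (ec₀≢0 , h) = (λ { refl → ec₀≢0 (zeroˡ c₀) }) , λ y s →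
        subst (Span a₀) (trans (*-assoc e c₀ _) (cong (e ⊗_) (⊗-inverse d₀c₀ y)))
          (proj₁ (h (d₀ ⊗ y)) (proj₂ (h₀ _) (subst (Span a₀) (sym (⊗-inverse d₀c₀ y)) s)))

  classReps : ℕ → ℕ → List Tuple
  classReps d u = Reps.reps (filter (hasType? d u) (tuples finite k))

  classReps-hasType : ∀ d u {a} → a ∈ classReps d u → HasType d u a
  classReps-hasType d u a∈ = proj₂ (∈-filter⁻ (hasType? d u) {xs = tuples finite k} (Reps.reps-⊆ _ a∈))

  #hasType : ℕ → ℕ → ℕ
  #hasType d u = # hasType? d u ∈ tuples finite k

  -- All classes of this type have the size given by `class-size`, and together they exhaust the
  -- tuples of the type.
  #classReps : ∀ d u → length (classReps d u) * ((q ^ l ∸ 1) * spanningTuples q d k 0) ≡ #hasType d u * (q ^ u ∸ 1)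
  #classReps d u = begin
    length (classReps d u) * ((q ^ l ∸ 1) * spanningTuples q d k 0) ≡⟨ sumOver-const (classReps d u) _ ⟨
    sumOver (classReps d u) (λ _ → (q ^ l ∸ 1) * spanningTuples q d k 0) ≡⟨ sumOver-cong∈ (classReps d u) (λ a∈ → sym (class-size d u (classReps-hasType d u a∈))) ⟩
    sumOver (classReps d u) (λ a₀ → # (_~? a₀) ∈ tuples finite k * (q ^ u ∸ 1)) ≡⟨ sumOver-*ʳ (classReps d u) _ _ ⟩
    sumOver (classReps d u) (λ a₀ → # (_~? a₀) ∈ tuples finite k) * (q ^ u ∸ 1) ≡⟨ cong (_* (q ^ u ∸ 1)) (doubleCount (classReps d u) (tuples finite k) (λ a₀ a → a ~? a₀) (λ _ → refl) (λ {a} _ → per-a a)) ⟩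
    #hasType d u * (q ^ u ∸ 1)                                                            ∎
    where
    open ≡-Reasoning
    per-a : ∀ a → # (λ a₀ → a ~? a₀) ∈ classReps d u ≡ ⟦ hasType? d u a ⟧
    per-a a = ⟦⟧-unique (hasType? d u a)
      (λ t → trans (Reps.#-inequivalent a (Reps.reps-inequivalent _)) (⟦⟧-yes (Any.any? (a ~?_) (classReps d u))
        (let b , b∈ , a~b = Reps.reps-cover (filter (hasType? d u) (tuples finite k)) (∈-filter⁺ (hasType? d u) (Finite.complete (finiteVec finite k) a) t)
         in lose b∈ a~b)))
      (λ ¬t → #-none _ (classReps d u) (λ b∈ a~b → ¬t (~-hasType d u (~-sym a~b) (classReps-hasType d u b∈))))

  closed? : ∀ d t → Decidable (λ a → count (span? a) ≡ q ^ d × (∀ x → Fixed.Mem t x → Stab.Mem a x))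
  closed? d t a = rank? d a ×-dec ∀? (λ x → Fixed.mem? t x →-dec Stab.mem? a x)

  #closed : ℕ → ℕ → ℕ
  #closed d t = # closed? d t ∈ tuples finite k

  private
    module LineOver (E : Subfield L) = Linear.Over (lineModule L) E

  -- Pairs of a closed tuple and a basis of its span over GF(q^t), of n = d/t vectors, are counted
  -- in two ways. The quotient of the two values of `extensions` is the Gaussian binomial
  -- coefficient of l/t over d/t at q^t.
  #closed-extensions : ∀ t n n′ → 0 < t → l ≡ n′ * t →
    #closed (n * t) t * extensions (q ^ t) n 0 n ≡ extensions (q ^ t) n′ 0 n * spanningTuples q (n * t) k 0
  #closed-extensions t n n′ 0<t l≡ = begin
    #closed d t * extensions (q ^ t) n 0 n ≡⟨ sumOver-*ʳ (tuples finite k) _ _ ⟨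
    sumOver (tuples finite k) (λ a → ⟦ closed? d t a ⟧ * extensions (q ^ t) n 0 n) ≡⟨ doubleCount (tuples finite k) (tuples finite n) spans? (λ {a} _ → per-a a (closed? d t a)) (λ {b} _ → per-b b (T.ind? b)) ⟩
    sumOver (tuples finite n) (λ b → ⟦ T.ind? b ⟧ * spanningTuples q d k 0) ≡⟨ sumOver-*ʳ (tuples finite n) _ _ ⟩
    # T.ind? ∈ tuples finite n * spanningTuples q d k 0 ≡⟨ cong (_* spanningTuples q d k 0) #ind ⟩
    extensions (q ^ t) n′ 0 n * spanningTuples q d k 0                           ∎
    where
    open ≡-Reasoning
    d = n * t
    module T = LineOver (fixedField t)

    card≡ : Fixed.card t ≡ q ^ t
    card≡ = fixed-card 0<t (divides n′ l≡)

    power : ∀ i → q ^ (i * t) ≡ Fixed.card t ^ i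
    power i = trans (cong (q ^_) (ℕ.*-comm i t)) (trans (sym (ℕ.^-*-assoc q t i)) (cong (_^ i) (sym card≡)))

    #ind : # T.ind? ∈ tuples finite n ≡ extensions (q ^ t) n′ 0 n
    #ind = trans (#-cong T.ind? (λ b → T.ind? b ×-dec VAll.all? (λ _ → yes tt) b) (tuples finite n) (λ b i → i , VAll.universal (λ _ → tt) b) (λ b → proj₁))
      (trans (T.#-independent {λ _ → ⊤} (λ _ → yes tt) (record { has-0 = tt ; has-+ = λ _ _ → tt ; has-* = λ _ _ → tt })
        (trans (whole-card L) (trans (cong (q ^_) l≡) (power n′))) n)
      (cong (λ c → extensions c n′ 0 n) card≡))

    spans? : (a : Tuple) (b : Vec Carrier n) → Dec (T.Ind b × (∀ y → (Span a y → T.Span b y) × (T.Span b y → Span a y)))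
    spans? a b = T.ind? b ×-dec ∀? (λ y → (span? a y →-dec T.span? b y) ×-dec (T.span? b y →-dec span? a y))

    over-base : {P : Pred Carrier 0ℓ} → T.IsSubspace P → IsSubspace P
    over-base sub = record { has-0 = has-0 ; has-+ = has-+ ; has-* = λ m → has-* (base⊆fixed t m) }
      where open T.IsSubspace sub

    per-b : ∀ b (i : Dec (T.Ind b)) → # (λ a → spans? a b) ∈ tuples finite k ≡ ⟦ i ⟧ * spanningTuples q d k 0
    per-b b (no ¬i) = #-none _ (tuples finite k) (λ _ (i , _) → ¬i i)
    per-b b (yes i) = trans (#-spanning (T.span? b) (over-base (T.span-isSubspace b)) d (trans (T.card-span i) (sym (power n)))
      (λ a → spans? a b) (λ a h → i , h) (λ a → proj₂)) (sym (ℕ.+-identityʳ _))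

    per-a : ∀ a (c : Dec _) → # spans? a ∈ tuples finite n ≡ ⟦ c ⟧ * extensions (q ^ t) n 0 n
    per-a a (yes (rank , closed)) = trans
      (trans (#-cong (spans? a) (λ b → T.ind? b ×-dec VAll.all? (span? a) b) (tuples finite n)
        (λ b (i , h) → i , VAll.map (λ {y} → proj₂ (h y)) (T.span-members b))
        (λ b (i , ps) → i , λ y → T.independent-spans (span? a) sub i ps power-size , T.span-least sub ps))
      (trans (T.#-independent (span? a) sub power-size n) (cong (λ c → extensions c n 0 n) card≡))) (sym (ℕ.+-identityʳ _))
      where
      sub : T.IsSubspace (Span a)
      sub = record { has-0 = IsSubspace.has-0 (span-isSubspace a) ; has-+ = IsSubspace.has-+ (span-isSubspace a) ; has-* = λ {c} {x} m → closed c m x }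

      power-size : count (span? a) ≡ Fixed.card t ^ n
      power-size = trans rank (power n)
    per-a a (no ¬c) = #-none _ (tuples finite n) (λ {b} _ (i , h) → ¬c
      ( trans (#-cong (span? a) (T.span? b) elems (λ y → proj₁ (h y)) (λ y → proj₂ (h y))) (trans (T.card-span i) (sym (power n)))
      , λ x m y s → proj₂ (h _) (T.IsSubspace.has-* (T.span-isSubspace b) m (proj₁ (h y) s))))

  -- Every tuple of rank d has a stabilizer of order q ^ s for exactly one s, and s ∣ gcd d l.
  #closed-∑ : ∀ d t → 0 < t → t ∣ gcd d l →
    #closed d t ≡ sumOver (upTo (gcd d l)) (λ i → ⟦ (suc i ∣? gcd d l) ×-dec (t ∣? suc i) ⟧ * #hasType d (suc i))
  #closed-∑ d t 0<t t∣G = begin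
    #closed d t ≡⟨ doubleCount (tuples finite k) (upTo G) typed? (λ {a} _ → per-a a) (λ {i} _ → per-i i) ⟩
    sumOver (upTo G) (λ i → ⟦ (suc i ∣? G) ×-dec (t ∣? suc i) ⟧ * #hasType d (suc i))          ∎
    where
    open ≡-Reasoning
    G = gcd d l

    typed? : (a : Tuple) (i : ℕ) → Dec ((suc i ∣ G × t ∣ suc i) × HasType d (suc i) a)
    typed? a i = ((suc i ∣? G) ×-dec (t ∣? suc i)) ×-dec hasType? d (suc i) a

    per-i : ∀ i → # (λ a → typed? a i) ∈ tuples finite k ≡ ⟦ (suc i ∣? G) ×-dec (t ∣? suc i) ⟧ * #hasType d (suc i)
    per-i i = trans (sumOver-cong (tuples finite k) (λ a → ⟦⟧-× ((suc i ∣? G) ×-dec (t ∣? suc i)) (hasType? d (suc i) a))) (sumOver-*ˡ (tuples finite k) _ ⟦ (suc i ∣? G) ×-dec (t ∣? suc i) ⟧)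

    0<G : 0 < G
    0<G = ℕ.n≢0⇒n>0 (λ G≡0 → ℕ.<⇒≢ (degree>0 (wholeField L) (whole-card L)) (sym (gcd[m,n]≡0⇒n≡0 d G≡0)))

    per-a : ∀ a → # typed? a ∈ upTo G ≡ ⟦ closed? d t a ⟧
    per-a a = ⟦⟧-unique (closed? d t a) one (λ ¬c → #-none _ (upTo G) (λ {i} _ ((_ , t∣) , (rank , stab)) → ¬c (rank , λ x → ∣⇒fixed⊆subfield (stabilizerOf a) stab t∣)))
      where
      one : count (span? a) ≡ q ^ d × (∀ x → Fixed.Mem t x → Stab.Mem a x) → # typed? a ∈ upTo G ≡ 1
      one (rank , closed) = by-degree (subfield-card (stabilizerOf a) (λ {x} m y → IsSubspace.has-* (span-isSubspace a) m))
        where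
        by-degree : ∃[ s ] Stab.card a ≡ q ^ s → # typed? a ∈ upTo G ≡ 1
        by-degree (zero  , card≡) = contradiction (degree>0 (stabilizerOf a) card≡) (ℕ.<-irrefl refl)
        by-degree (suc i , card≡) = #-one (typed? a) (Unique.upTo⁺ G) (∈-upTo⁺ (∣.∣⇒≤ {{ℕ.>-nonZero 0<G}} s∣G)) ((s∣G , t∣s) , rank , card≡)
          (λ _ (_ , _ , card≡′) → ℕ.suc-injective (q^-cancel (trans (sym card≡′) card≡)))
          where
          s∣G : suc i ∣ G
          s∣G = gcd-greatest {d} {l} (dimension-∣ (stabilizerOf a) card≡ (span? a)
            (record { has-0 = IsSubspace.has-0 (span-isSubspace a) ; has-+ = IsSubspace.has-+ (span-isSubspace a) ; has-* = λ {c} {x} m → m x }) {d} rank)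
            (degree-∣ (stabilizerOf a) card≡)

          t∣s : t ∣ suc i
          t∣s = fixed⊆subfield⇒∣ (stabilizerOf a) card≡ 0<t (∣.∣-trans t∣G (gcd[m,n]∣n d l)) (λ {x} → closed x)

-- Integers in the rationals and finite sums

toℚᵘ-fromℤ : ∀ z → ℚ.toℚᵘ (fromℤ z) ℚᵘ.≃ ℚᵘ.mkℚᵘ z 0
toℚᵘ-fromℤ z = ℚ.toℚᵘ-fromℚᵘ (ℚᵘ.mkℚᵘ z 0)

fromℤ-+ : ∀ x y → fromℤ (x ℤ.+ y) ≡ fromℤ x ℚ.+ fromℤ y
fromℤ-+ x y = ℚ.toℚᵘ-injective (ℚᵘ.≃-trans (toℚᵘ-fromℤ (x ℤ.+ y)) (ℚᵘ.≃-sym (ℚᵘ.≃-trans (ℚ.toℚᵘ-homo-+ (fromℤ x) (fromℤ y))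
  (ℚᵘ.≃-trans (ℚᵘ.+-cong (toℚᵘ-fromℤ x) (toℚᵘ-fromℤ y)) (ℚᵘ.*≡* (cong (ℤ._* 1ℤ) (cong₂ ℤ._+_ (ℤ.*-identityʳ x) (ℤ.*-identityʳ y))))))))

fromℤ-* : ∀ x y → fromℤ (x ℤ.* y) ≡ fromℤ x ℚ.* fromℤ y
fromℤ-* x y = ℚ.toℚᵘ-injective (ℚᵘ.≃-trans (toℚᵘ-fromℤ (x ℤ.* y)) (ℚᵘ.≃-sym (ℚᵘ.≃-trans (ℚ.toℚᵘ-homo-* (fromℤ x) (fromℤ y))
  (ℚᵘ.*-cong (toℚᵘ-fromℤ x) (toℚᵘ-fromℤ y)))))

fromℤ-≤ : ∀ {x y} → fromℤ x ℚ.≤ fromℤ y → x ℤ.≤ y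
fromℤ-≤ {x} {y} le = subst₂ ℤ._≤_ (ℤ.*-identityʳ x) (ℤ.*-identityʳ y) (ℚᵘ.drop-*≤*
  (ℚᵘ.≤-respʳ-≃ (toℚᵘ-fromℤ y) (ℚᵘ.≤-respˡ-≃ (toℚᵘ-fromℤ x) (ℚ.toℚᵘ-mono-≤ le))))

fromℤ-injective : ∀ {x y} → fromℤ x ≡ fromℤ y → x ≡ y
fromℤ-injective e = ℤ.≤-antisym (fromℤ-≤ (ℚ.≤-reflexive e)) (fromℤ-≤ (ℚ.≤-reflexive (sym e)))

fromℕ-+ : ∀ m n → fromℕ (m + n) ≡ fromℕ m ℚ.+ fromℕ n
fromℕ-+ m n = fromℤ-+ (+ m) (+ n)

fromℕ-* : ∀ m n → fromℕ (m * n) ≡ fromℕ m ℚ.* fromℕ n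
fromℕ-* m n = trans (cong fromℤ (ℤ.pos-* m n)) (fromℤ-* (+ m) (+ n))

fromℕ-injective : ∀ {m n} → fromℕ m ≡ fromℕ n → m ≡ n
fromℕ-injective e = ℤ.+-injective (fromℤ-injective e)

fromℕ-∸ : ∀ {m n} → n ≤ m → fromℕ (m ∸ n) ≡ fromℕ m ℚ.- fromℕ n
fromℕ-∸ {m} {n} n≤m = begin
  fromℕ (m ∸ n) ≡⟨ solve 2 (λ x y → x := x :+ y :- y) refl (fromℕ (m ∸ n)) (fromℕ n) ⟩
  fromℕ (m ∸ n) ℚ.+ fromℕ n ℚ.- fromℕ n ≡⟨ cong (ℚ._- fromℕ n) (fromℕ-+ (m ∸ n) n) ⟨
  fromℕ (m ∸ n + n) ℚ.- fromℕ n ≡⟨ cong (λ x → fromℕ x ℚ.- fromℕ n) (ℕ.m∸n+n≡m n≤m) ⟩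
  fromℕ m ℚ.- fromℕ n                        ∎
  where
  open ≡-Reasoning
  open ℚ.+-*-Solver

÷₀-* : ∀ x {y} → y ≢ 0ℚ → (x ÷₀ y) ℚ.* y ≡ x
÷₀-* x {y} y≢0 with y ℚ.≟ 0ℚ
... | yes y≡0 = contradiction y≡0 y≢0
... | no  _   = trans (ℚ.*-assoc x (ℚ.1/ y) y) (trans (cong (x ℚ.*_) (ℚ.*-inverseˡ y)) (ℚ.*-identityʳ x))
  where instance _ = ℚ.≢-nonZero y≢0

ℚ-*-cancelʳ : ∀ {x y z} → z ≢ 0ℚ → x ℚ.* z ≡ y ℚ.* z → x ≡ y
ℚ-*-cancelʳ {x} {y} {z} z≢0 e = trans (sym (undo x)) (trans (cong (ℚ._* ℚ.1/ z) e) (undo y))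
  where
  instance _ = ℚ.≢-nonZero z≢0
  undo : ∀ x → x ℚ.* z ℚ.* ℚ.1/ z ≡ x
  undo x = trans (ℚ.*-assoc x z _) (trans (cong (x ℚ.*_) (ℚ.*-inverseʳ z)) (ℚ.*-identityʳ x))

ℚ-*-≢0 : ∀ {x y} → x ≢ 0ℚ → y ≢ 0ℚ → x ℚ.* y ≢ 0ℚ
ℚ-*-≢0 {x} {y} x≢0 y≢0 e = x≢0 (ℚ-*-cancelʳ y≢0 (trans e (sym (ℚ.*-zeroˡ y))))

⟦_⟧ℚ : ∀ {p} {P : Set p} → Dec P → ℚ
⟦ p? ⟧ℚ = fromℕ ⟦ p? ⟧

if-⟦⟧ : ∀ {p} {P : Set p} (p? : Dec P) x → (if does p? then x else 0ℚ) ≡ ⟦ p? ⟧ℚ ℚ.* x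
if-⟦⟧ (yes _) x = sym (ℚ.*-identityˡ x)
if-⟦⟧ (no _)  x = sym (ℚ.*-zeroˡ x)

∑-cong∈ : (xs : List X) {f g : X → ℚ} → (∀ {x} → x ∈ xs → f x ≡ g x) → ∑ xs f ≡ ∑ xs g
∑-cong∈ []       e = refl
∑-cong∈ (x ∷ xs) e = cong₂ ℚ._+_ (e (here refl)) (∑-cong∈ xs (e ∘ there))

∑-cong : (xs : List X) {f g : X → ℚ} → (∀ x → f x ≡ g x) → ∑ xs f ≡ ∑ xs g
∑-cong xs e = ∑-cong∈ xs (λ {x} _ → e x)

∑-0 : (xs : List X) {f : X → ℚ} → (∀ {x} → x ∈ xs → f x ≡ 0ℚ) → ∑ xs f ≡ 0ℚ
∑-0 []       e = refl
∑-0 (x ∷ xs) e = trans (cong₂ ℚ._+_ (e (here refl)) (∑-0 xs (e ∘ there))) (ℚ.+-identityˡ 0ℚ)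

∑-+ : (xs : List X) (f g : X → ℚ) → ∑ xs (λ x → f x ℚ.+ g x) ≡ ∑ xs f ℚ.+ ∑ xs g
∑-+ []       f g = refl
∑-+ (x ∷ xs) f g = trans (cong (f x ℚ.+ g x ℚ.+_) (∑-+ xs f g))
  (solve 4 (λ a b c d → (a :+ b) :+ (c :+ d) := (a :+ c) :+ (b :+ d)) refl (f x) (g x) (∑ xs f) (∑ xs g))
  where open ℚ.+-*-Solver

∑-*ˡ : (c : ℚ) (xs : List X) (f : X → ℚ) → ∑ xs (λ x → c ℚ.* f x) ≡ c ℚ.* ∑ xs f
∑-*ˡ c []       f = sym (ℚ.*-zeroʳ c)
∑-*ˡ c (x ∷ xs) f = trans (cong (c ℚ.* f x ℚ.+_) (∑-*ˡ c xs f)) (sym (ℚ.*-distribˡ-+ c (f x) (∑ xs f)))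

∑-swap : (xs : List X) (ys : List Y) (f : X → Y → ℚ) → ∑ xs (λ x → ∑ ys (f x)) ≡ ∑ ys (λ y → ∑ xs (λ x → f x y))
∑-swap []       ys f = sym (∑-0 ys (λ _ → refl))
∑-swap (x ∷ xs) ys f = trans (cong (∑ ys (f x) ℚ.+_) (∑-swap xs ys f)) (sym (∑-+ ys (f x) _))

∑-map : (g : Y → X) (ys : List Y) (f : X → ℚ) → ∑ (map g ys) f ≡ ∑ ys (f ∘ g)
∑-map g []       f = refl
∑-map g (y ∷ ys) f = cong (f (g y) ℚ.+_) (∑-map g ys f)

fromℕ-sumOver : (xs : List X) (f : X → ℕ) → fromℕ (sumOver xs f) ≡ ∑ xs (fromℕ ∘ f)
fromℕ-sumOver []       f = refl
fromℕ-sumOver (x ∷ xs) f = trans (fromℕ-+ (f x) _) (cong (fromℕ (f x) ℚ.+_) (fromℕ-sumOver xs f))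

∑-⟦⟧ : (xs : List X) {P : Pred X 0ℓ} (P? : Decidable P) (c : ℚ) → ∑ xs (λ x → ⟦ P? x ⟧ℚ ℚ.* c) ≡ fromℕ (# P? ∈ xs) ℚ.* c
∑-⟦⟧ xs P? c = trans (∑-cong xs (λ x → ℚ.*-comm ⟦ P? x ⟧ℚ c)) (trans (∑-*ˡ c xs _) (trans (cong (c ℚ.*_) (sym (fromℕ-sumOver xs _))) (ℚ.*-comm c _)))

-- Each x in the support of h has exactly one preimage under g, so the indicator of g y = x sums to
-- 1 over y; exchanging the sums leaves the sum over `ys`. Where h vanishes nothing has to be
-- covered.
∑-reindex : {xs ys : List ℕ} → Unique xs → Unique ys → (g : ℕ → ℕ) → (∀ {y z} → y ∈ ys → z ∈ ys → g y ≡ g z → y ≡ z) →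
            (∀ {y} → y ∈ ys → g y ∈ xs) → {h : ℕ → ℚ} →
            (∀ {x} → x ∈ xs → h x ≢ 0ℚ → ∃[ y ] y ∈ ys × g y ≡ x) → ∑ xs h ≡ ∑ ys (h ∘ g)
∑-reindex {xs} {ys} uxs uys g inj g∈ {h} cover = begin
  ∑ xs h ≡⟨ ∑-cong∈ xs row ⟩
  ∑ xs (λ x → ∑ ys (λ y → ⟦ g y ℕ.≟ x ⟧ℚ ℚ.* h x)) ≡⟨ ∑-swap xs ys _ ⟩
  ∑ ys (λ y → ∑ xs (λ x → ⟦ g y ℕ.≟ x ⟧ℚ ℚ.* h x)) ≡⟨ ∑-cong∈ ys column ⟩
  ∑ ys (h ∘ g)                                                  ∎
  where
  open ≡-Reasoning
  row : ∀ {x} → x ∈ xs → h x ≡ ∑ ys (λ y → ⟦ g y ℕ.≟ x ⟧ℚ ℚ.* h x)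
  row {x} x∈ = by-cases (h x ℚ.≟ 0ℚ)
    where
    one : ∃[ y ] y ∈ ys × g y ≡ x → h x ≡ ∑ ys (λ y → ⟦ g y ℕ.≟ x ⟧ℚ ℚ.* h x)
    one (y , y∈ , refl) = sym (trans (∑-⟦⟧ ys (λ y → g y ℕ.≟ x) (h x))
      (trans (cong (λ n → fromℕ n ℚ.* h x) (#-one (λ y → g y ℕ.≟ x) uys y∈ refl (λ z∈ e → inj z∈ y∈ e))) (ℚ.*-identityˡ _)))

    by-cases : Dec (h x ≡ 0ℚ) → h x ≡ ∑ ys (λ y → ⟦ g y ℕ.≟ x ⟧ℚ ℚ.* h x)
    by-cases (yes h≡0) = trans h≡0 (sym (∑-0 ys (λ {y} _ → trans (cong (⟦ g y ℕ.≟ x ⟧ℚ ℚ.*_) h≡0) (ℚ.*-zeroʳ ⟦ g y ℕ.≟ x ⟧ℚ))))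
    by-cases (no h≢0)  = one (cover x∈ h≢0)

  column : ∀ {y} → y ∈ ys → ∑ xs (λ x → ⟦ g y ℕ.≟ x ⟧ℚ ℚ.* h x) ≡ h (g y)
  column {y} y∈ = trans (∑-cong xs (λ x → at (g y ℕ.≟ x))) (trans (∑-⟦⟧ xs (g y ℕ.≟_) (h (g y)))
      (trans (cong (λ n → fromℕ n ℚ.* h (g y)) (#-one (g y ℕ.≟_) uxs (g∈ y∈) refl (λ _ → sym))) (ℚ.*-identityˡ _)))
    where
    at : ∀ {x} (d : Dec (g y ≡ x)) → ⟦ d ⟧ℚ ℚ.* h x ≡ ⟦ d ⟧ℚ ℚ.* h (g y)
    at (yes refl) = refl
    at {x} (no _) = trans (ℚ.*-zeroˡ (h x)) (sym (ℚ.*-zeroˡ (h (g y))))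

-- Möbius inversion

range : ℕ → List ℕ
range n = map suc (upTo n)

range-unique : ∀ n → Unique (range n)
range-unique n = Unique.map⁺ ℕ.suc-injective (Unique.upTo⁺ n)

∈-range⁺ : ∀ {t n} → 0 < t → t ≤ n → t ∈ range n
∈-range⁺ {suc t} _ t≤n = ∈-map⁺ suc (∈-upTo⁺ t≤n)

∈-range⁻ : ∀ {t n} → t ∈ range n → 0 < t × t ≤ n
∈-range⁻ t∈ with ∈-map⁻ suc t∈
... | i , i∈ , refl = z<s , ∈-upTo⁻ i∈

∑-multiples : ∀ c n → 0 < c → (h : ℕ → ℚ) → ∑ (range (c * n)) (λ t → ⟦ c ∣? t ⟧ℚ ℚ.* h t) ≡ ∑ (range n) (λ e → h (c * e))
∑-multiples c n 0<c h = trans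
  (∑-reindex (range-unique (c * n)) (range-unique n) (c *_) (λ _ _ → ℕ.*-cancelˡ-≡ _ _ c)
    (λ {e} e∈ → let 0<e , e≤n = ∈-range⁻ e∈ in ∈-range⁺ (ℕ.*-mono-< 0<c 0<e) (ℕ.*-monoʳ-≤ c e≤n))
    (λ {t} t∈ ≢0 → cover t∈ (c ∣? t) ≢0))
  (∑-cong (range n) (λ e → trans (cong (λ i → fromℕ i ℚ.* h (c * e)) (⟦⟧-yes (c ∣? c * e) (∣.m∣m*n e))) (ℚ.*-identityˡ _)))
  where
  instance _ = ℕ.>-nonZero 0<c
  cover : ∀ {t} → t ∈ range (c * n) → (d : Dec (c ∣ t)) → ⟦ d ⟧ℚ ℚ.* h t ≢ 0ℚ → ∃[ e ] e ∈ range n × c * e ≡ t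
  cover {t} t∈ (no _) ≢0 = contradiction (ℚ.*-zeroˡ (h t)) ≢0
  cover t∈ (yes (divides e refl)) _ = let 0<t , t≤ = ∈-range⁻ t∈ in
    e , ∈-range⁺ (ℕ.n≢0⇒n>0 (λ { refl → ℕ.<-irrefl refl 0<t })) (ℕ.*-cancelˡ-≤ c (subst (_≤ c * n) (ℕ.*-comm e c) t≤)) , ℕ.*-comm c e

∑-truncate : ∀ {m n} → m ≤ n → {h : ℕ → ℚ} → (∀ {t} → 0 < t → h t ≢ 0ℚ → t ≤ m) → ∑ (range n) h ≡ ∑ (range m) h
∑-truncate m≤n small = ∑-reindex (range-unique _) (range-unique _) id (λ _ _ → id)
  (λ t∈ → let 0<t , t≤m = ∈-range⁻ t∈ in ∈-range⁺ 0<t (ℕ.≤-trans t≤m m≤n))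
  (λ t∈ ≢0 → let 0<t , _ = ∈-range⁻ t∈ in _ , ∈-range⁺ 0<t (small 0<t ≢0) , refl)

⟦⟧ℚ-*-≢0 : ∀ {p} {P : Set p} (p? : Dec P) {x} → ⟦ p? ⟧ℚ ℚ.* x ≢ 0ℚ → P
⟦⟧ℚ-*-≢0 (yes p) _  = p
⟦⟧ℚ-*-≢0 (no _) {x} ≢0 = contradiction (ℚ.*-zeroˡ x) ≢0

μℚ : ℕ → ℚ
μℚ n = fromℤ (μ n)

-- μ on lists of prime factors. As it is invariant under permutation, any prime factorisation of n
-- may be used to evaluate μ n.
signed : List ℕ → ℤ
signed ps = if does (unique? ps) then -1ℤ ℤ.^ length ps else 0ℤ

μ-signed : ∀ n .{{_ : NonZero n}} → μ n ≡ signed (factors (factorise n))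
μ-signed (suc n) = refl

if-yes : ∀ {p} {P : Set p} (p? : Dec P) {x y : X} → P → (if does p? then x else y) ≡ x
if-yes (yes _) p = refl
if-yes (no ¬p) p = contradiction p ¬p

if-no : ∀ {p} {P : Set p} (p? : Dec P) {x y : X} → ¬ P → (if does p? then x else y) ≡ y
if-no (yes p) ¬p = contradiction p ¬p
if-no (no _)  ¬p = refl

signed-↭ : ∀ {ps qs} → ps ↭ qs → signed ps ≡ signed qs
signed-↭ {ps} {qs} ps↭qs = by-cases (unique? ps)
  where
  respects : ∀ {ps qs} → ps ↭ qs → Unique ps → Unique qs
  respects p = PermutationProperties.Unique-resp-↭ (setoid ℕ) (↭⇒↭ₛ p)

  by-cases : Dec (Unique ps) → signed ps ≡ signed qs
  by-cases (yes u) = trans (if-yes (unique? ps) u) (trans (cong (-1ℤ ℤ.^_) (↭.↭-length ps↭qs)) (sym (if-yes (unique? qs) (respects ps↭qs u))))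
  by-cases (no ¬u) = trans (if-no (unique? ps) ¬u) (sym (if-no (unique? qs) (¬u ∘ respects (↭-sym ps↭qs))))

signed-∷-∈ : ∀ {p ps} → p ∈ ps → signed (p ∷ ps) ≡ 0ℤ
signed-∷-∈ {p} {ps} p∈ = if-no (unique? (p ∷ ps)) (λ { (p∉ ∷ _) → All.lookup p∉ p∈ refl })

signed-∷-∉ : ∀ {p ps} → ¬ p ∈ ps → signed (p ∷ ps) ≡ ℤ.- signed ps
signed-∷-∉ {p} {ps} p∉ = by-cases (unique? ps)
  where
  by-cases : Dec (Unique ps) → signed (p ∷ ps) ≡ ℤ.- signed ps
  by-cases (yes u) = trans (if-yes (unique? (p ∷ ps)) (All.tabulate (λ { q∈ refl → p∉ q∈ }) ∷ u))
    (trans (ℤ.-1*i≡-i _) (cong ℤ.-_ (sym (if-yes (unique? ps) u))))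
  by-cases (no ¬u) = trans (if-no (unique? (p ∷ ps)) (λ { (_ ∷ u) → ¬u u })) (cong ℤ.-_ (sym (if-no (unique? ps) ¬u)))

-- The prime factors of p e are p and those of e. The added p is a repetition exactly when p divides
-- e; otherwise one more factor changes the sign.
μ-prime-* : ∀ {p} → Prime p → ∀ e → 0 < e → μℚ (p * e) ≡ ℚ.- (⟦ ¬? (p ∣? e) ⟧ℚ ℚ.* μℚ e)
μ-prime-* {p} pp e 0<e = by-cases (p ∣? e)
  where
  instance
    p≢0 : NonZero p
    p≢0 = ℕ.nonTrivial⇒nonZero p {{prime⇒nonTrivial pp}}
    e≢0 : NonZero e
    e≢0 = ℕ.>-nonZero 0<e
    pe≢0 : NonZero (p * e)
    pe≢0 = ℕ.m*n≢0 p e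

  open PrimeFactorisation (factorise e) using (isFactorisation; factorsPrime)

  μ-pe : μ (p * e) ≡ signed (p ∷ factors (factorise e))
  μ-pe = trans (μ-signed (p * e)) (signed-↭ (factorisationUnique (factorise (p * e))
    (record { factors = p ∷ factors (factorise e) ; isFactorisation = cong (p *_) isFactorisation ; factorsPrime = pp ∷ factorsPrime })))

  by-cases : (d : Dec (p ∣ e)) → μℚ (p * e) ≡ ℚ.- (⟦ ¬? d ⟧ℚ ℚ.* μℚ e)
  by-cases (yes p∣e) = trans (cong fromℤ (trans μ-pe (signed-∷-∈ {ps = factors (factorise e)} (factorisationHasAllPrimeFactors pp (subst (p ∣_) isFactorisation p∣e) factorsPrime))))
    (sym (cong ℚ.-_ (ℚ.*-zeroˡ (μℚ e))))
  by-cases (no p∤e) = trans (cong fromℤ (trans μ-pe (trans (signed-∷-∉ {ps = factors (factorise e)} (λ p∈ → p∤e (subst (p ∣_) (sym isFactorisation) (ℕ.∈⇒∣product p∈))))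
      (trans (cong ℤ.-_ (sym (μ-signed e))) (sym (ℤ.-1*i≡-i (μ e)))))))
    (trans (fromℤ-* -1ℤ (μ e)) (solve 1 (λ x → con (fromℤ -1ℤ) :* x := :- (con 1ℚ :* x)) refl (μℚ e)))
    where open ℚ.+-*-Solver

prime-divisor : ∀ n → 1 < n → ∃[ p ] Prime p × p ∣ n
prime-divisor n 1<n = from-factors _ isFactorisation factorsPrime
  where
  instance _ = ℕ.>-nonZero (ℕ.<-trans z<s 1<n)
  open PrimeFactorisation (factorise n) using (isFactorisation; factorsPrime)
  from-factors : ∀ ps → n ≡ ℕ.product ps → All Prime ps → ∃[ p ] Prime p × p ∣ n
  from-factors []       n≡ _        = contradiction (sym n≡) (ℕ.<⇒≢ 1<n)
  from-factors (p ∷ ps) n≡ (pp ∷ _) = p , pp , subst (p ∣_) (sym n≡) (∣.m∣m*n _)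

-- For a prime p ∣ n, the divisors e prime to p cancel against the divisors p e.
∑-μ-cancel : ∀ {p} → Prime p → ∀ n′ → 0 < n′ → ∑ (range (p * n′)) (λ e → ⟦ e ∣? p * n′ ⟧ℚ ℚ.* μℚ e) ≡ 0ℚ
∑-μ-cancel {p} pp n′ n′>0 = begin
    ∑ (range (p * n′)) (λ e → ⟦ e ∣? p * n′ ⟧ℚ ℚ.* μℚ e)
      ≡⟨ ∑-cong (range (p * n′)) (λ e → split (p ∣? e) _) ⟩
    ∑ (range (p * n′)) (λ e → ⟦ p ∣? e ⟧ℚ ℚ.* (⟦ e ∣? p * n′ ⟧ℚ ℚ.* μℚ e) ℚ.+ ⟦ ¬? (p ∣? e) ⟧ℚ ℚ.* (⟦ e ∣? p * n′ ⟧ℚ ℚ.* μℚ e))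
      ≡⟨ ∑-+ (range (p * n′)) _ _ ⟩
    ∑ (range (p * n′)) (λ e → ⟦ p ∣? e ⟧ℚ ℚ.* (⟦ e ∣? p * n′ ⟧ℚ ℚ.* μℚ e)) ℚ.+ ∑ (range (p * n′)) (λ e → ⟦ ¬? (p ∣? e) ⟧ℚ ℚ.* (⟦ e ∣? p * n′ ⟧ℚ ℚ.* μℚ e))
      ≡⟨ cong₂ ℚ._+_ multiples others ⟩
    -1ℚ ℚ.* S ℚ.+ S
      ≡⟨ solve 1 (λ x → con (fromℤ -1ℤ) :* x :+ x := con 0ℚ) refl S ⟩
    0ℚ ∎
  where
  open ≡-Reasoning
  open ℚ.+-*-Solver
  -1ℚ = fromℤ -1ℤ
  instance
    p≢0 : NonZero p
    p≢0 = ℕ.nonTrivial⇒nonZero p {{prime⇒nonTrivial pp}}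

  summand : ℕ → ℚ
  summand e = ⟦ ¬? (p ∣? e) ⟧ℚ ℚ.* (⟦ e ∣? n′ ⟧ℚ ℚ.* μℚ e)

  S : ℚ
  S = ∑ (range n′) summand

  split : ∀ {P : Set} (d : Dec P) x → x ≡ ⟦ d ⟧ℚ ℚ.* x ℚ.+ ⟦ ¬? d ⟧ℚ ℚ.* x
  split (yes _) = solve 1 (λ x → x := con 1ℚ :* x :+ con 0ℚ :* x) refl
  split (no _)  = solve 1 (λ x → x := con 0ℚ :* x :+ con 1ℚ :* x) refl

  multiples : ∑ (range (p * n′)) (λ e → ⟦ p ∣? e ⟧ℚ ℚ.* (⟦ e ∣? p * n′ ⟧ℚ ℚ.* μℚ e)) ≡ -1ℚ ℚ.* S
  multiples = trans (∑-multiples p n′ (ℕ.>-nonZero⁻¹ p) _) (trans (∑-cong∈ (range n′) (λ {e} e∈ → trans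
      (cong₂ (λ i x → fromℕ i ℚ.* x) (⟦⟧-cong (p * e ∣? p * n′) (e ∣? n′) (∣.*-cancelˡ-∣ p) (∣.*-monoʳ-∣ p)) (μ-prime-* pp e (proj₁ (∈-range⁻ e∈))))
      (solve 3 (λ a b c → a :* (:- (b :* c)) := con -1ℚ :* (b :* (a :* c))) refl ⟦ e ∣? n′ ⟧ℚ ⟦ ¬? (p ∣? e) ⟧ℚ (μℚ e))))
    (∑-*ˡ -1ℚ (range n′) _))

  coprime : ∀ {e} → ¬ p ∣ e → Coprime e p
  coprime p∤e (d∣e , d∣p) with prime⇒irreducible pp d∣p
  ... | inj₁ d≡1  = d≡1
  ... | inj₂ refl = contradiction d∣e p∤e

  others : ∑ (range (p * n′)) (λ e → ⟦ ¬? (p ∣? e) ⟧ℚ ℚ.* (⟦ e ∣? p * n′ ⟧ℚ ℚ.* μℚ e)) ≡ S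
  others = trans (∑-cong (range (p * n′)) (λ e → at e (p ∣? e)))
    (∑-truncate {n′} {p * n′} (ℕ.m≤n*m n′ p) {summand} (λ {e} _ ≢0 → ∣.∣⇒≤ {{ℕ.>-nonZero n′>0}}
      (⟦⟧ℚ-*-≢0 (e ∣? n′) {μℚ e} (λ ≡0 → ≢0 (trans (cong (⟦ ¬? (p ∣? e) ⟧ℚ ℚ.*_) ≡0) (ℚ.*-zeroʳ ⟦ ¬? (p ∣? e) ⟧ℚ))))))
    where
    at : ∀ e (d : Dec (p ∣ e)) → ⟦ ¬? d ⟧ℚ ℚ.* (⟦ e ∣? p * n′ ⟧ℚ ℚ.* μℚ e) ≡ ⟦ ¬? d ⟧ℚ ℚ.* (⟦ e ∣? n′ ⟧ℚ ℚ.* μℚ e)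
    at e (yes _)  = trans (ℚ.*-zeroˡ (⟦ e ∣? p * n′ ⟧ℚ ℚ.* μℚ e)) (sym (ℚ.*-zeroˡ (⟦ e ∣? n′ ⟧ℚ ℚ.* μℚ e)))
    at e (no p∤e) = cong (λ i → 1ℚ ℚ.* (fromℕ i ℚ.* μℚ e)) (⟦⟧-cong (e ∣? p * n′) (e ∣? n′) (coprime-divisor (coprime p∤e)) (∣.∣n⇒∣m*n p))

∑-μ : ∀ n → 0 < n → ∑ (range n) (λ e → ⟦ e ∣? n ⟧ℚ ℚ.* μℚ e) ≡ ⟦ n ℕ.≟ 1 ⟧ℚ
∑-μ 1             _   = refl
∑-μ n@(suc (suc _)) 0<n = from-divisor (prime-divisor n (s≤s (s≤s z≤n)))
  where
  from-divisor : ∃[ p ] Prime p × p ∣ n → ∑ (range n) (λ e → ⟦ e ∣? n ⟧ℚ ℚ.* μℚ e) ≡ 0ℚ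
  from-divisor (p , pp , divides n′ n≡) = subst (λ n → ∑ (range n) (λ e → ⟦ e ∣? n ⟧ℚ ℚ.* μℚ e) ≡ 0ℚ) (sym (trans n≡ (ℕ.*-comm n′ p)))
    (∑-μ-cancel pp n′ (ℕ.n≢0⇒n>0 (λ n′≡0 → contradiction (trans n≡ (cong (_* p) n′≡0)) λ ())))

-- With t = u e the sum runs over the divisors e of s / u, where the divisor sum of μ vanishes
-- unless s / u = 1; if u does not divide s, no term survives.
∑-μ-interval : ∀ {G u} .{{_ : NonZero u}} → 0 < G → u ∣ G → ∀ {s} → 0 < s → s ∣ G →
    ∑ (range G) (λ t → ⟦ u ∣? t ⟧ℚ ℚ.* (⟦ t ∣? s ⟧ℚ ℚ.* μℚ (t ℕ./ u))) ≡ ⟦ s ℕ.≟ u ⟧ℚ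
∑-μ-interval {u = u} 0<G (divides G′ refl) {s} 0<s s∣G = begin
  ∑ (range (G′ * u)) (λ t → ⟦ u ∣? t ⟧ℚ ℚ.* (⟦ t ∣? s ⟧ℚ ℚ.* μℚ (t ℕ./ u)))
    ≡⟨ cong (λ G → ∑ (range G) (λ t → ⟦ u ∣? t ⟧ℚ ℚ.* (⟦ t ∣? s ⟧ℚ ℚ.* μℚ (t ℕ./ u)))) (ℕ.*-comm G′ u) ⟩
  ∑ (range (u * G′)) (λ t → ⟦ u ∣? t ⟧ℚ ℚ.* (⟦ t ∣? s ⟧ℚ ℚ.* μℚ (t ℕ./ u)))
    ≡⟨ ∑-multiples u G′ (ℕ.>-nonZero⁻¹ u) _ ⟩
  ∑ (range G′) (λ e → ⟦ u * e ∣? s ⟧ℚ ℚ.* μℚ (u * e ℕ./ u))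
    ≡⟨ ∑-cong (range G′) (λ e → cong (λ x → ⟦ u * e ∣? s ⟧ℚ ℚ.* μℚ x) (trans (cong (ℕ._/ u) (ℕ.*-comm u e)) (ℕ.m*n/n≡m e u))) ⟩
  ∑ (range G′) (λ e → ⟦ u * e ∣? s ⟧ℚ ℚ.* μℚ e)
    ≡⟨ evaluate (u ∣? s) ⟩
  ⟦ s ℕ.≟ u ⟧ℚ ∎
  where
  open ≡-Reasoning
  evaluate : Dec (u ∣ s) → ∑ (range G′) (λ e → ⟦ u * e ∣? s ⟧ℚ ℚ.* μℚ e) ≡ ⟦ s ℕ.≟ u ⟧ℚ
  evaluate (no u∤s) = trans (∑-0 (range G′) (λ {e} _ → trans (cong (λ i → fromℕ i ℚ.* μℚ e) (⟦⟧-no (u * e ∣? s) (λ d → u∤s (∣.m*n∣⇒m∣ u e d)))) (ℚ.*-zeroˡ (μℚ e))))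
    (cong fromℕ (sym (⟦⟧-no (s ℕ.≟ u) (λ { refl → u∤s ∣.∣-refl }))))
  evaluate (yes (divides s′ refl)) = begin
    ∑ (range G′) (λ e → ⟦ u * e ∣? s′ * u ⟧ℚ ℚ.* μℚ e) ≡⟨ ∑-cong (range G′) (λ e → cong (λ i → fromℕ i ℚ.* μℚ e) (⟦⟧-cong (u * e ∣? s′ * u) (e ∣? s′)
                                                               (λ d → ∣.*-cancelˡ-∣ u (subst (u * e ∣_) (ℕ.*-comm s′ u) d)) (λ d → subst (u * e ∣_) (ℕ.*-comm u s′) (∣.*-monoʳ-∣ u d)))) ⟩
    ∑ (range G′) (λ e → ⟦ e ∣? s′ ⟧ℚ ℚ.* μℚ e) ≡⟨ ∑-truncate s′≤G′ (λ {e} _ ≢0 → ∣.∣⇒≤ {{ℕ.>-nonZero 0<s′}} (⟦⟧ℚ-*-≢0 (e ∣? s′) {μℚ e} ≢0)) ⟩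
    ∑ (range s′) (λ e → ⟦ e ∣? s′ ⟧ℚ ℚ.* μℚ e) ≡⟨ ∑-μ s′ 0<s′ ⟩
    ⟦ s′ ℕ.≟ 1 ⟧ℚ ≡⟨ cong fromℕ (⟦⟧-cong (s′ ℕ.≟ 1) (s′ * u ℕ.≟ u) (λ { refl → ℕ.*-identityˡ u })
                                                               (λ e → ℕ.*-cancelʳ-≡ s′ 1 u (trans e (sym (ℕ.*-identityˡ u))))) ⟩
    ⟦ s′ * u ℕ.≟ u ⟧ℚ                                    ∎
    where
    0<s′ : 0 < s′
    0<s′ = ℕ.n≢0⇒n>0 (λ { refl → ℕ.<-irrefl refl 0<s })

    s′≤G′ : s′ ≤ G′
    s′≤G′ = ℕ.*-cancelʳ-≤ s′ G′ u (∣.∣⇒≤ {{ℕ.>-nonZero 0<G}} s∣G)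

module _ {G u : ℕ} .{{_ : NonZero u}} (0<G : 0 < G) (u∣G : u ∣ G) where

  -- After the sums are exchanged, f s is multiplied by the sum of μ(t/u) over all t with u | t | s,
  -- which is 1 for s = u and 0 otherwise. In the application f s is the number of tuples of given
  -- rank with stabilizer of order q^s, and the inner sum is the number of those closed under
  -- GF(q^t).
  möbius-inversion : (f : ℕ → ℚ) →
    ∑ (range G) (λ t → ⟦ t ∣? G ⟧ℚ ℚ.* (⟦ u ∣? t ⟧ℚ ℚ.* (μℚ (t ℕ./ u) ℚ.* ∑ (range G) (λ s → ⟦ (s ∣? G) ×-dec (t ∣? s) ⟧ℚ ℚ.* f s)))) ≡ f u
  möbius-inversion f = begin
    ∑ (range G) (λ t → ⟦ t ∣? G ⟧ℚ ℚ.* (⟦ u ∣? t ⟧ℚ ℚ.* (μℚ (t ℕ./ u) ℚ.* ∑ (range G) (λ s → ⟦ (s ∣? G) ×-dec (t ∣? s) ⟧ℚ ℚ.* f s))))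
      ≡⟨ ∑-cong (range G) (λ t → trans (solve 4 (λ a b c d → a :* (b :* (c :* d)) := (a :* b :* c) :* d) refl ⟦ t ∣? G ⟧ℚ ⟦ u ∣? t ⟧ℚ (μℚ (t ℕ./ u)) _)
                                        (sym (∑-*ˡ (⟦ t ∣? G ⟧ℚ ℚ.* ⟦ u ∣? t ⟧ℚ ℚ.* μℚ (t ℕ./ u)) (range G) _))) ⟩
    ∑ (range G) (λ t → ∑ (range G) (λ s → ⟦ t ∣? G ⟧ℚ ℚ.* ⟦ u ∣? t ⟧ℚ ℚ.* μℚ (t ℕ./ u) ℚ.* (⟦ (s ∣? G) ×-dec (t ∣? s) ⟧ℚ ℚ.* f s)))
      ≡⟨ ∑-swap (range G) (range G) _ ⟩
    ∑ (range G) (λ s → ∑ (range G) (λ t → ⟦ t ∣? G ⟧ℚ ℚ.* ⟦ u ∣? t ⟧ℚ ℚ.* μℚ (t ℕ./ u) ℚ.* (⟦ (s ∣? G) ×-dec (t ∣? s) ⟧ℚ ℚ.* f s)))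
      ≡⟨ ∑-cong∈ (range G) (λ {s} s∈ → inner (proj₁ (∈-range⁻ s∈)) (s ∣? G)) ⟩
    ∑ (range G) (λ s → ⟦ s ℕ.≟ u ⟧ℚ ℚ.* f s)
      ≡⟨ ∑-cong (range G) (λ s → at (s ℕ.≟ u)) ⟩
    ∑ (range G) (λ s → ⟦ s ℕ.≟ u ⟧ℚ ℚ.* f u)
      ≡⟨ ∑-⟦⟧ (range G) (ℕ._≟ u) (f u) ⟩
    fromℕ (# (ℕ._≟ u) ∈ range G) ℚ.* f u
      ≡⟨ cong (λ n → fromℕ n ℚ.* f u) (#-one (ℕ._≟ u) (range-unique G) (∈-range⁺ (ℕ.>-nonZero⁻¹ u) (∣.∣⇒≤ {{ℕ.>-nonZero 0<G}} u∣G)) refl (λ _ e → e)) ⟩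
    1ℚ ℚ.* f u
      ≡⟨ ℚ.*-identityˡ (f u) ⟩
    f u ∎
    where
    open ≡-Reasoning
    open ℚ.+-*-Solver

    at : ∀ {s} (d : Dec (s ≡ u)) → ⟦ d ⟧ℚ ℚ.* f s ≡ ⟦ d ⟧ℚ ℚ.* f u
    at (yes refl) = refl
    at {s} (no _) = trans (ℚ.*-zeroˡ (f s)) (sym (ℚ.*-zeroˡ (f u)))

    inner : ∀ {s} → 0 < s → (d : Dec (s ∣ G)) →
      ∑ (range G) (λ t → ⟦ t ∣? G ⟧ℚ ℚ.* ⟦ u ∣? t ⟧ℚ ℚ.* μℚ (t ℕ./ u) ℚ.* (⟦ d ×-dec (t ∣? s) ⟧ℚ ℚ.* f s)) ≡ ⟦ s ℕ.≟ u ⟧ℚ ℚ.* f s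
    inner {s} 0<s (no s∤G) = trans
      (∑-0 (range G) (λ {t} _ → trans (cong (⟦ t ∣? G ⟧ℚ ℚ.* ⟦ u ∣? t ⟧ℚ ℚ.* μℚ (t ℕ./ u) ℚ.*_) (ℚ.*-zeroˡ (f s))) (ℚ.*-zeroʳ (⟦ t ∣? G ⟧ℚ ℚ.* ⟦ u ∣? t ⟧ℚ ℚ.* μℚ (t ℕ./ u)))))
      (sym (trans (cong (λ i → fromℕ i ℚ.* f s) (⟦⟧-no (s ℕ.≟ u) (λ { refl → s∤G u∣G }))) (ℚ.*-zeroˡ (f s))))
    inner {s} 0<s (yes s∣G) = trans
      (∑-cong (range G) (λ t → merge t (t ∣? s) (t ∣? G)))
      (trans (∑-*ˡ (f s) (range G) _) (trans (cong (f s ℚ.*_) (∑-μ-interval 0<G u∣G 0<s s∣G)) (ℚ.*-comm (f s) ⟦ s ℕ.≟ u ⟧ℚ)))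
      where
      merge : ∀ t (e : Dec (t ∣ s)) (g : Dec (t ∣ G)) →
        ⟦ g ⟧ℚ ℚ.* ⟦ u ∣? t ⟧ℚ ℚ.* μℚ (t ℕ./ u) ℚ.* (⟦ yes s∣G ×-dec e ⟧ℚ ℚ.* f s) ≡ f s ℚ.* (⟦ u ∣? t ⟧ℚ ℚ.* (⟦ e ⟧ℚ ℚ.* μℚ (t ℕ./ u)))
      merge t (yes t∣s) (no t∤G) = contradiction (∣.∣-trans t∣s s∣G) t∤G
      merge t (yes _) (yes _) = solve 3 (λ a b c → con 1ℚ :* a :* b :* (con 1ℚ :* c) := c :* (a :* (con 1ℚ :* b))) refl ⟦ u ∣? t ⟧ℚ (μℚ (t ℕ./ u)) (f s)
      merge t (no _) g = solve 4 (λ g a b c → g :* a :* b :* (con 0ℚ :* c) := c :* (a :* (con 0ℚ :* b))) refl ⟦ g ⟧ℚ ⟦ u ∣? t ⟧ℚ (μℚ (t ℕ./ u)) (f s)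

-- Product formulas

∏-map : (g : Y → X) (ys : List Y) (f : X → ℚ) → ∏ (map g ys) f ≡ ∏ ys (f ∘ g)
∏-map g []       f = refl
∏-map g (y ∷ ys) f = cong (f (g y) ℚ.*_) (∏-map g ys f)

∏-++ : (xs ys : List X) (f : X → ℚ) → ∏ (xs ++ ys) f ≡ ∏ xs f ℚ.* ∏ ys f
∏-++ []       ys f = sym (ℚ.*-identityˡ _)
∏-++ (x ∷ xs) ys f = trans (cong (f x ℚ.*_) (∏-++ xs ys f)) (sym (ℚ.*-assoc (f x) _ _))

∏-cong∈ : (xs : List X) {f g : X → ℚ} → (∀ {x} → x ∈ xs → f x ≡ g x) → ∏ xs f ≡ ∏ xs g
∏-cong∈ []       e = refl
∏-cong∈ (x ∷ xs) e = cong₂ ℚ._*_ (e (here refl)) (∏-cong∈ xs (e ∘ there))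

∏-* : (xs : List X) (f g : X → ℚ) → ∏ xs (λ x → f x ℚ.* g x) ≡ ∏ xs f ℚ.* ∏ xs g
∏-* []       f g = refl
∏-* (x ∷ xs) f g = trans (cong (f x ℚ.* g x ℚ.*_) (∏-* xs f g))
  (solve 4 (λ a b c d → (a :* b) :* (c :* d) := (a :* c) :* (b :* d)) refl (f x) (g x) (∏ xs f) (∏ xs g))
  where open ℚ.+-*-Solver using (solve; con; _:=_; _:+_; _:*_; _:-_)

∏-*ˡ : (c : ℕ) (xs : List X) (f : X → ℚ) → ∏ xs (λ x → fromℕ c ℚ.* f x) ≡ fromℕ (c ^ length xs) ℚ.* ∏ xs f
∏-*ˡ c []       f = refl
∏-*ˡ c (x ∷ xs) f = trans (cong (fromℕ c ℚ.* f x ℚ.*_) (∏-*ˡ c xs f)) (trans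
  (solve 4 (λ a b c d → (a :* b) :* (c :* d) := (a :* c) :* (b :* d)) refl (fromℕ c) (f x) (fromℕ (c ^ length xs)) (∏ xs f))
  (cong (ℚ._* (f x ℚ.* ∏ xs f)) (sym (fromℕ-* c (c ^ length xs)))))
  where open ℚ.+-*-Solver using (solve; con; _:=_; _:+_; _:*_; _:-_)

∏-≢0 : (xs : List X) {f : X → ℚ} → (∀ {x} → x ∈ xs → f x ≢ 0ℚ) → ∏ xs f ≢ 0ℚ
∏-≢0 []       h = λ ()
∏-≢0 (x ∷ xs) h = ℚ-*-≢0 (h (here refl)) (∏-≢0 xs (h ∘ there))

∏< : ℕ → (ℕ → ℚ) → ℚ
∏< n f = ∏ (upTo n) f

∏<-suc : ∀ n f → ∏< (suc n) f ≡ ∏< n f ℚ.* f n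
∏<-suc n f = trans (cong (λ xs → ∏ xs f) (sym (List.upTo-∷ʳ n))) (trans (∏-++ (upTo n) (n ∷ []) f) (cong (∏< n f ℚ.*_) (ℚ.*-identityʳ (f n))))

∏<-suc′ : ∀ n f → ∏< (suc n) f ≡ f 0 ℚ.* ∏< n (f ∘ suc)
∏<-suc′ n f = cong (f 0 ℚ.*_) (trans (cong (λ xs → ∏ xs f) (sym (List.map-upTo suc n))) (∏-map suc (upTo n) f))

∏<-cong : ∀ n {f g} → (∀ {i} → i < n → f i ≡ g i) → ∏< n f ≡ ∏< n g
∏<-cong n e = ∏-cong∈ (upTo n) (e ∘ ∈-upTo⁻)

∏<-≢0 : ∀ n {f} → (∀ {i} → i < n → f i ≢ 0ℚ) → ∏< n f ≢ 0ℚ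
∏<-≢0 n h = ∏-≢0 (upTo n) (h ∘ ∈-upTo⁻)

∏<-+ : ∀ m n f → ∏< (m + n) f ≡ ∏< m f ℚ.* ∏< n (λ i → f (m + i))
∏<-+ m zero    f = trans (cong (λ k → ∏< k f) (ℕ.+-identityʳ m)) (sym (ℚ.*-identityʳ (∏< m f)))
∏<-+ m (suc n) f = begin
  ∏< (m + suc n) f ≡⟨ cong (λ k → ∏< k f) (ℕ.+-suc m n) ⟩
  ∏< (suc (m + n)) f ≡⟨ ∏<-suc (m + n) f ⟩
  ∏< (m + n) f ℚ.* f (m + n) ≡⟨ cong (ℚ._* f (m + n)) (∏<-+ m n f) ⟩
  ∏< m f ℚ.* ∏< n (λ i → f (m + i)) ℚ.* f (m + n) ≡⟨ ℚ.*-assoc (∏< m f) _ (f (m + n)) ⟩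
  ∏< m f ℚ.* (∏< n (λ i → f (m + i)) ℚ.* f (m + n)) ≡⟨ cong (∏< m f ℚ.*_) (∏<-suc n (λ i → f (m + i))) ⟨
  ∏< m f ℚ.* ∏< (suc n) (λ i → f (m + i))                     ∎
  where open ≡-Reasoning

∏-⋯< : ∀ a b f → ∏ (a ⋯< b) f ≡ ∏< (b ∸ a) (λ i → f (a + i))
∏-⋯< a b f = ∏-map (_+_ a) (upTo (b ∸ a)) f

module Powers (c : ℕ) (1<c : 1 < c) where
  instance
    c≢0 : NonZero c
    c≢0 = ℕ.>-nonZero (ℕ.<-trans z<s 1<c)

  pow : ℕ → ℚ
  pow n = fromℕ (c ^ n)

  pow-+ : ∀ m n → pow (m + n) ≡ pow m ℚ.* pow n
  pow-+ m n = trans (cong fromℕ (ℕ.^-distribˡ-+-* c m n)) (fromℕ-* (c ^ m) (c ^ n))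

  pow-suc : ∀ n → pow (suc n) ≡ fromℕ c ℚ.* pow n
  pow-suc n = fromℕ-* c (c ^ n)

  pow-∸ : ∀ {i n} → i ≤ n → fromℕ (c ^ n ∸ c ^ i) ≡ pow n ℚ.- pow i
  pow-∸ i≤n = fromℕ-∸ (ℕ.^-monoʳ-≤ c i≤n)

  pow-diff-≢0 : ∀ {i n} → i < n → pow n ℚ.- pow i ≢ 0ℚ
  pow-diff-≢0 {i} {n} i<n e = ℕ.<⇒≢ (ℕ.^-monoʳ-< c 1<c i<n) (sym (fromℕ-injective (begin
    pow n ≡⟨ solve 2 (λ x y → x := x :- y :+ y) refl (pow n) (pow i) ⟩
    pow n ℚ.- pow i ℚ.+ pow i ≡⟨ cong (ℚ._+ pow i) e ⟩
    0ℚ ℚ.+ pow i ≡⟨ ℚ.+-identityˡ (pow i) ⟩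
    pow i                       ∎)))
    where
    open ≡-Reasoning
    open ℚ.+-*-Solver using (solve; con; _:=_; _:+_; _:*_; _:-_)

  pow-factor : ∀ {i n} → i ≤ n → pow n ℚ.- pow i ≡ pow i ℚ.* (pow (n ∸ i) ℚ.- 1ℚ)
  pow-factor {i} {n} i≤n = trans (cong (λ x → x ℚ.- pow i) (trans (cong pow (sym (ℕ.m+[n∸m]≡n i≤n))) (pow-+ i (n ∸ i))))
    (solve 2 (λ x y → x :* y :- x := x :* (y :- con 1ℚ)) refl (pow i) (pow (n ∸ i)))
    where open ℚ.+-*-Solver using (solve; con; _:=_; _:+_; _:*_; _:-_)

  -- The largest exponent subtracted is j - 1 + s, hence the bound `suc N`: truncated subtraction is
  -- exact up to exponent N, where the factor is 0. For k = m + 1 this boundary case occurs.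
  fromℕ-extensions : ∀ N s j → j + s ≤ suc N → fromℕ (extensions c N s j) ≡ ∏< j (λ i → pow N ℚ.- pow (i + s))
  fromℕ-extensions N s zero    _  = refl
  fromℕ-extensions N s (suc j) le = trans (fromℕ-* (extensions c N s j) (c ^ N ∸ c ^ (j + s)))
    (trans (cong₂ ℚ._*_ (fromℕ-extensions N s j (ℕ.<⇒≤ le)) (pow-∸ {j + s} {N} (ℕ.s≤s⁻¹ le))) (sym (∏<-suc j (λ i → pow N ℚ.- pow (i + s)))))

  -- Multiplying numerator and denominator of the i-th factor by c^i turns it into (c^a - c^i) /
  -- (c^b - c^i).
  gaussian-extensions : ∀ a b → b ≤ a → gaussian c a b ℚ.* fromℕ (extensions c b 0 b) ≡ fromℕ (extensions c a 0 b)
  gaussian-extensions a b b≤a = begin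
    gaussian c a b ℚ.* fromℕ (extensions c b 0 b)
      ≡⟨ cong₂ ℚ._*_ (∏-⋯< 0 b _) (fromℕ-extensions b 0 b (ℕ.m≤n⇒m≤1+n (ℕ.≤-reflexive (ℕ.+-identityʳ b)))) ⟩
    ∏< b quotient ℚ.* ∏< b (λ i → pow b ℚ.- pow (i + 0))
      ≡⟨ ∏-* (upTo b) quotient _ ⟨
    ∏< b (λ i → quotient i ℚ.* (pow b ℚ.- pow (i + 0)))
      ≡⟨ ∏<-cong b (λ {i} i<b → trans (cong (λ j → quotient i ℚ.* (pow b ℚ.- pow j)) (ℕ.+-identityʳ i))
           (trans (step i<b) (cong (λ j → pow a ℚ.- pow j) (sym (ℕ.+-identityʳ i))))) ⟩
    ∏< b (λ i → pow a ℚ.- pow (i + 0))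
      ≡⟨ fromℕ-extensions a 0 b (ℕ.m≤n⇒m≤1+n (subst (_≤ a) (sym (ℕ.+-identityʳ b)) b≤a)) ⟨
    fromℕ (extensions c a 0 b) ∎
    where
    open ≡-Reasoning
    open ℚ.+-*-Solver using (solve; con; _:=_; _:+_; _:*_; _:-_)
    quotient : ℕ → ℚ
    quotient i = (pow (a ∸ i) ℚ.- 1ℚ) ÷₀ (pow (b ∸ i) ℚ.- 1ℚ)

    step : ∀ {i} → i < b → quotient i ℚ.* (pow b ℚ.- pow i) ≡ pow a ℚ.- pow i
    step {i} i<b = begin
      quotient i ℚ.* (pow b ℚ.- pow i) ≡⟨ cong (quotient i ℚ.*_) (pow-factor (ℕ.<⇒≤ i<b)) ⟩
      quotient i ℚ.* (pow i ℚ.* (pow (b ∸ i) ℚ.- 1ℚ)) ≡⟨ solve 3 (λ x y z → x :* (y :* z) := y :* (x :* z)) refl (quotient i) (pow i) (pow (b ∸ i) ℚ.- 1ℚ) ⟩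
      pow i ℚ.* (quotient i ℚ.* (pow (b ∸ i) ℚ.- 1ℚ)) ≡⟨ cong (pow i ℚ.*_) (÷₀-* _ (pow-diff-≢0 {0} (ℕ.m<n⇒0<n∸m i<b))) ⟩
      pow i ℚ.* (pow (a ∸ i) ℚ.- 1ℚ) ≡⟨ pow-factor (ℕ.≤-trans (ℕ.<⇒≤ i<b) b≤a) ⟨
      pow a ℚ.- pow i                                         ∎

  extensions-≢0 : ∀ N s j → j + s ≤ N → fromℕ (extensions c N s j) ≢ 0ℚ
  extensions-≢0 N s j le e = ∏<-≢0 j (λ i<j → pow-diff-≢0 (ℕ.<-≤-trans (ℕ.+-monoˡ-< s i<j) le)) (trans (sym (fromℕ-extensions N s j (ℕ.m≤n⇒m≤1+n le))) e)

  -- Modulo the span of the s given vectors the tuple has to span a space of dimension d: its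
  -- coordinates form a d by k matrix of rank d, chosen row by row, and each of the k entries has
  -- c^s lifts. For k < d the factor i = k vanishes.
  fromℕ-spanningTuples : ∀ d k s → fromℕ (spanningTuples c (s + d) k s) ≡ pow (s * k) ℚ.* ∏< d (λ i → pow k ℚ.- pow i)
  fromℕ-spanningTuples zero zero s = trans (cong fromℕ (⟦⟧-yes (s ℕ.≟ s + 0) (sym (ℕ.+-identityʳ s)))) (cong (λ n → pow n ℚ.* 1ℚ) (sym (ℕ.*-zeroʳ s)))
  fromℕ-spanningTuples (suc d) zero s = trans (cong fromℕ (⟦⟧-no (s ℕ.≟ s + suc d) (ℕ.m≢1+m+n s ∘ flip trans (ℕ.+-suc s d))))
    (sym (trans (cong (pow (s * 0) ℚ.*_) (trans (∏<-suc′ d (λ i → pow 0 ℚ.- pow i)) (ℚ.*-zeroˡ (∏< d (λ i → pow 0 ℚ.- pow (suc i)))))) (ℚ.*-zeroʳ (pow (s * 0)))))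
  fromℕ-spanningTuples zero (suc k) s = begin
    fromℕ (c ^ s * spanningTuples c (s + 0) k s + (c ^ (s + 0) ∸ c ^ s) * _) ≡⟨ cong (λ x → fromℕ (c ^ s * spanningTuples c (s + 0) k s + x * spanningTuples c (s + 0) k (suc s))) (trans (cong (λ n → c ^ n ∸ c ^ s) (ℕ.+-identityʳ s)) (ℕ.n∸n≡0 (c ^ s))) ⟩
    fromℕ (c ^ s * spanningTuples c (s + 0) k s + 0) ≡⟨ cong fromℕ (ℕ.+-identityʳ (c ^ s * spanningTuples c (s + 0) k s)) ⟩
    fromℕ (c ^ s * spanningTuples c (s + 0) k s) ≡⟨ fromℕ-* (c ^ s) (spanningTuples c (s + 0) k s) ⟩
    pow s ℚ.* fromℕ (spanningTuples c (s + 0) k s) ≡⟨ cong (pow s ℚ.*_) (fromℕ-spanningTuples 0 k s) ⟩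
    pow s ℚ.* (pow (s * k) ℚ.* 1ℚ) ≡⟨ ℚ.*-assoc (pow s) (pow (s * k)) 1ℚ ⟨
    pow s ℚ.* pow (s * k) ℚ.* 1ℚ ≡⟨ cong (ℚ._* 1ℚ) (trans (sym (pow-+ s (s * k))) (cong pow (sym (ℕ.*-suc s k)))) ⟩
    pow (s * suc k) ℚ.* 1ℚ                                                     ∎
    where open ≡-Reasoning
  fromℕ-spanningTuples (suc d) (suc k) s = begin
    fromℕ (c ^ s * spanningTuples c N k s + (c ^ N ∸ c ^ s) * spanningTuples c N k (suc s))
      ≡⟨ trans (fromℕ-+ (c ^ s * spanningTuples c N k s) _) (cong₂ ℚ._+_ (fromℕ-* (c ^ s) _) (fromℕ-* (c ^ N ∸ c ^ s) _)) ⟩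
    pow s ℚ.* fromℕ (spanningTuples c N k s) ℚ.+ fromℕ (c ^ N ∸ c ^ s) ℚ.* fromℕ (spanningTuples c N k (suc s))
      ≡⟨ cong₂ (λ x y → pow s ℚ.* x ℚ.+ fromℕ (c ^ N ∸ c ^ s) ℚ.* y) (fromℕ-spanningTuples (suc d) k s)
           (trans (cong (λ N → fromℕ (spanningTuples c N k (suc s))) (ℕ.+-suc s d)) (fromℕ-spanningTuples d k (suc s))) ⟩
    pow s ℚ.* (pow (s * k) ℚ.* ∏< (suc d) (λ i → pow k ℚ.- pow i)) ℚ.+ fromℕ (c ^ N ∸ c ^ s) ℚ.* (pow (suc s * k) ℚ.* P)
      ≡⟨ cong₂ (λ x y → pow s ℚ.* (pow (s * k) ℚ.* x) ℚ.+ y) (∏<-suc d (λ i → pow k ℚ.- pow i))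
           (cong₂ (λ x y → x ℚ.* (y ℚ.* P)) (trans (pow-∸ {s} {N} (ℕ.m≤m+n s (suc d)))
             (cong (ℚ._- pow s) (trans (pow-+ s (suc d)) (cong (pow s ℚ.*_) (pow-suc d))))) (pow-+ k (s * k))) ⟩
    pow s ℚ.* (pow (s * k) ℚ.* (P ℚ.* (pow k ℚ.- pow d))) ℚ.+ (pow s ℚ.* (fromℕ c ℚ.* pow d) ℚ.- pow s) ℚ.* (pow k ℚ.* pow (s * k) ℚ.* P)
      ≡⟨ solve 6 (λ x y z D C P → x :* (y :* (P :* (z :- D))) :+ (x :* (C :* D) :- x) :* (z :* y :* P) := (x :* y) :* ((C :* z :- con 1ℚ) :* (D :* P))) refl
           (pow s) (pow (s * k)) (pow k) (pow d) (fromℕ c) P ⟩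
    pow s ℚ.* pow (s * k) ℚ.* ((fromℕ c ℚ.* pow k ℚ.- 1ℚ) ℚ.* (pow d ℚ.* P))
      ≡⟨ cong₂ ℚ._*_ (trans (sym (pow-+ s (s * k))) (cong pow (sym (ℕ.*-suc s k)))) (sym product) ⟩
    pow (s * suc k) ℚ.* ∏< (suc d) (λ i → pow (suc k) ℚ.- pow i) ∎
    where
    open ≡-Reasoning
    open ℚ.+-*-Solver using (solve; con; _:=_; _:+_; _:*_; _:-_)
    N = s + suc d
    P = ∏< d (λ i → pow k ℚ.- pow i)

    product : ∏< (suc d) (λ i → pow (suc k) ℚ.- pow i) ≡ (fromℕ c ℚ.* pow k ℚ.- 1ℚ) ℚ.* (pow d ℚ.* P)
    product = trans (∏<-suc′ d (λ i → pow (suc k) ℚ.- pow i)) (cong₂ ℚ._*_ (cong (ℚ._- 1ℚ) (pow-suc k)) (trans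
      (∏-cong∈ (upTo d) (λ {i} _ → trans (cong₂ ℚ._-_ (pow-suc k) (pow-suc i)) (solve 3 (λ C z y → C :* z :- C :* y := C :* (z :- y)) refl (fromℕ c) (pow k) (pow i))))
      (trans (∏-*ˡ c (upTo d) (λ i → pow k ℚ.- pow i)) (cong (λ n → pow n ℚ.* P) (List.length-upTo d)))))

∑-divisors-range : ∀ n (h : (u : ℕ) → .{{_ : NonZero u}} → ℚ) (h′ : ℕ → ℚ) → (∀ i → suc i ∣ n → h (suc i) ≡ h′ (suc i)) →
                   ∑-divisors n h ≡ ∑ (range n) (λ t → ⟦ t ∣? n ⟧ℚ ℚ.* h′ t)
∑-divisors-range n h h′ e = trans (∑-cong (upTo n) (λ i → at i (suc i ∣? n))) (sym (∑-map suc (upTo n) _))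
  where
  at : ∀ i (d : Dec (suc i ∣ n)) → (if does d then h (suc i) else 0ℚ) ≡ ⟦ d ⟧ℚ ℚ.* h′ (suc i)
  at i (yes d) = trans (e i d) (sym (ℚ.*-identityˡ (h′ (suc i))))
  at i (no _)  = sym (ℚ.*-zeroˡ (h′ (suc i)))

-- The orbit numbers

module OrbitCount {q l : ℕ} {F : FiniteField q} {L : FiniteField (q ^ l)} (φ : F ↪ L) (k : ℕ) where
  open Extension {q} {l} φ using (1<q; q≢0)
  open Orbits {q} {l} φ k
  open Powers q 1<q using (pow; pow-diff-≢0; pow-∸; fromℕ-spanningTuples)

  spanning≡ : ∀ d → fromℕ (spanningTuples q d k 0) ≡ ∏< d (λ i → pow k ℚ.- pow i)
  spanning≡ d = trans (fromℕ-spanningTuples d k 0) (ℚ.*-identityˡ _)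

  spanning≢0 : ∀ {d} → d ≤ k → fromℕ (spanningTuples q d k 0) ≢ 0ℚ
  spanning≢0 {d} d≤k e = ∏<-≢0 d (λ i<d → pow-diff-≢0 (ℕ.<-≤-trans i<d d≤k)) (trans (sym (spanning≡ d)) e)

  -- Both sides are multiplied by (q^l - 1) S, where S is the number of k-tuples spanning a given
  -- d-subspace. On the left, orbits become q^u - 1 times the tuples of type (d, u). On the right, S
  -- times a Gaussian coefficient is the number of tuples closed under GF(q^t), and the sum is the
  -- Möbius inversion of these numbers.
  orbitNumber-classReps : ∀ {d} → 0 < l → d ≤ k → d ≤ l → ∀ u .{{_ : NonZero u}} → u ∣ gcd d l →
                          fromℕ (length (classReps d u)) ≡ orbitNumber q l d u
  orbitNumber-classReps {d} 0<l d≤k d≤l u u∣G = ℚ-*-cancelʳ (ℚ-*-≢0 q^l-1≢0 S≢0) (begin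
    R ℚ.* (fromℕ (q ^ l ∸ 1) ℚ.* S)
      ≡⟨ cong (R ℚ.*_) (fromℕ-* (q ^ l ∸ 1) (spanningTuples q d k 0)) ⟨
    R ℚ.* fromℕ ((q ^ l ∸ 1) * spanningTuples q d k 0)
      ≡⟨ fromℕ-* (length (classReps d u)) _ ⟨
    fromℕ (length (classReps d u) * ((q ^ l ∸ 1) * spanningTuples q d k 0))
      ≡⟨ cong fromℕ (#classReps d u) ⟩
    fromℕ (#hasType d u * (q ^ u ∸ 1))
      ≡⟨ fromℕ-* (#hasType d u) (q ^ u ∸ 1) ⟩
    fromℕ (#hasType d u) ℚ.* fromℕ (q ^ u ∸ 1)
      ≡⟨ cong₂ ℚ._*_ (trans (sym (möbius-inversion 0<G u∣G (λ s → fromℕ (#hasType d s)))) (sym sum≡)) (pow-∸ {0} {u} z≤n) ⟩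
    S ℚ.* D ℚ.* (pow u ℚ.- 1ℚ)
      ≡⟨ cong (S ℚ.* D ℚ.*_) (÷₀-* (pow u ℚ.- 1ℚ) {pow l ℚ.- 1ℚ} (pow-diff-≢0 {0} 0<l)) ⟨
    S ℚ.* D ℚ.* (((pow u ℚ.- 1ℚ) ÷₀ (pow l ℚ.- 1ℚ)) ℚ.* (pow l ℚ.- 1ℚ))
      ≡⟨ solve 4 (λ S D a b → S :* D :* (a :* b) := a :* D :* (b :* S)) refl S D ((pow u ℚ.- 1ℚ) ÷₀ (pow l ℚ.- 1ℚ)) (pow l ℚ.- 1ℚ) ⟩
    orbitNumber q l d u ℚ.* ((pow l ℚ.- 1ℚ) ℚ.* S)
      ≡⟨ cong (λ x → orbitNumber q l d u ℚ.* (x ℚ.* S)) (pow-∸ {0} {l} z≤n) ⟨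
    orbitNumber q l d u ℚ.* (fromℕ (q ^ l ∸ 1) ℚ.* S) ∎)
    where
    open ≡-Reasoning
    open ℚ.+-*-Solver using (solve; con; _:=_; _:+_; _:*_; _:-_)
    G = gcd d l
    R = fromℕ (length (classReps d u))
    S = fromℕ (spanningTuples q d k 0)
    S≢0 = spanning≢0 d≤k

    q^l-1≢0 : fromℕ (q ^ l ∸ 1) ≢ 0ℚ
    q^l-1≢0 e = pow-diff-≢0 {0} 0<l (trans (sym (pow-∸ {0} {l} z≤n)) e)

    0<G : 0 < G
    0<G = ℕ.n≢0⇒n>0 (λ G≡0 → ℕ.<⇒≢ 0<l (sym (gcd[m,n]≡0⇒n≡0 d G≡0)))

    summand : (t : ℕ) → .{{_ : NonZero t}} → ℚ
    summand t = if does (u ∣? t) then fromℤ (μ (t ℕ./ u)) ℚ.* gaussian (q ^ t) (l ℕ./ t) (d ℕ./ t) else 0ℚ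

    D : ℚ
    D = ∑-divisors G summand

    total : ℕ → ℚ
    total t = ∑ (range G) (λ s → ⟦ (s ∣? G) ×-dec (t ∣? s) ⟧ℚ ℚ.* fromℕ (#hasType d s))

    closed≡total : ∀ t → 0 < t → t ∣ G → fromℕ (#closed d t) ≡ total t
    closed≡total t 0<t t∣G = begin
      fromℕ (#closed d t) ≡⟨ cong fromℕ (#closed-∑ d t 0<t t∣G) ⟩
      fromℕ (sumOver (upTo G) (λ i → ⟦ (suc i ∣? G) ×-dec (t ∣? suc i) ⟧ * #hasType d (suc i))) ≡⟨ fromℕ-sumOver (upTo G) _ ⟩
      ∑ (upTo G) (λ i → fromℕ (⟦ (suc i ∣? G) ×-dec (t ∣? suc i) ⟧ * #hasType d (suc i))) ≡⟨ ∑-cong (upTo G) (λ i → fromℕ-* ⟦ (suc i ∣? G) ×-dec (t ∣? suc i) ⟧ (#hasType d (suc i))) ⟩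
      ∑ (upTo G) (λ i → ⟦ (suc i ∣? G) ×-dec (t ∣? suc i) ⟧ℚ ℚ.* fromℕ (#hasType d (suc i))) ≡⟨ ∑-map suc (upTo G) _ ⟨
      total t                                                                                         ∎

    -- Closed tuples are counted by the subspaces over the field of order q ^ t.
    closed-gaussian : ∀ t .{{_ : NonZero t}} → t ∣ G → S ℚ.* gaussian (q ^ t) (l ℕ./ t) (d ℕ./ t) ≡ fromℕ (#closed d t)
    closed-gaussian t t∣G = ℚ-*-cancelʳ (T.extensions-≢0 n 0 n (ℕ.≤-reflexive (ℕ.+-identityʳ n))) (begin
      S ℚ.* gaussian (q ^ t) n′ n ℚ.* fromℕ (extensions (q ^ t) n 0 n) ≡⟨ ℚ.*-assoc S _ _ ⟩
      S ℚ.* (gaussian (q ^ t) n′ n ℚ.* fromℕ (extensions (q ^ t) n 0 n)) ≡⟨ cong (S ℚ.*_) (T.gaussian-extensions n′ n (ℕ./-monoˡ-≤ t d≤l)) ⟩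
      S ℚ.* fromℕ (extensions (q ^ t) n′ 0 n) ≡⟨ ℚ.*-comm S _ ⟩
      fromℕ (extensions (q ^ t) n′ 0 n) ℚ.* S ≡⟨ fromℕ-* (extensions (q ^ t) n′ 0 n) (spanningTuples q d k 0) ⟨
      fromℕ (extensions (q ^ t) n′ 0 n * spanningTuples q d k 0) ≡⟨ cong fromℕ (subst (λ d → #closed d t * extensions (q ^ t) n 0 n ≡ extensions (q ^ t) n′ 0 n * spanningTuples q d k 0)
                                                                                (ℕ.m/n*n≡m (∣.∣-trans t∣G (gcd[m,n]∣m d l))) (#closed-extensions t n n′ (ℕ.>-nonZero⁻¹ t) (sym (ℕ.m/n*n≡m (∣.∣-trans t∣G (gcd[m,n]∣n d l)))))) ⟨
      fromℕ (#closed d t * extensions (q ^ t) n 0 n) ≡⟨ fromℕ-* (#closed d t) _ ⟩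
      fromℕ (#closed d t) ℚ.* fromℕ (extensions (q ^ t) n 0 n)             ∎)
      where
      n  = d ℕ./ t
      n′ = l ℕ./ t
      module T = Powers (q ^ t) (ℕ.^-monoʳ-< q 1<q (ℕ.>-nonZero⁻¹ t))

    sum≡ : S ℚ.* D ≡ ∑ (range G) (λ t → ⟦ t ∣? G ⟧ℚ ℚ.* (⟦ u ∣? t ⟧ℚ ℚ.* (μℚ (t ℕ./ u) ℚ.* total t)))
    sum≡ = trans (sym (pull-in (upTo G))) (trans (∑-cong (upTo G) (λ i → at i (suc i ∣? G))) (sym (∑-map suc (upTo G) _)))
      where
      pull-in : ∀ is → ∑ is (λ i → S ℚ.* (if does (suc i ∣? G) then summand (suc i) else 0ℚ)) ≡ S ℚ.* ∑ is (λ i → if does (suc i ∣? G) then summand (suc i) else 0ℚ)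
      pull-in is = ∑-*ˡ S is _

      at : ∀ i (g : Dec (suc i ∣ G)) → S ℚ.* (if does g then summand (suc i) else 0ℚ) ≡ ⟦ g ⟧ℚ ℚ.* (⟦ u ∣? suc i ⟧ℚ ℚ.* (μℚ (suc i ℕ./ u) ℚ.* total (suc i)))
      at i (no _)  = trans (ℚ.*-zeroʳ S) (sym (ℚ.*-zeroˡ (⟦ u ∣? suc i ⟧ℚ ℚ.* (μℚ (suc i ℕ./ u) ℚ.* total (suc i)))))
      at i (yes t∣G) = begin
        S ℚ.* summand (suc i) ≡⟨ cong (S ℚ.*_) (if-⟦⟧ (u ∣? suc i) (μℚ (suc i ℕ./ u) ℚ.* gaussian (q ^ suc i) (l ℕ./ suc i) (d ℕ./ suc i))) ⟩
        S ℚ.* (U ℚ.* (M ℚ.* gaussian (q ^ suc i) (l ℕ./ suc i) (d ℕ./ suc i))) ≡⟨ solve 4 (λ S U M g → S :* (U :* (M :* g)) := con 1ℚ :* (U :* (M :* (S :* g)))) refl S U M (gaussian (q ^ suc i) (l ℕ./ suc i) (d ℕ./ suc i)) ⟩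
        1ℚ ℚ.* (U ℚ.* (M ℚ.* (S ℚ.* gaussian (q ^ suc i) (l ℕ./ suc i) (d ℕ./ suc i)))) ≡⟨ cong (λ x → 1ℚ ℚ.* (U ℚ.* (M ℚ.* x))) (trans (closed-gaussian (suc i) t∣G) (closed≡total (suc i) z<s t∣G)) ⟩
        1ℚ ℚ.* (U ℚ.* (M ℚ.* total (suc i)))                                   ∎
        where
        U = ⟦ u ∣? suc i ⟧ℚ
        M = μℚ (suc i ℕ./ u)

-- Tuples with a one-dimensional space of linear relations

module LinearRelations {Q : ℕ} (L : FiniteField Q) where
  open FiniteField L
  open FieldTheory L hiding (_⊖_)

  module _ (M N : FinModule L) where
    private
      module M = Linear M
      module N = Linear N

    record IsLinear (f : M.Carrierᴹ → N.Carrierᴹ) : Set where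
      field
        map-+ : ∀ x y → f (x M.+ᴹ y) ≡ f x N.+ᴹ f y
        map-* : ∀ a x → f (a M.*ₗ x) ≡ a N.*ₗ f x

      map-0 : f M.0ᴹ ≡ N.0ᴹ
      map-0 = trans (cong f (sym (M.*ₗ-zeroˡ M.0ᴹ))) (trans (map-* 𝟘 M.0ᴹ) (N.*ₗ-zeroˡ _))

      lc-map : ∀ {n} (c : Vec Carrier n) xs → N.lc c (Vec.map f xs) ≡ f (M.lc c xs)
      lc-map []      []       = sym map-0
      lc-map (c ∷ cs) (x ∷ xs) = trans (cong₂ N._+ᴹ_ (sym (map-* c x)) (lc-map cs xs)) (sym (map-+ _ _))

  open IsLinear using (lc-map)

  module Row k = Linear (spaceModule L k)

  identity : ∀ k → Vec (Vec Carrier k) k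
  identity zero    = []
  identity (suc k) = (𝟙 ∷ Vec.replicate k 𝟘) ∷ Vec.map (𝟘 ∷_) (identity k)

  private
    pad-isLinear : ∀ k → IsLinear (spaceModule L k) (spaceModule L (suc k)) (𝟘 ∷_)
    pad-isLinear k = record { map-+ = λ x y → cong (_∷ _) (sym (+-identityˡ 𝟘)) ; map-* = λ a x → cong (_∷ _) (sym (zeroʳ a)) }

  lc-identity : ∀ {k} (b : Vec Carrier k) → Row.lc k b (identity k) ≡ b
  lc-identity []      = refl
  lc-identity {suc k} (b ∷ bs) = trans (cong (Vec.zipWith _⊕_ (Vec.map (b ⊗_) (𝟙 ∷ Vec.replicate k 𝟘))) (trans (lc-map (pad-isLinear k) bs (identity k)) (cong (𝟘 ∷_) (lc-identity bs))))
    (cong₂ _∷_ (trans (+-identityʳ _) (*-identityʳ b)) (trans (cong (λ z → Vec.zipWith _⊕_ z bs) (Row.*ₗ-zeroʳ k b)) (Row.+ᴹ-identityˡ k bs)))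

  private
    map≡0 : ∀ {n e} {a : Vec Carrier n} → e ≡ 𝟘 → Vec.map (e ⊗_) a ≡ Vec.replicate n 𝟘
    map≡0 {n} {a = a} refl = Row.*ₗ-zeroˡ n a

  module Relations (M : FinModule L) where
    open Linear M
    open Over (wholeField L)

    coef : ∀ {n} (c : Vec Carrier n) → Coef c
    coef = VAll.universal (λ _ → tt)

    -- For a = 0 this expresses the independence of x; the chosen relation vectors are nonzero by
    -- their rank.
    Rel : ∀ {n} → Vec Carrier n → Vec Carrierᴹ n → Set
    Rel a x = lc a x ≡ 0ᴹ × (∀ c → lc c x ≡ 0ᴹ → ∃[ e ] c ≡ Vec.map (e ⊗_) a)

    rel? : ∀ {n} (a : Vec Carrier n) (x : Vec Carrierᴹ n) → Dec (Rel a x)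
    rel? {n} a x = (lc a x V.≟ 0ᴹ) ×-dec Finite.∀? (finiteVec finite n) (λ c → (lc c x V.≟ 0ᴹ) →-dec ∃? (λ e → Finite._≟_ (finiteVec finite n) c (Vec.map (e ⊗_) a)))

    -1∷-relation : ∀ {n} (c : Vec Carrier n) xs → lc ((⊖ 𝟙) ∷ c) (lc c xs ∷ xs) ≡ 0ᴹ
    -1∷-relation c xs = -1*ₗ-inverseˡ (lc c xs)

    relation⇒span : ∀ {n c} cs {x} {xs : Vec Carrierᴹ n} → c ≢ 𝟘 → lc (c ∷ cs) (x ∷ xs) ≡ 0ᴹ → Span xs x
    relation⇒span cs {x} {xs} c≢0 e = span-solve tt tt c≢0 (cs , coef cs , refl) (IsSubspace.has-0 (span-isSubspace xs))
      (trans e (sym (trans (+ᴹ-identityʳ _) (*ₗ-zeroˡ x))))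

    -- With an independent tail a relation is determined by its first coefficient c₁, so it is the
    -- multiple of the given one by c₁ a₁⁻¹.
    rel-≢0⁺ : ∀ {n a₁ a x} {xs : Vec Carrierᴹ n} → a₁ ≢ 𝟘 → Ind xs → lc (a₁ ∷ a) (x ∷ xs) ≡ 0ᴹ → Rel (a₁ ∷ a) (x ∷ xs)
    rel-≢0⁺ {n} {a₁} {a} {x} {xs} a₁≢0 ind e with inverse a₁ a₁≢0
    ... | d , da = e , λ { (c₁ ∷ c) e′ → c₁ ⊗ d , proportional c₁ c e′ }
      where
      proportional : ∀ c₁ c → lc (c₁ ∷ c) (x ∷ xs) ≡ 0ᴹ → c₁ ∷ c ≡ Vec.map ((c₁ ⊗ d) ⊗_) (a₁ ∷ a)
      proportional c₁ c e′ = cong₂ _∷_ head≡ (coef-unique ind (coef c) (coef _) (+ᴹ-cancelʳ (c₁ *ₗ x) (begin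
        lc c xs +ᴹ c₁ *ₗ x ≡⟨ +ᴹ-comm _ _ ⟩
        c₁ *ₗ x +ᴹ lc c xs ≡⟨ e′ ⟩
        0ᴹ ≡⟨ *ₗ-zeroʳ (c₁ ⊗ d) ⟨
        (c₁ ⊗ d) *ₗ 0ᴹ ≡⟨ cong ((c₁ ⊗ d) *ₗ_) e ⟨
        (c₁ ⊗ d) *ₗ (a₁ *ₗ x +ᴹ lc a xs) ≡⟨ *ₗ-distribˡ _ _ _ ⟩
        (c₁ ⊗ d) *ₗ a₁ *ₗ x +ᴹ (c₁ ⊗ d) *ₗ lc a xs ≡⟨ cong₂ _+ᴹ_ (trans (sym (*ₗ-assoc _ a₁ x)) (cong (_*ₗ x) (sym head≡))) (sym (lc-* _ a xs)) ⟩
        c₁ *ₗ x +ᴹ lc (Vec.map ((c₁ ⊗ d) ⊗_) a) xs ≡⟨ +ᴹ-comm _ _ ⟩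
        lc (Vec.map ((c₁ ⊗ d) ⊗_) a) xs +ᴹ c₁ *ₗ x                      ∎)))
        where
        open ≡-Reasoning
        head≡ : c₁ ≡ (c₁ ⊗ d) ⊗ a₁
        head≡ = sym (trans (*-assoc c₁ d a₁) (trans (cong (c₁ ⊗_) da) (*-identityʳ c₁)))

    rel-≢0⁻ : ∀ {n a₁ a x} {xs : Vec Carrierᴹ n} → a₁ ≢ 𝟘 → Rel (a₁ ∷ a) (x ∷ xs) → Ind xs
    rel-≢0⁻ {n} {a₁} {a} {x} {xs} a₁≢0 (_ , h) = coef-zero⇒ind xs λ {c} _ e →
      let f , eq = h (𝟘 ∷ c) (trans (lc-0∷ c x xs) e)
          f≡0 = ⊗≡0 a₁≢0 (trans (*-comm a₁ f) (sym (Vec.∷-injectiveˡ eq)))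
      in trans (Vec.∷-injectiveʳ eq) (map≡0 f≡0)

    rel-0⁺ : ∀ {n a x} {xs : Vec Carrierᴹ n} → Rel a xs → ¬ Span xs x → Rel (𝟘 ∷ a) (x ∷ xs)
    rel-0⁺ {a = a} {x} {xs} (e , h) x∉ = trans (lc-0∷ a x xs) e , λ { (c₁ ∷ c) e′ → extend c₁ c (c₁ ≟ 𝟘) e′ }
      where
      extend : ∀ c₁ c → Dec (c₁ ≡ 𝟘) → lc (c₁ ∷ c) (x ∷ xs) ≡ 0ᴹ → ∃[ f ] c₁ ∷ c ≡ Vec.map (f ⊗_) (𝟘 ∷ a)
      extend c₁ c (no c₁≢0)  e′ = contradiction (relation⇒span c c₁≢0 e′) x∉
      extend c₁ c (yes refl) e′ = let f , eq = h c (trans (sym (lc-0∷ c x xs)) e′) in f , cong₂ _∷_ (sym (zeroʳ f)) eq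

    rel-0⁻ : ∀ {n a x} {xs : Vec Carrierᴹ n} → Rel (𝟘 ∷ a) (x ∷ xs) → Rel a xs × ¬ Span xs x
    rel-0⁻ {a = a} {x} {xs} (e , h) =
      (trans (sym (lc-0∷ a x xs)) e , λ c e′ → let f , eq = h (𝟘 ∷ c) (trans (lc-0∷ c x xs) e′) in f , Vec.∷-injectiveʳ eq) ,
      λ { (c , _ , refl) → let f , eq = h ((⊖ 𝟙) ∷ c) (-1∷-relation c xs) in
          𝟙≢𝟘 (trans (sym (-‿involutive 𝟙)) (trans (cong ⊖_ (trans (Vec.∷-injectiveˡ eq) (zeroʳ f))) -0#≈0#)) }

    -- A vector occurring in the relation is redundant, and the others are independent.
    rel-basis : ∀ {n} {a : Vec Carrier (suc n)} {x} → Rel a x → a ≢ Vec.replicate (suc n) 𝟘 →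
                Σ[ b ∈ Vec Carrierᴹ n ] Ind b × (∀ y → (Span x y → Span b y) × (Span b y → Span x y))
    rel-basis {n} {a₁ ∷ a} {x ∷ xs} r a≢0 with a₁ ≟ 𝟘
    ... | no a₁≢0 = xs , rel-≢0⁻ a₁≢0 r , λ y → span-mono (relation⇒span a a₁≢0 (proj₁ r) ∷ span-members xs) , span-there
    rel-basis {zero}  {_ ∷ []} r a≢0 | yes refl = contradiction refl a≢0
    rel-basis {suc n} {_ ∷ a} {x ∷ xs} r a≢0 | yes refl with rel-0⁻ r
    ... | r′ , x∉ with rel-basis r′ (λ { refl → a≢0 refl })
    ... | b , ind , h = x ∷ b , ((λ s → x∉ (proj₂ (h x) s)) , ind) , λ y →
          span-mono (span-here ∷ VAll.map (λ {z} s → span-there (proj₁ (h z) s)) (span-members xs)) ,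
          span-mono (span-here ∷ VAll.map (λ {z} s → span-there (proj₂ (h z) s)) (span-members b))

    module _ {m : ℕ} (dim : V.size ≡ Q ^ m) {s : ℕ} (t : Vec Carrierᴹ s) (t-ind : Ind t) where
      private
        all-sub : IsSubspace (λ _ → ⊤)
        all-sub = record { has-0 = tt ; has-+ = λ _ _ → tt ; has-* = λ _ _ → tt }

        all-dim : V.count {P = λ _ → ⊤} (λ _ → yes tt) ≡ Subfield.card (wholeField L) ^ m
        all-dim = trans (#-all _ V.elems (λ _ → tt)) (trans dim (cong (_^ m) (sym (whole-card L))))

      #-ind-extensions : ∀ j → # (λ xs → ind? (xs Vec.++ t)) ∈ tuples finiteᴹ j ≡ extensions Q m s j
      #-ind-extensions j = trans (#-cong (λ xs → ind? (xs Vec.++ t)) (extends? (λ _ → yes tt) all-sub {m} all-dim t) (tuples finiteᴹ j)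
          (λ xs i → i , VAll.universal (λ _ → tt) xs) (λ _ → proj₁))
        (trans (#-extensions (λ _ → yes tt) all-sub {m} all-dim t-ind (VAll.universal (λ _ → tt) t) j) (cong (λ c → extensions c m s j) (whole-card L)))

      #-outside : ∀ {n i} {a : Vec Carrier (suc n)} {x} → n ≡ i → Rel a x → a ≢ Vec.replicate (suc n) 𝟘 → V.count (λ y → ¬? (span? x y)) ≡ Q ^ m ∸ Q ^ i
      #-outside {n} {a = a} {x} refl r a≢0 with rel-basis r a≢0
      ... | b , ind , h = trans (#-cong (λ y → ¬? (span? x y)) (λ y → yes tt ×-dec ¬? (span? b y)) V.elems (λ y ∉ → tt , ∉ ∘ proj₂ (h y)) (λ y (_ , ∉) → ∉ ∘ proj₁ (h y)))
        (trans (#-∸ {P = λ _ → ⊤} (λ _ → yes tt) (span? b) (λ _ _ → tt)) (cong₂ _∸_ (trans all-dim (cong (_^ m) (whole-card L))) (trans (card-span ind) (cong (_^ n) (whole-card L)))))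

      -- The number does not depend on a. While the leading coefficient is 0, the first vector must
      -- avoid the span of the others, whose dimension is one less than their number; at the first
      -- nonzero coefficient the vector is forced, and the vectors after it must be independent. So
      -- one vector out of i + 1 is determined.
      #-rel-extensions : ∀ i (a : Vec Carrier (suc i)) (α : Vec Carrier s) → a ≢ Vec.replicate (suc i) 𝟘 →
                         # (λ xs → rel? (a Vec.++ α) (xs Vec.++ t)) ∈ tuples finiteᴹ (suc i) ≡ extensions Q m s i
      #-rel-extensions i (a₁ ∷ a) α a≢0 = trans (sumOver-tuples finiteᴹ i _) (by-cases i a a≢0 (a₁ ≟ 𝟘))
        where
        by-cases : ∀ i (a : Vec Carrier i) → a₁ ∷ a ≢ Vec.replicate (suc i) 𝟘 → Dec (a₁ ≡ 𝟘) →
          sumOver (tuples finiteᴹ i) (λ xs → V.count (λ x → rel? (a₁ ∷ a Vec.++ α) (x ∷ xs Vec.++ t))) ≡ extensions Q m s i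
        by-cases i a a≢0 (no a₁≢0) = trans (sumOver-cong (tuples finiteᴹ i) (λ xs → determined xs (inverse a₁ a₁≢0))) (#-ind-extensions i)
          where
          determined : ∀ xs → ∃[ d ] d ⊗ a₁ ≡ 𝟙 → V.count (λ x → rel? (a₁ ∷ a Vec.++ α) (x ∷ xs Vec.++ t)) ≡ ⟦ ind? (xs Vec.++ t) ⟧
          determined xs (d , da) = ⟦⟧-unique (ind? (xs Vec.++ t))
            (λ ind → V.count-one (λ x → rel? (a₁ ∷ a Vec.++ α) (x ∷ xs Vec.++ t)) {x₀} (rel-≢0⁺ a₁≢0 ind relation₀)
              (λ y (e , _) → trans (sym (unscale y da)) (trans (cong (d *ₗ_) (+ᴹ-cancelʳ rest (trans e (sym relation₀)))) (unscale x₀ da))))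
            (λ ¬ind → #-none _ V.elems (λ _ r → ¬ind (rel-≢0⁻ a₁≢0 r)))
            where
            rest x₀ : Carrierᴹ
            rest = lc (a Vec.++ α) (xs Vec.++ t)
            x₀ = d *ₗ (⊖ 𝟙) *ₗ rest

            relation₀ : a₁ *ₗ x₀ +ᴹ rest ≡ 0ᴹ
            relation₀ = trans (cong (_+ᴹ rest) (trans (*ₗ-exchange a₁ d _) (unscale _ da))) (-1*ₗ-inverseˡ rest)
        by-cases zero    []  a≢0 (yes refl) = contradiction refl a≢0
        by-cases (suc i) a   a≢0 (yes refl) = trans (sumOver-cong (tuples finiteᴹ (suc i)) step)
          (trans (sumOver-*ʳ (tuples finiteᴹ (suc i)) _ (Q ^ m ∸ Q ^ (i + s))) (cong (_* (Q ^ m ∸ Q ^ (i + s))) (#-rel-extensions i a α (λ { refl → a≢0 refl }))))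
          where
          ++≢0 : ∀ {n} (a : Vec Carrier n) → a ≢ Vec.replicate n 𝟘 → a Vec.++ α ≢ Vec.replicate (n + s) 𝟘
          ++≢0 []      a≢0 e = a≢0 refl
          ++≢0 (a ∷ as) a≢0 e = ++≢0 as (λ as≡0 → a≢0 (cong₂ _∷_ (Vec.∷-injectiveˡ e) as≡0)) (Vec.∷-injectiveʳ e)

          step : ∀ xs → V.count (λ x → rel? (𝟘 ∷ a Vec.++ α) (x ∷ xs Vec.++ t)) ≡ ⟦ rel? (a Vec.++ α) (xs Vec.++ t) ⟧ * (Q ^ m ∸ Q ^ (i + s))
          step xs = trans (sumOver-cong V.elems (λ x → trans
              (⟦⟧-cong (rel? (𝟘 ∷ a Vec.++ α) (x ∷ xs Vec.++ t)) (rel? (a Vec.++ α) (xs Vec.++ t) ×-dec ¬? (span? (xs Vec.++ t) x)) rel-0⁻ (λ (r , x∉) → rel-0⁺ r x∉))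
              (⟦⟧-× (rel? (a Vec.++ α) (xs Vec.++ t)) (¬? (span? (xs Vec.++ t) x)))))
            (trans (sumOver-*ˡ V.elems _ ⟦ rel? (a Vec.++ α) (xs Vec.++ t) ⟧)
            (⟦⟧-*-cong (rel? (a Vec.++ α) (xs Vec.++ t)) (λ r → #-outside refl r (++≢0 a (λ { refl → a≢0 refl })))))

-- The tuples spanning blocks

-- All that the construction uses of the chosen relation vectors: `scale` absorbs the scalar left
-- open by a relation, `respects` a change of basis of the block over GF(q), and `rank≥3` says that
-- no two scalars span all entries over GF(q).
record Selection {q l : ℕ} {F : FiniteField q} {L : FiniteField (q ^ l)} (φ : F ↪ L) (k : ℕ) : Set₁ where
  open FiniteField L
  open Extension.BaseProperties.line {q} {l} φ using (Span)
  field
    Mem      : Pred (Vec Carrier k) 0ℓ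
    mem?     : Decidable Mem
    scale    : ∀ {e a} → e ≢ 𝟘 → Mem a → Mem (Vec.map (e ⊗_) a)
    respects : ∀ {a b} → VAll (Span a) b → VAll (Span b) a → Mem a → Mem b
    rank≥3   : ∀ {a} → Mem a → ∀ u v → ¬ VAll (Span (u ∷ v ∷ [])) a

module GoodTuples {q l : ℕ} {F : FiniteField q} {L : FiniteField (q ^ l)} (φ : F ↪ L) (M : FinModule L)
                  {k : ℕ} (S : Selection {q} {l} φ k) {W : Set} (W? : Dec W) where
  open FiniteField L
  open FieldTheory L hiding (_⊖_)
  open Extension {q} {l} φ
  open Linear M
  open LinearRelations L
  open Relations M using (Rel; rel?; coef; #-ind-extensions; #-rel-extensions)
  open BaseProperties using (module line)
  private
    module S = Selection S
    module FO = Over baseField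
    module LO = Over (wholeField L)
    module RO = Linear.Over (spaceModule L k) baseField

  Good : Vec Carrierᴹ k → Set
  Good x = (W × LO.Ind x) ⊎ (∃[ a ] S.Mem a × Rel a x)

  related? : ∀ x → Dec (∃[ a ] S.Mem a × Rel a x)
  related? x = Finite.∃? (finiteVec finite k) (λ a → S.mem? a ×-dec rel? a x)

  good? : Decidable Good
  good? x = (W? ×-dec LO.ind? x) ⊎-dec related? x

  L-ind⇒F-ind : ∀ {n} (x : Vec Carrierᴹ n) → LO.Ind x → FO.Ind x
  L-ind⇒F-ind []      _            = tt
  L-ind⇒F-ind (x ∷ xs) (x∉ , ind) = (λ (c , _ , e) → x∉ (c , coef c , e)) , L-ind⇒F-ind xs ind

  unscaleVec : ∀ {n g f} (a : Vec Carrier n) → g ⊗ f ≡ 𝟙 → Vec.map (g ⊗_) (Vec.map (f ⊗_) a) ≡ a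
  unscaleVec []      e = refl
  unscaleVec {g = g} {f} (a ∷ as) e = cong₂ _∷_ (trans (sym (*-assoc g f a)) (trans (cong (_⊗ a) e) (*-identityˡ a))) (unscaleVec as e)

  zero-scaled : ∀ {n f} (a : Vec Carrier n) → f ≡ 𝟘 → Vec.map (f ⊗_) a ≡ Vec.replicate n 𝟘
  zero-scaled {n} a refl = Row.*ₗ-zeroˡ n a

  rank≥3⇒≢0 : ∀ {a} → S.Mem a → a ≢ Vec.replicate k 𝟘
  rank≥3⇒≢0 s refl = S.rank≥3 s 𝟘 𝟘 (zeros k)
    where
    zeros : ∀ n → VAll (line.Span (𝟘 ∷ 𝟘 ∷ [])) (Vec.replicate n 𝟘)
    zeros zero    = []
    zeros (suc n) = line.IsSubspace.has-0 (line.span-isSubspace _) ∷ zeros n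

  -- A dependence with coefficients in GF(q) is f a for some f. If f is nonzero, the entries of a
  -- lie in f⁻¹ GF(q), which has dimension 1, against `rank≥3`.
  good⇒F-ind : ∀ {x} → Good x → FO.Ind x
  good⇒F-ind {x} (inj₁ (_ , ind))          = L-ind⇒F-ind x ind
  good⇒F-ind {x} (inj₂ (a , s , _ , only)) = FO.coef-zero⇒ind x λ {c} m e → let f , eq = only c e in zero-coef m eq (f ≟ 𝟘)
    where
    spanned : ∀ {n g} (c : Vec Carrier n) → FO.Coef c → VAll (line.Span (g ∷ 𝟘 ∷ [])) (Vec.map (g ⊗_) c)
    spanned []      []       = []
    spanned {g = g} (c ∷ cs) (m ∷ ms) = subst (line.Span (g ∷ 𝟘 ∷ [])) (*-comm c g) (line.IsSubspace.has-* (line.span-isSubspace _) m line.span-here) ∷ spanned cs ms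

    zero-coef : ∀ {c f} → FO.Coef c → c ≡ Vec.map (f ⊗_) a → Dec (f ≡ 𝟘) → c ≡ Vec.replicate k 𝟘
    zero-coef m eq   (yes f≡0) = trans eq (zero-scaled a f≡0)
    zero-coef m refl (no f≢0)  = let g , gf = inverse _ f≢0 in
      contradiction (subst (VAll (line.Span (g ∷ 𝟘 ∷ []))) (unscaleVec a gf) (spanned _ m)) (S.rank≥3 s g 𝟘)

  -- A relation supported on two entries would bound the rank of a by 2.
  suffix-L-ind : ∀ {j} (k≡ : j + 2 ≡ k) (xs : Vec Carrierᴹ j) (t : Vec Carrierᴹ 2) → Good (subst (Vec Carrierᴹ) k≡ (xs Vec.++ t)) → LO.Ind t
  suffix-L-ind refl xs t (inj₁ (_ , ind)) = drop xs ind
    where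
    drop : ∀ {j} (xs : Vec Carrierᴹ j) → LO.Ind (xs Vec.++ t) → LO.Ind t
    drop []       ind       = ind
    drop (x ∷ xs) (_ , ind) = drop xs ind
  suffix-L-ind {j} refl xs t (inj₂ (a , s , _ , only)) = LO.coef-zero⇒ind t λ {c} _ e →
    let f , eq = only (Vec.replicate j 𝟘 Vec.++ c) (trans (lc-++ (Vec.replicate j 𝟘) c xs t) (trans (cong₂ _+ᴹ_ (lc-0 xs) e) (+ᴹ-identityˡ 0ᴹ)))
    in zero-coef c eq (f ≟ 𝟘)
    where
    last-zero : ∀ j {n} {c : Vec Carrier n} → Vec.replicate j 𝟘 Vec.++ c ≡ Vec.replicate (j + n) 𝟘 → c ≡ Vec.replicate n 𝟘
    last-zero zero    e = e
    last-zero (suc j) e = last-zero j (Vec.∷-injectiveʳ e)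

    spanned : ∀ j g u v → VAll (line.Span (g ⊗ u ∷ g ⊗ v ∷ [])) (Vec.map (g ⊗_) (Vec.replicate j 𝟘 Vec.++ u ∷ v ∷ []))
    spanned zero    g u v = line.span-here ∷ line.span-there line.span-here ∷ []
    spanned (suc j) g u v = subst (line.Span (g ⊗ u ∷ g ⊗ v ∷ [])) (sym (zeroʳ g)) (line.IsSubspace.has-0 (line.span-isSubspace _)) ∷ spanned j g u v

    zero-coef : ∀ c {f} → Vec.replicate j 𝟘 Vec.++ c ≡ Vec.map (f ⊗_) a → Dec (f ≡ 𝟘) → c ≡ Vec.replicate 2 𝟘
    zero-coef c           eq (yes f≡0) = last-zero j (trans eq (zero-scaled a f≡0))
    zero-coef (u ∷ v ∷ []) eq (no f≢0) = let g , gf = inverse _ f≢0 in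
      contradiction (subst (VAll (line.Span (g ⊗ u ∷ g ⊗ v ∷ []))) (trans (cong (Vec.map (g ⊗_)) eq) (unscaleVec a gf)) (spanned j g u v)) (S.rank≥3 s _ _)

  -- An injective linear map changes none of the relations; the invariance of the blocks under GL(m,
  -- q^l) rests on this.
  good-map : ∀ {f} → IsLinear M M f → (∀ {x y} → f x ≡ f y → x ≡ y) → ∀ {x} → Good x → Good (Vec.map f x)
  good-map {f} linear injective {x} = λ
    { (inj₁ (w , ind))          → inj₁ (w , LO.coef-zero⇒ind (Vec.map f x) (λ {c} m e → LO.coef-zero ind m (lc≡0 c e)))
    ; (inj₂ (a , s , e , only)) → inj₂ (a , s , trans (lc-map a x) (trans (cong f e) map-0) , λ c e′ → only c (lc≡0 c e′)) }
    where
    open IsLinear linear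
    lc≡0 : ∀ c → lc c (Vec.map f x) ≡ 0ᴹ → lc c x ≡ 0ᴹ
    lc≡0 c e = injective (trans (sym (lc-map c x)) (trans e (sym map-0)))

  rows : ∀ {n} {x : Vec Carrierᴹ n} {y : Vec Carrierᴹ k} → VAll (FO.Span y) x → ∃[ N ] VAll FO.Coef N × Vec.map (λ r → lc r y) N ≡ x
  rows []                  = [] , [] , refl
  rows ((r , m , refl) ∷ s) = let N , ms , e = rows s in r ∷ N , m ∷ ms , cong (_ ∷_) e

  combine-isLinear : (y : Vec Carrierᴹ k) → IsLinear (spaceModule L k) M (λ r → lc r y)
  combine-isLinear y = record { map-+ = λ c d → lc-+ c d y ; map-* = λ a c → lc-* a c y }

  lc-rows : ∀ {n} (a : Vec Carrier n) N y → lc a (Vec.map (λ r → lc r y) N) ≡ lc (Row.lc k a N) y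
  lc-rows a N y = IsLinear.lc-map (combine-isLinear y) a N

  rows-unique : ∀ {n} {y : Vec Carrierᴹ k} {N N′ : Vec (Vec Carrier k) n} → FO.Ind y → VAll FO.Coef N → VAll FO.Coef N′ →
                Vec.map (λ r → lc r y) N ≡ Vec.map (λ r → lc r y) N′ → N ≡ N′
  rows-unique {N = []}    {[]}    ind []       []         e = refl
  rows-unique {N = _ ∷ _} {_ ∷ _} ind (m ∷ ms) (m′ ∷ ms′) e = cong₂ _∷_ (FO.coef-unique ind m m′ (Vec.∷-injectiveˡ e)) (rows-unique ind ms ms′ (Vec.∷-injectiveʳ e))

  identity-coef : ∀ n → VAll FO.Coef (identity n)
  identity-coef zero    = []
  identity-coef (suc n) = (Base.𝟙-closed ∷ FO.coef-0 n) ∷ pad (identity-coef n)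
    where
    pad : ∀ {i} {N : Vec (Vec Carrier n) i} → VAll FO.Coef N → VAll FO.Coef (Vec.map (𝟘 ∷_) N)
    pad []       = []
    pad (m ∷ ms) = (Base.𝟘-closed ∷ m) ∷ pad ms

  identity-rows : ∀ {n} (y : Vec Carrierᴹ n) → Vec.map (λ r → lc r y) (identity n) ≡ y
  identity-rows []      = refl
  identity-rows (y ∷ ys) = cong₂ _∷_ (trans (cong₂ _+ᴹ_ (*ₗ-identityˡ y) (lc-0 ys)) (+ᴹ-identityʳ y))
    (trans (sym (Vec.map-∘ _ _ (identity _))) (trans (Vec.map-cong (λ r → lc-0∷ r y ys) (identity _)) (identity-rows ys)))

  -- The transition matrices N and N′ have entries in GF(q). Coordinates over GF(q) in the
  -- independent y are unique, so N N′ is the identity matrix, and it then acts as the identity on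
  -- coefficients from all of GF(q^l).
  rows-inverse : ∀ {x y N N′} → FO.Ind y → VAll FO.Coef N → VAll FO.Coef N′ →
                 Vec.map (λ r → lc r x) N ≡ y → Vec.map (λ r → lc r y) N′ ≡ x → ∀ c → Row.lc k (Row.lc k c N) N′ ≡ c
  rows-inverse {x} {y} {N} {N′} ind ms ms′ Nx≡y N′y≡x c = begin
    Row.lc k (Row.lc k c N) N′ ≡⟨ IsLinear.lc-map {M = spaceModule L k} {N = spaceModule L k} (record { map-+ = λ c d → Row.lc-+ k c d N′ ; map-* = λ a c → Row.lc-* k a c N′ }) c N ⟨
    Row.lc k c (Vec.map (λ r → Row.lc k r N′) N) ≡⟨ cong (Row.lc k c) (rows-unique ind (closed ms) (identity-coef k) product≡) ⟩
    Row.lc k c (identity k) ≡⟨ lc-identity c ⟩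
    c                                                ∎
    where
    open ≡-Reasoning
    coef-isSubspace : RO.IsSubspace FO.Coef
    coef-isSubspace = record { has-0 = FO.coef-0 k ; has-+ = FO.coef-+ ; has-* = FO.coef-* }

    closed : ∀ {n} {N : Vec (Vec Carrier k) n} → VAll FO.Coef N → VAll FO.Coef (Vec.map (λ r → Row.lc k r N′) N)
    closed []       = []
    closed (m ∷ ms) = RO.lc-closed coef-isSubspace m ms′ ∷ closed ms

    product≡ : Vec.map (λ r → lc r y) (Vec.map (λ r → Row.lc k r N′) N) ≡ Vec.map (λ r → lc r y) (identity k)
    product≡ = begin
      Vec.map (λ r → lc r y) (Vec.map (λ r → Row.lc k r N′) N) ≡⟨ Vec.map-∘ _ _ N ⟨
      Vec.map (λ r → lc (Row.lc k r N′) y) N ≡⟨ Vec.map-cong (λ r → trans (sym (lc-rows r N′ y)) (cong (lc r) N′y≡x)) N ⟩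
      Vec.map (λ r → lc r x) N ≡⟨ Nx≡y ⟩
      y ≡⟨ identity-rows y ⟨
      Vec.map (λ r → lc r y) (identity k)                        ∎

  row-entries : ∀ {n} (a : Vec Carrier n) {N} → VAll FO.Coef N → VAll (line.Span a) (Row.lc k a N)
  row-entries a {N} ms = go a ms
    where
    zeros : ∀ {m} (b : Vec Carrier m) n → VAll (line.Span b) (Vec.replicate n 𝟘)
    zeros b zero    = []
    zeros b (suc n) = line.IsSubspace.has-0 (line.span-isSubspace b) ∷ zeros b n

    add : ∀ {i n a} {b : Vec Carrier i} (r c : Vec Carrier n) → FO.Coef r → VAll (line.Span b) c → VAll (line.Span (a ∷ b)) (Vec.zipWith _⊕_ (Vec.map (a ⊗_) r) c)
    add []      []      []       []       = []
    add {a = a} {b} (r ∷ rs) (c ∷ cs) (m ∷ ms) (p ∷ ps) =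
      line.IsSubspace.has-+ (line.span-isSubspace (a ∷ b)) (subst (line.Span (a ∷ b)) (*-comm r a) (line.IsSubspace.has-* (line.span-isSubspace (a ∷ b)) m line.span-here)) (line.span-there p)
      ∷ add rs cs ms ps

    go : ∀ {n} (a : Vec Carrier n) {N} → VAll FO.Coef N → VAll (line.Span a) (Row.lc k a N)
    go []      {[]}    []       = zeros [] k
    go (a ∷ as) {r ∷ N} (m ∷ ms) = add r (Row.lc k as N) m (go as ms)

  -- If x = N y with N invertible over GF(q), a relation a of x becomes the relation a N of y, and
  -- the entries of a and of a N span the same space over GF(q).
  good-basechange : ∀ {x y} → FO.Ind x → FO.Ind y → VAll (FO.Span y) x → VAll (FO.Span x) y → Good x → Good y
  good-basechange {x} {y} ind-x ind-y x⊆y y⊆x = λ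
    { (inj₁ (w , ind))          → inj₁ (w , LO.coef-zero⇒ind y (λ {c} _ e → trans (sym (inverse-y c)) (trans (cong (λ d → Row.lc k d N) (LO.coef-zero ind {Row.lc k c M′} (coef _) (to-x c e))) (zero-lc N))))
    ; (inj₂ (a , s , e , only)) → inj₂ (Row.lc k a N , S.respects (row-entries a msN) (subst (VAll (line.Span (Row.lc k a N))) (inverse-x a) (row-entries (Row.lc k a N) msM)) s ,
        trans (sym (lc-rows a N y)) (trans (cong (lc a) Ny≡x) e) ,
        λ c e′ → let f , eq = only (Row.lc k c M′) (to-x c e′) in f , trans (sym (inverse-y c)) (trans (cong (λ d → Row.lc k d N) eq) (Row.lc-* k f a N))) }
    where
    N-rows = rows x⊆y
    M-rows = rows y⊆x
    N M′ : Vec (Vec Carrier k) k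
    N  = proj₁ N-rows
    M′ = proj₁ M-rows
    msN  = proj₁ (proj₂ N-rows)
    msM  = proj₁ (proj₂ M-rows)
    Ny≡x = proj₂ (proj₂ N-rows)
    Mx≡y = proj₂ (proj₂ M-rows)

    inverse-y : ∀ c → Row.lc k (Row.lc k c M′) N ≡ c
    inverse-y = rows-inverse ind-y msM msN Mx≡y Ny≡x

    inverse-x : ∀ a → Row.lc k (Row.lc k a N) M′ ≡ a
    inverse-x = rows-inverse ind-x msN msM Ny≡x Mx≡y

    to-x : ∀ c → lc c y ≡ 0ᴹ → lc (Row.lc k c M′) x ≡ 0ᴹ
    to-x c e = trans (sym (lc-rows c M′ x)) (trans (cong (lc c) Mx≡y) e)

    zero-lc : (N : Vec (Vec Carrier k) k) → Row.lc k (Vec.replicate k 𝟘) N ≡ Vec.replicate k 𝟘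
    zero-lc N = Row.lc-0 k N

  -- The chosen relations of x are the nonzero multiples of any one of them, whence the factor q^l -
  -- 1 carried through the later counts.
  #-relations : ∀ x → # (λ a → S.mem? a ×-dec rel? a x) ∈ tuples finite k ≡ ⟦ related? x ⟧ * (q ^ l ∸ 1)
  #-relations x = by-cases (related? x)
    where
    by-cases : (d : Dec (∃[ a ] S.Mem a × Rel a x)) → # (λ a → S.mem? a ×-dec rel? a x) ∈ tuples finite k ≡ ⟦ d ⟧ * (q ^ l ∸ 1)
    by-cases (no ¬r) = #-none _ (tuples finite k) (λ {a} _ r → ¬r (a , r))
    by-cases (yes (a₀ , s₀ , e₀ , only₀)) = trans
      (doubleCount (tuples finite k) elems multiple?
        (λ {a} _ → ⟦⟧-unique (S.mem? a ×-dec rel? a x)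
          (λ (s , e , only) → let f , eq = only₀ a e in count-one (multiple? a) ((λ f≡0 → rank≥3⇒≢0 s (trans eq (zero-scaled a₀ f≡0))) , eq)
            (λ g (_ , eq′) → cancel a₀ (rank≥3⇒≢0 s₀) (trans (sym eq′) eq)))
          (λ ¬r → #-none _ elems (λ { {f} _ (f≢0 , refl) → ¬r (S.scale f≢0 s₀ , trans (lc-* f a₀ x) (trans (cong (f *ₗ_) e₀) (*ₗ-zeroʳ f)) , rescale f f≢0) })))
        (λ {f} _ → ⟦⟧-unique (¬? (f ≟ 𝟘)) (λ f≢0 → Finite.count-one (finiteVec finite k) (λ a → multiple? a f) (f≢0 , refl) (λ _ → proj₂))
          (λ ¬f≢0 → #-none _ (tuples finite k) (λ _ (f≢0 , _) → ¬f≢0 f≢0))))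
      (trans count-nonzero (sym (ℕ.+-identityʳ _)))
      where
      multiple? : ∀ a f → Dec (f ≢ 𝟘 × a ≡ Vec.map (f ⊗_) a₀)
      multiple? a f = ¬? (f ≟ 𝟘) ×-dec Finite._≟_ (finiteVec finite k) a (Vec.map (f ⊗_) a₀)

      cancel : ∀ {n f g} (a : Vec Carrier n) → a ≢ Vec.replicate n 𝟘 → Vec.map (g ⊗_) a ≡ Vec.map (f ⊗_) a → g ≡ f
      cancel []      a≢0 e = contradiction refl a≢0
      cancel (a ∷ as) a≢0 e with a ≟ 𝟘
      ... | yes refl = cancel as (λ as≡0 → a≢0 (cong (𝟘 ∷_) as≡0)) (Vec.∷-injectiveʳ e)
      ... | no a₁≢0  = ⊗-cancelˡ a₁≢0 (trans (*-comm a _) (trans (Vec.∷-injectiveˡ e) (*-comm _ a)))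

      rescale : ∀ f → f ≢ 𝟘 → ∀ c → lc c x ≡ 0ᴹ → ∃[ e ] c ≡ Vec.map (e ⊗_) (Vec.map (f ⊗_) a₀)
      rescale f f≢0 c e with only₀ c e | inverse f f≢0
      ... | h , refl | g , gf = h ⊗ g , trans (Vec.map-cong (λ z → cong (_⊗ z) (sym (trans (*-assoc h g f) (trans (cong (h ⊗_) gf) (*-identityʳ h))))) a₀)
                                          (trans (Vec.map-cong (λ z → *-assoc (h ⊗ g) f z) a₀) (Vec.map-∘ _ _ a₀))

-- Counting the blocks through a pair

module BlockCount {q l : ℕ} {F : FiniteField q} {L : FiniteField (q ^ l)} (φ : F ↪ L) (M : FinModule L)
                  (i : ℕ) (S : Selection {q} {l} φ (suc i + 2)) {W : Set} (W? : Dec W) where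
  open FiniteField L
  open FieldTheory L hiding (_⊖_)
  open Extension {q} {l} φ
  open Linear M
  open LinearRelations L
  open Relations M using (Rel; rel?; #-ind-extensions; #-rel-extensions)
  open BaseProperties using (module line)
  open GoodTuples {q} {l} φ M S W? public
  module FO = Over baseField
  module LO = Over (wholeField L)
  private module S = Selection S

  -- A tuple spanning a block through t is a prefix of j = k - 2 vectors followed by t. When a
  -- relation forces one of them, i = k - 3 are left.
  j k : ℕ
  j = suc i
  k = j + 2

  good-suffix : (xs : Vec Carrierᴹ j) (t : Vec Carrierᴹ 2) → Good (xs Vec.++ t) → LO.Ind t
  good-suffix = suffix-L-ind refl

  #selected : ℕ
  #selected = # S.mem? ∈ tuples finite k

  #good : (t : Vec Carrierᴹ 2) → ℕ
  #good t = # (λ xs → good? (xs Vec.++ t)) ∈ tuples finiteᴹ j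

  -- Good prefixes are either independent over GF(q^l) together with t or carry a chosen relation,
  -- never both. The latter are counted by their relations: every chosen a has the same number of
  -- prefixes, and every such prefix has q^l - 1 relations.
  #good≡ : ∀ {m} → V.size ≡ (q ^ l) ^ m → ∀ {t} → LO.Ind t →
           #good t * (q ^ l ∸ 1) ≡ ⟦ W? ⟧ * extensions (q ^ l) m 2 j * (q ^ l ∸ 1) + #selected * extensions (q ^ l) m 2 i
  #good≡ {m} dim {t} t-ind = begin
    #good t * (q ^ l ∸ 1)
      ≡⟨ cong (_* (q ^ l ∸ 1)) (trans (sumOver-cong (tuples finiteᴹ j) split) (sumOver-+ (tuples finiteᴹ j) _ _)) ⟩
    (sumOver (tuples finiteᴹ j) (λ xs → ⟦ W? ⟧ * ⟦ LO.ind? (xs Vec.++ t) ⟧) + # (λ xs → related? (xs Vec.++ t)) ∈ tuples finiteᴹ j) * (q ^ l ∸ 1)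
      ≡⟨ ℕ.*-distribʳ-+ (q ^ l ∸ 1) (sumOver (tuples finiteᴹ j) (λ xs → ⟦ W? ⟧ * ⟦ LO.ind? (xs Vec.++ t) ⟧)) _ ⟩
    sumOver (tuples finiteᴹ j) (λ xs → ⟦ W? ⟧ * ⟦ LO.ind? (xs Vec.++ t) ⟧) * (q ^ l ∸ 1) + # (λ xs → related? (xs Vec.++ t)) ∈ tuples finiteᴹ j * (q ^ l ∸ 1)
      ≡⟨ cong₂ _+_ (cong (_* (q ^ l ∸ 1)) (trans (sumOver-*ˡ (tuples finiteᴹ j) _ ⟦ W? ⟧) (cong (⟦ W? ⟧ *_) (#-ind-extensions {m} dim t t-ind j)))) #related ⟩
    ⟦ W? ⟧ * extensions (q ^ l) m 2 j * (q ^ l ∸ 1) + #selected * extensions (q ^ l) m 2 i ∎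
    where
    open ≡-Reasoning
    split : ∀ xs → ⟦ good? (xs Vec.++ t) ⟧ ≡ ⟦ W? ⟧ * ⟦ LO.ind? (xs Vec.++ t) ⟧ + ⟦ related? (xs Vec.++ t) ⟧
    split xs = trans (disjoint (W? ×-dec LO.ind? (xs Vec.++ t)) (related? (xs Vec.++ t))
        (λ { (_ , ind) (a , s , e , _) → rank≥3⇒≢0 s (LO.coef-zero ind (VAll.universal (λ _ → tt) a) e) }))
      (cong (_+ ⟦ related? (xs Vec.++ t) ⟧) (⟦⟧-× W? (LO.ind? (xs Vec.++ t))))
      where
      disjoint : {A B : Set} (a? : Dec A) (b? : Dec B) → (A → B → ⊥) → ⟦ a? ⊎-dec b? ⟧ ≡ ⟦ a? ⟧ + ⟦ b? ⟧
      disjoint (yes a) (yes b) h = ⊥-elim (h a b)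
      disjoint (yes _) (no _)  h = refl
      disjoint (no _)  (yes _) h = refl
      disjoint (no _)  (no _)  h = refl

    selected-relation? : ∀ xs a → Dec (S.Mem a × Rel a (xs Vec.++ t))
    selected-relation? xs a = S.mem? a ×-dec rel? a (xs Vec.++ t)

    per-a : ∀ a → # (λ xs → selected-relation? xs a) ∈ tuples finiteᴹ j ≡ ⟦ S.mem? a ⟧ * extensions (q ^ l) m 2 i
    per-a a = trans (sumOver-cong (tuples finiteᴹ j) (λ xs → ⟦⟧-× (S.mem? a) (rel? a (xs Vec.++ t))))
      (trans (sumOver-*ˡ (tuples finiteᴹ j) _ ⟦ S.mem? a ⟧) (⟦⟧-*-cong (S.mem? a) (λ s → count-relations (Vec.splitAt j a) s)))
      where
      suffix-spans : ∀ {n} (α : Vec Carrier 2) → VAll (line.Span α) (Vec.replicate n 𝟘 Vec.++ α)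
      suffix-spans {zero}  α = line.span-members α
      suffix-spans {suc n} α = line.IsSubspace.has-0 (line.span-isSubspace α) ∷ suffix-spans {n} α

      count-relations : ∀ {a} → ∃₂ (λ (a′ : Vec Carrier j) α → a ≡ a′ Vec.++ α) → S.Mem a →
                        # (λ xs → rel? a (xs Vec.++ t)) ∈ tuples finiteᴹ j ≡ extensions (q ^ l) m 2 i
      -- If a′ were zero, all entries of a would lie in the span of the two entries of α.
      count-relations (a′ , α@(u ∷ v ∷ []) , refl) s = #-rel-extensions {m} dim t t-ind i a′ α (λ { refl → S.rank≥3 s u v (suffix-spans {j} α) })

    #related : # (λ xs → related? (xs Vec.++ t)) ∈ tuples finiteᴹ j * (q ^ l ∸ 1) ≡ #selected * extensions (q ^ l) m 2 i
    #related = trans (sym (sumOver-*ʳ (tuples finiteᴹ j) _ (q ^ l ∸ 1)))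
      (trans (doubleCount (tuples finiteᴹ j) (tuples finite k) selected-relation? (λ {xs} _ → #-relations (xs Vec.++ t)) (λ {a} _ → per-a a))
      (sumOver-*ʳ (tuples finite k) _ (extensions (q ^ l) m 2 i)))

  _≈_ : Vec Carrierᴹ k → Vec Carrierᴹ k → Set
  x ≈ y = VAll (FO.Span y) x × VAll (FO.Span x) y

  _≈?_ : ∀ x y → Dec (x ≈ y)
  x ≈? y = VAll.all? (FO.span? y) x ×-dec VAll.all? (FO.span? x) y

  ≈-refl : ∀ {x} → x ≈ x
  ≈-refl {x} = FO.span-members x , FO.span-members x

  ≈-sym : ∀ {x y} → x ≈ y → y ≈ x
  ≈-sym (p , r) = r , p

  ≈-trans : ∀ {x y z} → x ≈ y → y ≈ z → x ≈ z
  ≈-trans (p , r) (p′ , r′) = VAll.map (FO.span-mono p′) p , VAll.map (FO.span-mono r) r′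

  module Reps = Representatives _≈?_ (λ {x} → ≈-refl {x}) (λ {x} {y} → ≈-sym {x} {y}) (λ {x} {y} {z} → ≈-trans {x} {y} {z})

  blockTuples : List (Vec Carrierᴹ k)
  blockTuples = Reps.reps (filter good? (tuples finiteᴹ k))

  blockTuples-good : ∀ {b} → b ∈ blockTuples → Good b
  blockTuples-good b∈ = proj₂ (∈-filter⁻ good? {xs = tuples finiteᴹ k} (Reps.reps-⊆ _ b∈))

  blockTuples-cover : ∀ {x} → Good x → ∃[ b ] b ∈ blockTuples × x ≈ b
  blockTuples-cover {x} g = Reps.reps-cover (filter good? (tuples finiteᴹ k)) (∈-filter⁺ good? (Finite.complete (finiteVec finiteᴹ k) x) g)

  contains? : (t : Vec Carrierᴹ 2) → Decidable (λ (b : Vec Carrierᴹ k) → VAll (FO.Span b) t)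
  contains? t b = VAll.all? (FO.span? b) t

  -- A good extension of t spans exactly one block. Conversely every basis of a block that ends in t
  -- is good, and there are `extensions q k 2 j` of them.
  #containing : ∀ {t} → LO.Ind t → # contains? t ∈ blockTuples * extensions q k 2 j ≡ #good t
  #containing {t} t-ind = trans (sym (sumOver-*ʳ blockTuples (λ b → ⟦ contains? t b ⟧) (extensions q k 2 j)))
    (doubleCount blockTuples (tuples finiteᴹ j) extends-to? per-b (λ {xs} _ → per-xs xs))
    where
    extends-to? : ∀ b xs → Dec (Good (xs Vec.++ t) × (xs Vec.++ t) ≈ b)
    extends-to? b xs = good? (xs Vec.++ t) ×-dec ((xs Vec.++ t) ≈? b)

    t-F-ind : FO.Ind t
    t-F-ind = L-ind⇒F-ind t t-ind

    suffix : ∀ {n} {P : Pred Carrierᴹ 0ℓ} (xs : Vec Carrierᴹ n) → VAll P (xs Vec.++ t) → VAll P xs × VAll P t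
    suffix []       ps       = [] , ps
    suffix (x ∷ xs) (p ∷ ps) = let r , r′ = suffix xs ps in p ∷ r , r′

    join : ∀ {n} {P : Pred Carrierᴹ 0ℓ} {xs : Vec Carrierᴹ n} → VAll P xs → VAll P t → VAll P (xs Vec.++ t)
    join []       rs = rs
    join (p ∷ ps) rs = p ∷ join ps rs

    per-b : ∀ {b} → b ∈ blockTuples → # extends-to? b ∈ tuples finiteᴹ j ≡ ⟦ contains? t b ⟧ * extensions q k 2 j
    per-b {b} b∈ = by-cases (contains? t b)
      where
      b-good = blockTuples-good b∈
      b-ind  = good⇒F-ind b-good

      by-cases : (c : Dec (VAll (FO.Span b) t)) → # extends-to? b ∈ tuples finiteᴹ j ≡ ⟦ c ⟧ * extensions q k 2 j
      by-cases (no ¬c) = #-none _ (tuples finiteᴹ j) (λ {xs} _ (_ , xt⊆b , _) → ¬c (proj₂ (suffix xs xt⊆b)))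
      by-cases (yes c) = trans (trans
        (#-cong (extends-to? b) (FO.extends? (FO.span? b) (FO.span-isSubspace b) {k} (FO.card-span b-ind) t) (tuples finiteᴹ j)
          (λ xs (g , xt⊆b , _) → good⇒F-ind g , proj₁ (suffix xs xt⊆b))
          (λ xs (ind , xs⊆b) → let xt⊆b = join xs⊆b c
                                   b⊆xt = VAll.map (FO.independent-spans (FO.span? b) (FO.span-isSubspace b) ind xt⊆b (FO.card-span b-ind)) (FO.span-members b)
                               in good-basechange b-ind ind b⊆xt xt⊆b b-good , xt⊆b , b⊆xt))
        (FO.#-extensions (FO.span? b) (FO.span-isSubspace b) {k} (FO.card-span b-ind) t-F-ind c j))
        (trans (cong (λ c → extensions c k 2 j) base-card) (sym (ℕ.+-identityʳ _)))

    per-xs : ∀ xs → # (λ b → extends-to? b xs) ∈ blockTuples ≡ ⟦ good? (xs Vec.++ t) ⟧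
    per-xs xs = ⟦⟧-unique (good? (xs Vec.++ t))
      (λ g → trans (#-cong (λ b → extends-to? b xs) ((xs Vec.++ t) ≈?_) blockTuples (λ _ → proj₂) (λ _ r → g , r))
        (trans (Reps.#-inequivalent (xs Vec.++ t) (Reps.reps-inequivalent _)) (⟦⟧-yes (Any.any? ((xs Vec.++ t) ≈?_) blockTuples)
          (let b , b∈ , r = blockTuples-cover g in lose b∈ r))))
      (λ ¬g → #-none _ blockTuples (λ _ (g , _) → ¬g g))

-- The selected relation classes and the multiplicity

take-⊆ : ∀ n (xs : List X) {x} → x ∈ take n xs → x ∈ xs
take-⊆ (suc n) (x ∷ xs) (here e)   = here e
take-⊆ (suc n) (x ∷ xs) (there x∈) = there (take-⊆ n xs x∈)

divisors : ℕ → List ℕ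
divisors n = filter (_∣? n) (range n)

∈-divisors : ∀ {n u} → u ∈ divisors n → 0 < u × u ∣ n
∈-divisors {n} u∈ = let u∈′ , u∣n = ∈-filter⁻ (_∣? n) {xs = range n} u∈ in proj₁ (∈-range⁻ u∈′) , u∣n

∑-divisors-sum : ∀ n (h : (u : ℕ) → .{{_ : NonZero u}} → ℚ) (f : ℕ → ℚ) → (∀ u .{{_ : NonZero u}} → u ∣ n → h u ≡ f u) → ∑-divisors n h ≡ ∑ (divisors n) f
∑-divisors-sum n h f e = trans (∑-divisors-range n h f (λ i d → e (suc i) d)) (sym (filtered (range n)))
  where
  filtered : ∀ xs → ∑ (filter (_∣? n) xs) f ≡ ∑ xs (λ t → ⟦ t ∣? n ⟧ℚ ℚ.* f t)
  filtered []       = refl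
  filtered (x ∷ xs) with x ∣? n
  ... | yes _ = cong₂ ℚ._+_ (sym (ℚ.*-identityˡ (f x))) (filtered xs)
  ... | no _  = trans (filtered xs) (sym (trans (cong (ℚ._+ ∑ xs (λ t → ⟦ t ∣? n ⟧ℚ ℚ.* f t)) (ℚ.*-zeroˡ (f x))) (ℚ.+-identityˡ _)))

module ClassSelection {q l : ℕ} {F : FiniteField q} {L : FiniteField (q ^ l)} (φ : F ↪ L) (k : ℕ) (number : ℕ → ℕ → ℕ) where
  open FiniteField L
  open FieldTheory L hiding (_⊖_)
  open Extension {q} {l} φ
  open Orbits {q} {l} φ k
  open BaseProperties using (module line)
  open BaseProperties.line using (span?)

  chosen : ℕ → ℕ → List Tuple
  chosen r u = take (number r u) (classReps (suc r) u)

  chosenOfRank : ℕ → List Tuple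
  chosenOfRank r = concatMap (chosen r) (divisors (gcd (suc r) l))

  representatives : List Tuple
  representatives = concatMap chosenOfRank (2 ⋯< k)

  chosen-hasType : ∀ r u {a} → a ∈ chosen r u → HasType (suc r) u a
  chosen-hasType r u a∈ = classReps-hasType (suc r) u (take-⊆ (number r u) _ a∈)

  chosenOfRank-rank : ∀ r {a} → a ∈ chosenOfRank r → count (span? a) ≡ q ^ suc r
  chosenOfRank-rank r a∈ = let u , _ , a∈′ = find (∈-concatMap⁻ (chosen r) {xs = divisors (gcd (suc r) l)} a∈) in
    proj₁ (chosen-hasType r u a∈′)

  ⋯<-≥ : ∀ {a b r} → r ∈ (a ⋯< b) → a ≤ r
  ⋯<-≥ {a} r∈ with ∈-map⁻ (_+_ a) r∈
  ... | i , _ , refl = ℕ.m≤m+n a i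

  representatives-rank : ∀ {a} → a ∈ representatives → ∃[ r ] 2 ≤ r × count (span? a) ≡ q ^ suc r
  representatives-rank a∈ = let r , r∈ , a∈′ = find (∈-concatMap⁻ chosenOfRank {xs = 2 ⋯< k} a∈) in
    r , ⋯<-≥ {b = k} r∈ , chosenOfRank-rank r a∈′

  concatMap-inequivalent : ∀ {is : List ℕ} (f : ℕ → List Tuple) → Unique is → (∀ i → Reps.Inequivalent (f i)) →
    (∀ {i i′ a a′} → a ∈ f i → a′ ∈ f i′ → a ~ a′ → i ≡ i′) → Reps.Inequivalent (concatMap f is)
  concatMap-inequivalent f u each apart = AllPairs.concat⁺ (All.map⁺ (All.tabulate (λ {i} _ → each i)))
    (AllPairs.map⁺ (AllPairs.map (λ i≢i′ → All.tabulate (λ a∈ → All.tabulate (λ a′∈ a~a′ → i≢i′ (apart a∈ a′∈ a~a′)))) u))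

  -- Classes for different r differ in rank and classes for different u in the order of the
  -- stabilizer, both invariant under `_~_`; so no orbit is chosen twice.
  representatives-inequivalent : Reps.Inequivalent representatives
  representatives-inequivalent = concatMap-inequivalent chosenOfRank (Unique.map⁺ (ℕ.+-cancelˡ-≡ 2 _ _) (Unique.upTo⁺ (k ∸ 2)))
    (λ r → concatMap-inequivalent (chosen r) (Unique.filter⁺ (_∣? gcd (suc r) l) (range-unique (gcd (suc r) l)))
      (λ u → AllPairs.take⁺ (number r u) (Reps.reps-inequivalent _))
      (λ {u} {u′} a∈ a′∈ a~a′ → q^-cancel (trans (sym (proj₂ (~-hasType (suc r) u a~a′ (chosen-hasType r u a∈)))) (proj₂ (chosen-hasType r u′ a′∈)))))
    (λ {r} {r′} a∈ a′∈ a~a′ → ℕ.suc-injective (q^-cancel (trans (sym (chosenOfRank-rank r a∈)) (trans (~-rank a~a′) (chosenOfRank-rank r′ a′∈)))))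

  Selected : Tuple → Set
  Selected a = Any (a ~_) representatives

  scale-~ : ∀ {e a} → e ≢ 𝟘 → Vec.map (e ⊗_) a ~ a
  scale-~ {e} {a} e≢0 with inverse e e≢0
  ... | d , de = d , inverse≢0 de , λ y →
    (λ { (c , m , refl) → c , m , sym (trans (cong (d ⊗_) (lc-scale c a)) (trans (sym (*-assoc d e _)) (trans (cong (_⊗ lc c a) de) (*-identityˡ _)))) }) ,
    (λ { (c , m , eq) → c , m , trans (lc-scale c a) (trans (cong (e ⊗_) eq) (trans (sym (*-assoc e d y)) (trans (cong (_⊗ y) (trans (*-comm e d) de)) (*-identityˡ y)))) })
    where
    open Linear (lineModule L) using (lc)
    lc-scale : ∀ {n} (c a : Vec Carrier n) → lc c (Vec.map (e ⊗_) a) ≡ e ⊗ lc c a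
    lc-scale = LinearRelations.IsLinear.lc-map {L = L} {lineModule L} {lineModule L}
      (record { map-+ = distribˡ e ; map-* = λ a x → trans (sym (*-assoc e a x)) (trans (cong (_⊗ x) (*-comm e a)) (*-assoc a e x)) })

  selection : Selection {q} {l} φ k
  selection = record
    { Mem      = Selected
    ; mem?     = λ a → Any.any? (a ~?_) representatives
    ; scale    = λ e≢0 → Any.map (~-trans (scale-~ e≢0))
    ; respects = λ {a} {b} b⊆a a⊆b → Any.map (~-trans (𝟙 , 𝟙≢𝟘 , λ y →
                   (λ s → subst (line.Span a) (sym (*-identityˡ y)) (line.span-mono b⊆a s)) ,
                   (λ s → line.span-mono a⊆b (subst (line.Span a) (*-identityˡ y) s))))
    -- The span of the entries has q^(r+1) elements with r + 1 at least 3, while two vectors span at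
    -- most q^2.
    ; rank≥3   = λ {a} s u v a⊆uv → let b , b∈ , a~b = find s ; r , 2≤r , rank = representatives-rank b∈ in
                   ℕ.<⇒≱ (ℕ.^-monoʳ-< q 1<q (s≤s 2≤r)) (subst₂ _≤_ (trans (~-rank a~b) rank) (cong (_^ 2) base-card)
                     (ℕ.≤-trans (#-⊆ (span? a) (line.span? (u ∷ v ∷ [])) elems (λ _ → line.span-mono a⊆uv)) (line.card-span-≤ (u ∷ v ∷ []))))
    }

  #selected≡ : # (Selection.mem? selection) ∈ tuples finite k ≡
    sumOver (2 ⋯< k) (λ r → sumOver (divisors (gcd (suc r) l)) (λ u → sumOver (chosen r u) (λ b → # (_~? b) ∈ tuples finite k)))
  #selected≡ = trans (doubleCount (tuples finite k) representatives _~?_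
      (λ {a} _ → Reps.#-inequivalent a representatives-inequivalent) (λ _ → refl))
    (trans (sumOver-concatMap chosenOfRank (2 ⋯< k) _) (sumOver-cong (2 ⋯< k) (λ r → sumOver-concatMap (chosen r) (divisors (gcd (suc r) l)) _)))

-- Evaluation of the multiplicity

module Multiplicity {q l : ℕ} {F : FiniteField q} {L : FiniteField (q ^ l)} (φ : F ↪ L) (m i w : ℕ) (0<l : 0 < l) (w≤1 : w ≤ 1)
                    (k≤m+1 : suc i + 2 ≤ suc m) (k≤l : suc i + 2 ≤ l) (ws : ℕ → ℕ → ℤ)
                    (ws-bound : ∀ r u → .{{_ : NonZero u}} → 2 ≤ r → r < suc i + 2 → u ∣ gcd (suc r) l →
                                0ℤ ℤ.≤ ws r u × fromℤ (ws r u) ℚ.≤ orbitNumber q l (suc r) u) where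
  open Extension {q} {l} φ using (1<q; q≢0)
  open FieldTheory L using (finite)
  open Powers q 1<q hiding (fromℕ-extensions; extensions-≢0)
  open ℚ.+-*-Solver using (solve; con; _:=_; _:+_; _:*_; _:-_)

  j k Q : ℕ
  j = suc i
  k = j + 2
  Q = q ^ l

  module PQ = Powers Q (ℕ.^-monoʳ-< q 1<q 0<l)
  open OrbitCount {q} {l} φ k
  open Orbits {q} {l} φ k using (classReps; class-size; _~?_)
  open ClassSelection {q} {l} φ k (λ r u → ℤ.∣ ws r u ∣)

  pow-Q : ∀ n → PQ.pow n ≡ pow (n * l)
  pow-Q n = cong fromℕ (trans (ℕ.^-*-assoc q l n) (cong (q ^_) (ℕ.*-comm l n)))

  -- E counts the prefixes completing a pair to a basis of one block, A the prefixes independent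
  -- over GF(q^l) together with the pair, and B the prefixes with a given relation.
  Q-1 E A B : ℚ
  Q-1 = fromℕ (Q ∸ 1)
  E = fromℕ (extensions q k 2 j)
  A = fromℕ (extensions Q m 2 j)
  B = fromℕ (extensions Q m 2 i)

  Q-1≢0 : Q-1 ≢ 0ℚ
  Q-1≢0 e = PQ.pow-diff-≢0 {0} {1} z<s (trans (sym (PQ.pow-∸ {0} {1} z≤n)) (trans (cong (λ n → fromℕ (n ∸ 1)) (ℕ.*-identityʳ Q)) e))

  E≢0 : E ≢ 0ℚ
  E≢0 = Powers.extensions-≢0 q 1<q k 2 j ℕ.≤-refl

  E≡ : E ≡ ∏< j (λ n → pow k ℚ.- pow (n + 2))
  E≡ = Powers.fromℕ-extensions q 1<q k 2 j (ℕ.n≤1+n k)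

  A≡ : A ≡ ∏< j (λ n → pow (m * l) ℚ.- pow ((n + 2) * l))
  A≡ = trans (PQ.fromℕ-extensions m 2 j k≤m+1) (∏<-cong j (λ {n} _ → cong₂ ℚ._-_ (pow-Q m) (pow-Q (n + 2))))

  B≡ : B ≡ ∏ (2 ⋯< (k ∸ 1)) (λ n → pow (m * l) ℚ.- pow (n * l))
  B≡ = trans (PQ.fromℕ-extensions m 2 i (ℕ.<⇒≤ k≤m+1)) (trans
    (∏<-cong i (λ {n} _ → cong₂ ℚ._-_ (pow-Q m) (trans (pow-Q (n + 2)) (cong (λ x → pow (x * l)) (ℕ.+-comm n 2)))))
    (sym (trans (∏-⋯< 2 (k ∸ 1) _) (cong (λ n → ∏< n (λ n → pow (m * l) ℚ.- pow ((2 + n) * l))) (ℕ.m+n∸n≡m i 2)))))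

  module _ (r : ℕ) (2≤r : 2 ≤ r) (r<k : r < k) where
    rest : ℚ
    rest = ∏ (suc r ⋯< k) (λ n → pow k ℚ.- pow n)

    S : ℚ
    S = fromℕ (spanningTuples q (suc r) k 0)

    -- Both sides are the product of q^k - q^n over all n < k, split at r + 1 on the left and at 2
    -- on the right.
    S-rest : S ℚ.* rest ≡ (pow k ℚ.- 1ℚ) ℚ.* (pow k ℚ.- pow 1) ℚ.* E
    S-rest = begin
      S ℚ.* rest ≡⟨ cong₂ ℚ._*_ (spanning≡ (suc r)) (∏-⋯< (suc r) k f) ⟩
      ∏< (suc r) f ℚ.* ∏< (k ∸ suc r) (λ n → f (suc r + n)) ≡⟨ ∏<-+ (suc r) (k ∸ suc r) f ⟨
      ∏< (suc r + (k ∸ suc r)) f ≡⟨ cong (λ n → ∏< n f) (trans (ℕ.m+[n∸m]≡n r<k) (ℕ.+-comm j 2)) ⟩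
      ∏< (2 + j) f ≡⟨ ∏<-+ 2 j f ⟩
      (f 0 ℚ.* (f 1 ℚ.* 1ℚ)) ℚ.* ∏< j (λ n → f (2 + n)) ≡⟨ cong₂ ℚ._*_ (cong (f 0 ℚ.*_) (ℚ.*-identityʳ (f 1))) (trans (∏<-cong j (λ {n} _ → cong f (ℕ.+-comm 2 n))) (sym E≡)) ⟩
      f 0 ℚ.* f 1 ℚ.* E                                                                   ∎
      where
      open ≡-Reasoning
      f : ℕ → ℚ
      f n = pow k ℚ.- pow n

    rest≢0 : rest ≢ 0ℚ
    rest≢0 e = ∏<-≢0 (k ∸ suc r) {λ n → pow k ℚ.- pow (suc r + n)} (λ {n} n< → pow-diff-≢0 (ℕ.≤-trans (ℕ.≤-reflexive (sym (ℕ.+-suc (suc r) n))) (ℕ.≤-trans (ℕ.+-monoʳ-≤ (suc r) n<) (ℕ.≤-reflexive (ℕ.m+[n∸m]≡n r<k)))))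
      (trans (sym (∏-⋯< (suc r) k _)) e)

    module _ (u : ℕ) .{{_ : NonZero u}} (u∣G : u ∣ gcd (suc r) l) where
      quotient : ℚ
      quotient = ((pow k ℚ.- 1ℚ) ℚ.* (pow k ℚ.- pow 1) ℚ.* (∏[ n ∈ 2 ⋯< (k ∸ 1) ] (pow (m * l) ℚ.- pow (n * l)))) ÷₀ ((pow u ℚ.- 1ℚ) ℚ.* rest)

      pow-u≢0 : pow u ℚ.- 1ℚ ≢ 0ℚ
      pow-u≢0 = pow-diff-≢0 {0} (ℕ.>-nonZero⁻¹ u)

      -- A class has (Q - 1) S / (q^u - 1) tuples by `class-size`, and `S-rest` trades S for E. What
      -- remains is the contribution of one orbit to λ, multiplied by E (Q - 1).
      class-quotient : ∀ {b} → b ∈ chosen r u → fromℕ (# (_~? b) ∈ tuples finite k) ℚ.* B ≡ quotient ℚ.* (E ℚ.* Q-1)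
      class-quotient {b} b∈ = ℚ-*-cancelʳ (ℚ-*-≢0 pow-u≢0 rest≢0) (begin
        c ℚ.* B ℚ.* (U ℚ.* rest) ≡⟨ solve 4 (λ c B U R → c :* B :* (U :* R) := (c :* U) :* R :* B) refl c B U rest ⟩
        (c ℚ.* U) ℚ.* rest ℚ.* B ≡⟨ cong (λ x → x ℚ.* rest ℚ.* B) c-U ⟩
        (Q-1 ℚ.* S) ℚ.* rest ℚ.* B ≡⟨ solve 4 (λ Q S R B → (Q :* S) :* R :* B := (S :* R) :* B :* Q) refl Q-1 S rest B ⟩
        (S ℚ.* rest) ℚ.* B ℚ.* Q-1 ≡⟨ cong₂ (λ x y → x ℚ.* y ℚ.* Q-1) S-rest B≡ ⟩
        num ℚ.* E ℚ.* B′ ℚ.* Q-1 ≡⟨ solve 4 (λ X E B Q → X :* E :* B :* Q := (X :* B) :* (E :* Q)) refl num E B′ Q-1 ⟩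
        (num ℚ.* B′) ℚ.* (E ℚ.* Q-1) ≡⟨ cong (ℚ._* (E ℚ.* Q-1)) (÷₀-* (num ℚ.* B′) (ℚ-*-≢0 pow-u≢0 rest≢0)) ⟨
        quotient ℚ.* (U ℚ.* rest) ℚ.* (E ℚ.* Q-1) ≡⟨ solve 3 (λ x y z → x :* y :* z := x :* z :* y) refl quotient (U ℚ.* rest) (E ℚ.* Q-1) ⟩
        quotient ℚ.* (E ℚ.* Q-1) ℚ.* (U ℚ.* rest)                        ∎)
        where
        open ≡-Reasoning
        c  = fromℕ (# (_~? b) ∈ tuples finite k)
        U  = pow u ℚ.- 1ℚ
        num = (pow k ℚ.- 1ℚ) ℚ.* (pow k ℚ.- pow 1)
        B′ = ∏[ n ∈ 2 ⋯< (k ∸ 1) ] (pow (m * l) ℚ.- pow (n * l))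

        c-U : c ℚ.* U ≡ Q-1 ℚ.* S
        c-U = begin
          c ℚ.* U ≡⟨ cong (c ℚ.*_) (pow-∸ {0} {u} z≤n) ⟨
          c ℚ.* fromℕ (q ^ u ∸ 1) ≡⟨ fromℕ-* (# (_~? b) ∈ tuples finite k) (q ^ u ∸ 1) ⟨
          fromℕ (# (_~? b) ∈ tuples finite k * (q ^ u ∸ 1)) ≡⟨ cong fromℕ (class-size (suc r) u (chosen-hasType r u b∈)) ⟩
          fromℕ ((q ^ l ∸ 1) * spanningTuples q (suc r) k 0) ≡⟨ fromℕ-* (q ^ l ∸ 1) (spanningTuples q (suc r) k 0) ⟩
          Q-1 ℚ.* S                                                ∎

      -- `take` yields as many representatives as asked for, since the upper bound on `ws r u` is
      -- the number of available orbits.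
      number≡ : fromℕ (length (chosen r u)) ≡ fromℤ (ws r u)
      number≡ = trans (cong fromℕ (trans (List.length-take ℤ.∣ ws r u ∣ (classReps (suc r) u)) (ℕ.m≤n⇒m⊓n≡m bound))) (cong fromℤ abs)
        where
        abs : + ℤ.∣ ws r u ∣ ≡ ws r u
        abs = ℤ.0≤i⇒+∣i∣≡i (proj₁ (ws-bound r u 2≤r r<k u∣G))

        bound : ℤ.∣ ws r u ∣ ≤ length (classReps (suc r) u)
        bound = ℤ.drop‿+≤+ (fromℤ-≤ (subst₂ ℚ._≤_ (cong fromℤ (sym abs))
          (sym (orbitNumber-classReps 0<l r<k (ℕ.≤-trans r<k k≤l) u u∣G)) (proj₂ (ws-bound r u 2≤r r<k u∣G))))

      chosen-sum : fromℕ (sumOver (chosen r u) (λ b → # (_~? b) ∈ tuples finite k)) ℚ.* B ≡ fromℤ (ws r u) ℚ.* quotient ℚ.* (E ℚ.* Q-1)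
      chosen-sum = begin
        fromℕ (sumOver (chosen r u) size-of) ℚ.* B ≡⟨ cong (ℚ._* B) (fromℕ-sumOver (chosen r u) size-of) ⟩
        ∑ (chosen r u) (λ b → fromℕ (size-of b)) ℚ.* B ≡⟨ ℚ.*-comm (∑ (chosen r u) (λ b → fromℕ (size-of b))) B ⟩
        B ℚ.* ∑ (chosen r u) (λ b → fromℕ (size-of b)) ≡⟨ ∑-*ˡ B (chosen r u) (λ b → fromℕ (size-of b)) ⟨
        ∑ (chosen r u) (λ b → B ℚ.* fromℕ (size-of b)) ≡⟨ ∑-cong∈ (chosen r u) (λ {b} b∈ → trans (ℚ.*-comm B (fromℕ (size-of b))) (trans (class-quotient b∈) (sym (ℚ.*-identityʳ qEQ)))) ⟩
        ∑ (chosen r u) (λ _ → qEQ ℚ.* 1ℚ) ≡⟨ ∑-*ˡ qEQ (chosen r u) (λ _ → 1ℚ) ⟩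
        qEQ ℚ.* ∑ (chosen r u) (λ _ → 1ℚ) ≡⟨ cong (qEQ ℚ.*_) (fromℕ-sumOver (chosen r u) (λ _ → 1)) ⟨
        qEQ ℚ.* fromℕ (sumOver (chosen r u) (λ _ → 1)) ≡⟨ cong (λ n → qEQ ℚ.* fromℕ n) (trans (sumOver-const (chosen r u) 1) (ℕ.*-identityʳ (length (chosen r u)))) ⟩
        qEQ ℚ.* fromℕ (length (chosen r u)) ≡⟨ cong (qEQ ℚ.*_) number≡ ⟩
        qEQ ℚ.* fromℤ (ws r u) ≡⟨ solve 3 (λ x y z → x :* y :* z := z :* x :* y) refl quotient (E ℚ.* Q-1) (fromℤ (ws r u)) ⟩
        fromℤ (ws r u) ℚ.* quotient ℚ.* (E ℚ.* Q-1)                  ∎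
        where
        open ≡-Reasoning
        qEQ : ℚ
        qEQ = quotient ℚ.* (E ℚ.* Q-1)

        size-of : Vec (FiniteField.Carrier L) k → ℕ
        size-of b = # (_~? b) ∈ tuples finite k

  ∑-*ʳ : (xs : List X) (f : X → ℚ) (c : ℚ) → ∑ xs f ℚ.* c ≡ ∑ xs (λ x → f x ℚ.* c)
  ∑-*ʳ xs f c = trans (ℚ.*-comm (∑ xs f) c) (trans (sym (∑-*ˡ c xs f)) (∑-cong xs (λ x → ℚ.*-comm c (f x))))

  fromℕ-sumOver-* : (xs : List X) (f : X → ℕ) (c : ℚ) → fromℕ (sumOver xs f) ℚ.* c ≡ ∑ xs (λ x → fromℕ (f x) ℚ.* c)
  fromℕ-sumOver-* xs f c = trans (cong (ℚ._* c) (fromℕ-sumOver xs f)) (∑-*ʳ xs (fromℕ ∘ f) c)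

  #selected : ℕ
  #selected = # (Selection.mem? selection) ∈ tuples finite k

  relation-sum : ℚ
  relation-sum = ∑[ r ∈ 2 ⋯< k ] ∑-divisors (gcd (suc r) l) (λ u → fromℤ (ws r u) ℚ.*
    (((pow k ℚ.- 1ℚ) ℚ.* (pow k ℚ.- pow 1) ℚ.* (∏[ n ∈ 2 ⋯< (k ∸ 1) ] (pow (m * l) ℚ.- pow (n * l)))) ÷₀ ((pow u ℚ.- 1ℚ) ℚ.* (∏[ n ∈ suc r ⋯< k ] (pow k ℚ.- pow n)))))

  ∈-⋯< : ∀ {r} → r ∈ (2 ⋯< k) → 2 ≤ r × r < k
  ∈-⋯< r∈ with ∈-map⁻ (_+_ 2) r∈
  ... | n , n∈ , refl = ℕ.m≤m+n 2 n , ℕ.≤-trans (ℕ.+-monoʳ-≤ 2 (∈-upTo⁻ n∈)) (ℕ.≤-reflexive (ℕ.m+[n∸m]≡n {2} {k} (ℕ.m≤n+m 2 j)))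

  selected-sum : fromℕ #selected ℚ.* B ≡ relation-sum ℚ.* (E ℚ.* Q-1)
  selected-sum = begin
    fromℕ #selected ℚ.* B
      ≡⟨ cong (λ n → fromℕ n ℚ.* B) #selected≡ ⟩
    fromℕ (sumOver (2 ⋯< k) (λ r → sumOver (divisors (gcd (suc r) l)) (λ u → size-of r u))) ℚ.* B
      ≡⟨ fromℕ-sumOver-* (2 ⋯< k) (λ r → sumOver (divisors (gcd (suc r) l)) (λ u → size-of r u)) B ⟩
    ∑ (2 ⋯< k) (λ r → fromℕ (sumOver (divisors (gcd (suc r) l)) (λ u → size-of r u)) ℚ.* B)
      ≡⟨ ∑-cong∈ (2 ⋯< k) (λ {r} r∈ → per-rank r (proj₁ (∈-⋯< r∈)) (proj₂ (∈-⋯< r∈))) ⟩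
    ∑ (2 ⋯< k) (λ r → ∑-divisors (gcd (suc r) l) (λ u → term r u) ℚ.* (E ℚ.* Q-1))
      ≡⟨ ∑-*ʳ (2 ⋯< k) (λ r → ∑-divisors (gcd (suc r) l) (λ u → term r u)) (E ℚ.* Q-1) ⟨
    relation-sum ℚ.* (E ℚ.* Q-1) ∎
    where
    open ≡-Reasoning
    size-of : ℕ → ℕ → ℕ
    size-of r u = sumOver (chosen r u) (λ b → # (_~? b) ∈ tuples finite k)

    term : ℕ → ℕ → ℚ
    term r u = fromℤ (ws r u) ℚ.*
      (((pow k ℚ.- 1ℚ) ℚ.* (pow k ℚ.- pow 1) ℚ.* (∏[ n ∈ 2 ⋯< (k ∸ 1) ] (pow (m * l) ℚ.- pow (n * l)))) ÷₀ ((pow u ℚ.- 1ℚ) ℚ.* (∏[ n ∈ suc r ⋯< k ] (pow k ℚ.- pow n))))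

    per-rank : ∀ r → 2 ≤ r → r < k → fromℕ (sumOver (divisors (gcd (suc r) l)) (size-of r)) ℚ.* B ≡ ∑-divisors (gcd (suc r) l) (λ u → term r u) ℚ.* (E ℚ.* Q-1)
    per-rank r 2≤r r<k = begin
      fromℕ (sumOver D (size-of r)) ℚ.* B ≡⟨ fromℕ-sumOver-* D (size-of r) B ⟩
      ∑ D (λ u → fromℕ (size-of r u) ℚ.* B) ≡⟨ ∑-cong∈ D (λ {u} u∈ → chosen-sum r 2≤r r<k u {{ℕ.>-nonZero (proj₁ (∈-divisors {gcd (suc r) l} u∈))}} (proj₂ (∈-divisors {gcd (suc r) l} u∈))) ⟩
      ∑ D (λ u → term r u ℚ.* (E ℚ.* Q-1)) ≡⟨ ∑-*ʳ D (term r) (E ℚ.* Q-1) ⟨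
      ∑ D (term r) ℚ.* (E ℚ.* Q-1) ≡⟨ cong (ℚ._* (E ℚ.* Q-1)) (∑-divisors-sum (gcd (suc r) l) (λ u → term r u) (term r) (λ _ _ → refl)) ⟨
      ∑-divisors (gcd (suc r) l) (λ u → term r u) ℚ.* (E ℚ.* Q-1) ∎
      where D = divisors (gcd (suc r) l)

  -- The sum 2 + 3 + ... + (n + 1). In this form the exponent `k C 2 ∸ 1` is distributed over the
  -- factors with index 2, ..., k - 1 in the second summand of λ.
  triangle : ℕ → ℕ
  triangle zero    = 0
  triangle (suc n) = triangle n + (2 + n)

  C-triangle : ∀ n → (n + 2) C 2 ≡ suc (triangle n)
  C-triangle zero    = refl
  C-triangle (suc n) = begin
    suc (n + 2) C 2 ≡⟨ nCk+nC[k+1]≡[n+1]C[k+1] (n + 2) 1 ⟨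
    (n + 2) C 1 + (n + 2) C 2 ≡⟨ cong₂ _+_ (trans (nC1≡n (n + 2)) (ℕ.+-comm n 2)) (C-triangle n) ⟩
    (2 + n) + suc (triangle n) ≡⟨ ℕ.+-comm (2 + n) (suc (triangle n)) ⟩
    suc (triangle (suc n))            ∎
    where open ≡-Reasoning

  independent-term : ℚ
  independent-term = pow ((l ∸ 1) * (k C 2 ∸ 1)) ℚ.* (∏[ n ∈ 2 ⋯< k ] ((pow ((m ∸ n) * l) ℚ.- 1ℚ) ÷₀ (pow (k ∸ n) ℚ.- 1ℚ)))

  -- Factor by factor, with q^k - q^n = q^n (q^(k-n) - 1): the denominators cancel, and q^((l-1) n)
  -- q^n = q^(l n) is left in front of q^((m-n) l) - 1.
  independent-term-E : independent-term ℚ.* E ≡ A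
  independent-term-E = begin
    pow ((l ∸ 1) * (k C 2 ∸ 1)) ℚ.* ∏ (2 ⋯< k) g ℚ.* E
      ≡⟨ cong₂ (λ x y → pow ((l ∸ 1) * x) ℚ.* ∏ (2 ⋯< k) g ℚ.* y) (cong (_∸ 1) (C-triangle j)) E≡ ⟩
    pow ((l ∸ 1) * triangle j) ℚ.* ∏ (2 ⋯< k) g ℚ.* ∏< j (λ n → pow k ℚ.- pow (n + 2))
      ≡⟨ cong₂ (λ x y → x ℚ.* y ℚ.* ∏< j (λ n → pow k ℚ.- pow (n + 2))) (pow-triangle j) (trans (∏-⋯< 2 k g) (cong (λ n → ∏< n (λ n → g (2 + n))) (ℕ.m+n∸n≡m j 2))) ⟩
    ∏< j (λ n → pow ((l ∸ 1) * (2 + n))) ℚ.* ∏< j (λ n → g (2 + n)) ℚ.* ∏< j (λ n → pow k ℚ.- pow (n + 2))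
      ≡⟨ trans (∏-* (upTo j) (λ n → pow ((l ∸ 1) * (2 + n)) ℚ.* g (2 + n)) (λ n → pow k ℚ.- pow (n + 2)))
           (cong (ℚ._* ∏< j (λ n → pow k ℚ.- pow (n + 2))) (∏-* (upTo j) (λ n → pow ((l ∸ 1) * (2 + n))) (λ n → g (2 + n)))) ⟨
    ∏< j (λ n → pow ((l ∸ 1) * (2 + n)) ℚ.* g (2 + n) ℚ.* (pow k ℚ.- pow (n + 2)))
      ≡⟨ ∏<-cong j step ⟩
    ∏< j (λ n → pow (m * l) ℚ.- pow ((n + 2) * l))
      ≡⟨ A≡ ⟨
    A ∎
    where
    open ≡-Reasoning
    g : ℕ → ℚ
    g n = (pow ((m ∸ n) * l) ℚ.- 1ℚ) ÷₀ (pow (k ∸ n) ℚ.- 1ℚ)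

    pow-triangle : ∀ n → pow ((l ∸ 1) * triangle n) ≡ ∏< n (λ n → pow ((l ∸ 1) * (2 + n)))
    pow-triangle zero    = cong pow (ℕ.*-zeroʳ (l ∸ 1))
    pow-triangle (suc n) = trans (cong pow (ℕ.*-distribˡ-+ (l ∸ 1) (triangle n) (2 + n))) (trans (pow-+ ((l ∸ 1) * triangle n) ((l ∸ 1) * (2 + n)))
      (trans (cong (ℚ._* pow ((l ∸ 1) * (2 + n))) (pow-triangle n)) (sym (∏<-suc n (λ n → pow ((l ∸ 1) * (2 + n)))))))

    step : ∀ {n} → n < j → pow ((l ∸ 1) * (2 + n)) ℚ.* g (2 + n) ℚ.* (pow k ℚ.- pow (n + 2)) ≡ pow (m * l) ℚ.- pow ((n + 2) * l)
    step {n} n<j = begin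
      a ℚ.* g (2 + n) ℚ.* (pow k ℚ.- pow (n + 2)) ≡⟨ cong (λ x → a ℚ.* g (2 + n) ℚ.* (pow k ℚ.- pow x)) (ℕ.+-comm n 2) ⟩
      a ℚ.* g (2 + n) ℚ.* (pow k ℚ.- pow (2 + n)) ≡⟨ cong (a ℚ.* g (2 + n) ℚ.*_) (pow-factor (ℕ.<⇒≤ 2+n<k)) ⟩
      a ℚ.* g (2 + n) ℚ.* (b ℚ.* (pow (k ∸ (2 + n)) ℚ.- 1ℚ)) ≡⟨ solve 4 (λ a g b d → a :* g :* (b :* d) := a :* b :* (g :* d)) refl a (g (2 + n)) b (pow (k ∸ (2 + n)) ℚ.- 1ℚ) ⟩
      a ℚ.* b ℚ.* (g (2 + n) ℚ.* (pow (k ∸ (2 + n)) ℚ.- 1ℚ)) ≡⟨ cong₂ ℚ._*_ a-b (÷₀-* (pow ((m ∸ (2 + n)) * l) ℚ.- 1ℚ) (pow-diff-≢0 {0} (ℕ.m<n⇒0<n∸m 2+n<k))) ⟩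
      pow ((2 + n) * l) ℚ.* (pow ((m ∸ (2 + n)) * l) ℚ.- 1ℚ) ≡⟨ cong (λ x → pow ((2 + n) * l) ℚ.* (pow x ℚ.- 1ℚ)) (ℕ.*-distribʳ-∸ l m (2 + n)) ⟩
      pow ((2 + n) * l) ℚ.* (pow (m * l ∸ (2 + n) * l) ℚ.- 1ℚ) ≡⟨ pow-factor (ℕ.*-monoˡ-≤ l 2+n≤m) ⟨
      pow (m * l) ℚ.- pow ((2 + n) * l) ≡⟨ cong (λ x → pow (m * l) ℚ.- pow (x * l)) (ℕ.+-comm 2 n) ⟩
      pow (m * l) ℚ.- pow ((n + 2) * l)                            ∎
      where
      a b : ℚ
      a = pow ((l ∸ 1) * (2 + n))
      b = pow (2 + n)

      2+n<k : 2 + n < k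
      2+n<k = ℕ.≤-trans (ℕ.≤-reflexive (sym (ℕ.+-suc 2 n))) (ℕ.≤-trans (ℕ.+-monoʳ-≤ 2 n<j) (ℕ.≤-reflexive (ℕ.+-comm 2 j)))

      2+n≤m : 2 + n ≤ m
      2+n≤m = ℕ.s≤s⁻¹ (ℕ.≤-trans 2+n<k k≤m+1)

      a-b : a ℚ.* b ≡ pow ((2 + n) * l)
      a-b = trans (sym (pow-+ ((l ∸ 1) * (2 + n)) (2 + n))) (cong pow (begin
        (l ∸ 1) * (2 + n) + (2 + n) ≡⟨ ℕ.+-comm ((l ∸ 1) * (2 + n)) (2 + n) ⟩
        suc (l ∸ 1) * (2 + n) ≡⟨ cong (_* (2 + n)) (trans (ℕ.+-comm 1 (l ∸ 1)) (ℕ.m∸n+n≡m 0<l)) ⟩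
        l * (2 + n) ≡⟨ ℕ.*-comm l (2 + n) ⟩
        (2 + n) * l                     ∎))

  ⟦w≡1⟧ : ∀ {w} → w ≤ 1 → fromℕ w ≡ fromℕ ⟦ w ℕ.≟ 1 ⟧
  ⟦w≡1⟧ {zero}        _        = refl
  ⟦w≡1⟧ {suc zero}    _        = refl
  ⟦w≡1⟧ {suc (suc _)} (s≤s ())

  -- The hypothesis is the count of good tuples through a pair; cancelling E (Q - 1) yields the
  -- formula for λ. The indicator of w = 1 equals w because w is 0 or 1.
  multiplicity≡ : ∀ {N} → N * extensions q k 2 j * (Q ∸ 1) ≡ ⟦ w ℕ.≟ 1 ⟧ * extensions Q m 2 j * (Q ∸ 1) + #selected * extensions Q m 2 i →
                  fromℕ N ≡ multiplicity q m l k w ws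
  multiplicity≡ {N} eq = ℚ-*-cancelʳ (ℚ-*-≢0 E≢0 Q-1≢0) (begin
    fromℕ N ℚ.* (E ℚ.* Q-1)
      ≡⟨ trans (fromℕ-* (N * extensions q k 2 j) (Q ∸ 1)) (trans (cong (ℚ._* Q-1) (fromℕ-* N (extensions q k 2 j))) (ℚ.*-assoc (fromℕ N) E Q-1)) ⟨
    fromℕ (N * extensions q k 2 j * (Q ∸ 1))
      ≡⟨ cong fromℕ eq ⟩
    fromℕ (⟦ w ℕ.≟ 1 ⟧ * extensions Q m 2 j * (Q ∸ 1) + #selected * extensions Q m 2 i)
      ≡⟨ trans (fromℕ-+ (⟦ w ℕ.≟ 1 ⟧ * extensions Q m 2 j * (Q ∸ 1)) (#selected * extensions Q m 2 i))
           (cong₂ ℚ._+_ (trans (fromℕ-* (⟦ w ℕ.≟ 1 ⟧ * extensions Q m 2 j) (Q ∸ 1)) (cong (ℚ._* Q-1) (fromℕ-* ⟦ w ℕ.≟ 1 ⟧ (extensions Q m 2 j)))) (fromℕ-* #selected (extensions Q m 2 i))) ⟩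
    fromℕ ⟦ w ℕ.≟ 1 ⟧ ℚ.* A ℚ.* Q-1 ℚ.+ fromℕ #selected ℚ.* B
      ≡⟨ cong₂ ℚ._+_ (cong₂ (λ x y → x ℚ.* y ℚ.* Q-1) (sym (⟦w≡1⟧ w≤1)) (sym independent-term-E)) selected-sum ⟩
    fromℕ w ℚ.* (independent-term ℚ.* E) ℚ.* Q-1 ℚ.+ relation-sum ℚ.* (E ℚ.* Q-1)
      ≡⟨ solve 6 (λ w p x E Q R → w :* (p :* x :* E) :* Q :+ R :* (E :* Q) := (R :+ w :* p :* x) :* (E :* Q)) refl
           (fromℕ w) (pow ((l ∸ 1) * (k C 2 ∸ 1))) (∏[ n ∈ 2 ⋯< k ] ((pow ((m ∸ n) * l) ℚ.- 1ℚ) ÷₀ (pow (k ∸ n) ℚ.- 1ℚ))) E Q-1 relation-sum ⟩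
    multiplicity q m l k w ws ℚ.* (E ℚ.* Q-1) ∎)
    where open ≡-Reasoning

-- The design

exactly-map : ∀ {a p r} {A : Set a} {B : Set} {P : Pred A p} {R : Pred B r} (R? : Decidable R) (f : B → A) →
              (∀ b → R b → P (f b)) → (∀ b → P (f b) → R b) → ∀ bs → Exactly P (# R? ∈ bs) (map f bs)
exactly-map R? f to from []       = []
exactly-map R? f to from (b ∷ bs) with R? b
... | yes r = hit (to b r) (exactly-map R? f to from bs)
... | no ¬r = miss (¬r ∘ from b) (exactly-map R? f to from bs)

tabulate-VAll : ∀ {n} {A : Set} {P : Pred A 0ℓ} {f : Fin n → A} → (∀ i → P (f i)) → VAll P (Vec.tabulate f)
tabulate-VAll {zero}  p = []
tabulate-VAll {suc n} p = p zero ∷ tabulate-VAll (p ∘ suc)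

VAll-lookup : ∀ {n} {A : Set} {P : Pred A 0ℓ} {xs : Vec A n} → VAll P xs → ∀ i → P (Vec.lookup xs i)
VAll-lookup (p ∷ ps) zero    = p
VAll-lookup (p ∷ ps) (suc i) = VAll-lookup ps i

module Design {q l : ℕ} {F : FiniteField q} {L : FiniteField (q ^ l)} (φ : F ↪ L) (m : ℕ) (0<l : 0 < l)
              (i : ℕ) (S : Selection {q} {l} φ (suc i + 2)) {W : Set} (W? : Dec W) where
  open FiniteField L
  open FieldTheory L hiding (_⊖_)
  open Extension {q} {l} φ
  open LinearRelations L using (IsLinear; module Relations)
  open BlockCount {q} {l} φ (spaceModule L m) i S W?
  open Linear (spaceModule L m)
  open Relations (spaceModule L m) using (coef)
  private
    module F  = FiniteField F
    module FT = FieldTheory F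
  open _↪_ φ renaming (⟦_⟧ to φ⟦_⟧)

  U : LeftModule (FiniteField.ring F) 0ℓ 0ℓ
  U = restrict φ (space L m)

  coefficients : ∀ {n} {c : Vec Carrier n} → FO.Coef c → Σ[ a ∈ (Fin n → F.Carrier) ] Vec.tabulate (φ⟦_⟧ ∘ a) ≡ c
  coefficients {zero}  []                 = (λ ()) , refl
  coefficients {suc n} ((a₀ , refl) ∷ ms) = let a , e = coefficients ms in (λ { zero → a₀ ; (suc i) → a i }) , cong (φ⟦ a₀ ⟧ ∷_) e

  lc-tabulate : ∀ {n} (a : Fin n → F.Carrier) b → linearCombination U a b ≡ lc (Vec.tabulate (φ⟦_⟧ ∘ a)) (Vec.tabulate b)
  lc-tabulate {zero}  a b = refl
  lc-tabulate {suc n} a b = cong (φ⟦ a zero ⟧ *ₗ b zero +ᴹ_) (lc-tabulate (a ∘ suc) (b ∘ suc))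

  fromHasDim : ∀ {X n} → HasDim U X n → FO.Basis (Subspace.carrier X) n
  fromHasDim {X} {n} (b , B) = record
    { vectors     = Vec.tabulate b
    ; independent = FO.coef-zero⇒ind (Vec.tabulate b) λ ms e → zero-coef ms e (coefficients ms)
    ; members     = tabulate-VAll member
    ; spanning    = λ y∈ → let a , e = spanning y∈ in Vec.tabulate (φ⟦_⟧ ∘ a) , tabulate-VAll (λ i → a i , refl) , trans (sym (lc-tabulate a b)) (sym e)
    }
    where
    open IsBasis B
    zeros : ∀ {n} {a : Fin n → F.Carrier} → (∀ i → a i ≡ F.𝟘) → Vec.tabulate (φ⟦_⟧ ∘ a) ≡ Vec.replicate n 𝟘
    zeros {zero}  h = refl
    zeros {suc n} h = cong₂ _∷_ (trans (cong φ⟦_⟧ (h zero)) (proj₂ Base.𝟘-closed)) (zeros (h ∘ suc))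

    zero-coef : ∀ {c} → FO.Coef c → lc c (Vec.tabulate b) ≡ 0ᴹ → Σ[ a ∈ (Fin n → F.Carrier) ] Vec.tabulate (φ⟦_⟧ ∘ a) ≡ c → c ≡ Vec.replicate n 𝟘
    zero-coef ms e (a , refl) = zeros (independent a (trans (lc-tabulate a b) e))

  toHasDim : ∀ {P : Pred Carrierᴹ 0ℓ} {X n} → FO.Basis P n → (∀ {y} → P y → Subspace.carrier X y) → (∀ {y} → Subspace.carrier X y → P y) → HasDim U X n
  toHasDim {X = X} {n} B to from = Vec.lookup vectors , record
    { member      = λ i → to (VAll-lookup members i)
    ; independent = λ a e i → φ-injective (trans (nth a (FO.coef-zero independent (tabulate-VAll (λ i → a i , refl)) (trans (sym (lc-vectors a)) e)) i) (sym (proj₂ Base.𝟘-closed)))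
    ; spanning    = λ y∈ → combination (spanning (from y∈))
    }
    where
    open FO.Basis B
    lc-vectors : ∀ a → linearCombination U a (Vec.lookup vectors) ≡ lc (Vec.tabulate (φ⟦_⟧ ∘ a)) vectors
    lc-vectors a = trans (lc-tabulate a (Vec.lookup vectors)) (cong (lc (Vec.tabulate (φ⟦_⟧ ∘ a))) (Vec.tabulate∘lookup vectors))

    nth : ∀ {n} (a : Fin n → F.Carrier) → Vec.tabulate (φ⟦_⟧ ∘ a) ≡ Vec.replicate n 𝟘 → ∀ i → φ⟦ a i ⟧ ≡ 𝟘
    nth a e zero    = Vec.∷-injectiveˡ e
    nth a e (suc i) = nth (a ∘ suc) (Vec.∷-injectiveʳ e) i

    combination : ∀ {y} → FO.Span vectors y → ∃[ a ] y ≡ linearCombination U a (Vec.lookup vectors)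
    combination (c , ms , refl) = let a , e = coefficients ms in a , sym (trans (lc-vectors a) (cong (λ c → lc c vectors) e))

  spanSubspace : Vec Carrierᴹ k → Subspace U
  spanSubspace b = record
    { carrier  = FO.Span b
    ; resp     = subst (FO.Span b)
    ; 0-closed = has-0
    ; +-closed = has-+
    ; *-closed = λ a → has-* (a , refl)
    }
    where open FO.IsSubspace (FO.span-isSubspace b)

  subspace-isSubspace : (X : Subspace U) → FO.IsSubspace (Subspace.carrier X)
  subspace-isSubspace X = record { has-0 = X.0-closed ; has-+ = X.+-closed ; has-* = λ { (a , refl) → X.*-closed a } }
    where module X = Subspace X

  Line : Carrierᴹ → Pred Carrierᴹ 0ℓ
  Line v = LO.Span (v ∷ [])

  line-lc : ∀ e v → lc (e ∷ []) (v ∷ []) ≡ e *ₗ v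
  line-lc e v = +ᴹ-identityʳ (e *ₗ v)

  line⊆ : ∀ {v x} → Line v x → ∀ {y} → Line x y → Line v y
  line⊆ s = LO.span-mono (s ∷ [])

  line-sym : ∀ {v x} → x ≢ 0ᴹ → Line v x → Line x v
  line-sym {v} {x} x≢0 (e ∷ [] , _ , eq) = by-cases (e ≟ 𝟘)
    where
    ev≡x : e *ₗ v ≡ x
    ev≡x = trans (sym (line-lc e v)) eq

    by-cases : Dec (e ≡ 𝟘) → Line x v
    by-cases (yes refl) = contradiction (trans (sym ev≡x) (*ₗ-zeroˡ v)) x≢0
    by-cases (no e≢0)   = let d , de = inverse e e≢0 in
      d ∷ [] , coef (d ∷ []) , trans (line-lc d x) (trans (cong (d *ₗ_) (sym ev≡x)) (unscale v de))

  lineSubspace : Carrierᴹ → Subspace (space L m)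
  lineSubspace v = record
    { carrier  = Line v
    ; resp     = subst (Line v)
    ; 0-closed = has-0
    ; +-closed = has-+
    ; *-closed = λ a → has-* tt
    }
    where open LO.IsSubspace (LO.span-isSubspace (v ∷ []))

  _≐′_ : Pred Carrierᴹ 0ℓ → Pred Carrierᴹ 0ℓ → Set
  P ≐′ R = ∀ y → (P y → R y) × (R y → P y)

  group⇒line : ∀ {X} → Desarguesian φ m X → ∃[ v ] v ≢ 0ᴹ × Subspace.carrier X ≐′ Line v
  group⇒line {X} (Y , (b , B) , X⊆Y , Y⊆X) = b zero ,
    (λ v≡0 → 𝟙≢𝟘 (IsBasis.independent B (λ _ → 𝟙) (trans (line-lc 𝟙 (b zero)) (trans (cong (𝟙 *ₗ_) v≡0) (*ₗ-zeroʳ 𝟙))) zero)) ,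
    λ y → (λ y∈ → let a , e = IsBasis.spanning B (X⊆Y y∈) in a zero ∷ [] , coef (a zero ∷ []) , sym e) ,
          (λ { (e ∷ [] , _ , refl) → Y⊆X (Subspace.+-closed Y (Subspace.*-closed Y e (IsBasis.member B zero)) (Subspace.0-closed Y)) })

  line⇒group : ∀ {X v} → v ≢ 0ᴹ → Subspace.carrier X ≐′ Line v → Desarguesian φ m X
  line⇒group {X} {v} v≢0 h = lineSubspace v , ((λ _ → v) , record
    { member      = λ _ → LO.span-here
    ; independent = λ { a e zero → by-cases (a zero ≟ 𝟘) (trans (sym (line-lc (a zero) v)) e) }
    ; spanning    = λ { (e ∷ [] , _ , eq) → (λ _ → e) , sym eq }
    }) , (λ {y} → proj₁ (h y)) , (λ {y} → proj₂ (h y))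
    where
    by-cases : ∀ {a} → Dec (a ≡ 𝟘) → a *ₗ v ≡ 0ᴹ → a ≡ 𝟘
    by-cases (yes a≡0) _ = a≡0
    by-cases (no a≢0)  e = contradiction (*ₗ≡0 a≢0 e) v≢0

  ind⇒≢0 : ∀ {v} → FO.Ind (v ∷ []) → v ≢ 0ᴹ
  ind⇒≢0 (v∉ , _) refl = v∉ (FO.IsSubspace.has-0 (FO.span-isSubspace []))

  ≢0⇒L-ind : ∀ {v} → v ≢ 0ᴹ → LO.Ind (v ∷ [])
  ≢0⇒L-ind v≢0 = (λ { ([] , _ , e) → v≢0 (sym e) }) , tt

  L-sub⇒F-sub : ∀ {P} → LO.IsSubspace P → FO.IsSubspace P
  L-sub⇒F-sub sub = record { has-0 = has-0 ; has-+ = has-+ ; has-* = λ _ → has-* tt }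
    where open LO.IsSubspace sub

  -- A basis over GF(q) exists, and its length is read off from the number of elements.
  hasDim-count : ∀ {P : Pred Carrierᴹ 0ℓ} (P? : Decidable P) (X : Subspace U) {d} → Subspace.carrier X ≐′ P → V.count P? ≡ q ^ d → HasDim U X d
  hasDim-count {P} P? X {d} h size = subst (HasDim U X) (q^-cancel (trans (trans (cong (_^ n) (sym base-card)) (sym (FO.basis-card P? sub B))) size))
      (toHasDim B (λ {y} → proj₂ (h y)) (λ {y} → proj₁ (h y)))
    where
    sub : FO.IsSubspace P
    sub = record
      { has-0 = proj₁ (h _) has-0 ; has-+ = λ p r → proj₁ (h _) (has-+ (proj₂ (h _) p) (proj₂ (h _) r)) ; has-* = λ m p → proj₁ (h _) (has-* m (proj₂ (h _) p)) }
      where open FO.IsSubspace (subspace-isSubspace X)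
    n = proj₁ (FO.basis P? sub)
    B = proj₂ (FO.basis P? sub)

  blocks : List (Subspace U)
  blocks = map spanSubspace blockTuples

  -- Two independent vectors of a block extend to a basis of it, which is again good.
  block-pair-ind : ∀ {b t} → b ∈ blockTuples → FO.Ind t → VAll (FO.Span b) t → LO.Ind t
  block-pair-ind {b} {t} b∈ t-ind t⊆b = good-suffix (proj₁ prefix) t (good-basechange b-ind (proj₁ extended) b⊆ xst⊆ b-good)
    where
    b-good = blockTuples-good b∈
    b-ind  = good⇒F-ind b-good
    dim    = FO.card-span b-ind
    extends? = FO.extends? (FO.span? b) (FO.span-isSubspace b) {k} dim {2} {j} t

    extensions>0 : ∀ n → n + 2 ≤ k → 0 < extensions Base.card k 2 n
    extensions>0 zero    _  = z<s
    extensions>0 (suc n) le = ℕ.*-mono-< (extensions>0 n (ℕ.<⇒≤ le)) (ℕ.m<n⇒0<n∸m (ℕ.^-monoʳ-< Base.card Base.1<card le))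

    witness : ∃[ xs ] xs ∈ tuples finiteᴹ j × (FO.Ind (xs Vec.++ t) × VAll (FO.Span b) xs)
    witness = #-witness extends? (tuples finiteᴹ j) (subst (0 <_)
      (sym (FO.#-extensions (FO.span? b) (FO.span-isSubspace b) {k} dim t-ind t⊆b j)) (extensions>0 j ℕ.≤-refl))

    prefix : ∃[ xs ] FO.Ind (xs Vec.++ t) × VAll (FO.Span b) xs
    prefix = let xs , _ , r = witness in xs , r

    extended = proj₂ prefix

    join : ∀ {n} {xs : Vec Carrierᴹ n} → VAll (FO.Span b) xs → VAll (FO.Span b) (xs Vec.++ t)
    join []       = t⊆b
    join (p ∷ ps) = p ∷ join ps

    xst⊆ : VAll (FO.Span b) (proj₁ prefix Vec.++ t)
    xst⊆ = join (proj₂ extended)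

    b⊆ : VAll (FO.Span (proj₁ prefix Vec.++ t)) b
    b⊆ = VAll.map (FO.independent-spans (FO.span? b) (FO.span-isSubspace b) (proj₁ extended) xst⊆ dim) (FO.span-members b)

  -- Two vectors of the intersection independent over GF(q) would, lying in a block, be independent
  -- over GF(q^l), which is impossible on a line over GF(q^l).
  block∩line : ∀ {b} → b ∈ blockTuples → ∀ {X} → Desarguesian φ m X → ∃[ d ] d ≤ 1 × HasDim U (spanSubspace b ∩ₛ X) d
  block∩line {b} b∈ {X} X∈ with group⇒line {X} X∈
  ... | v , v≢0 , h = at-most-one (FO.basis P? sub)
    where
    P? : Decidable (λ y → FO.Span b y × Line v y)
    P? y = FO.span? b y ×-dec LO.span? (v ∷ []) y

    sub : FO.IsSubspace (λ y → FO.Span b y × Line v y)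
    sub = record
      { has-0 = SB.has-0 , SL.has-0 ; has-+ = λ (p , r) (p′ , r′) → SB.has-+ p p′ , SL.has-+ r r′ ; has-* = λ m (p , r) → SB.has-* m p , SL.has-* tt r }
      where
      module SB = FO.IsSubspace (FO.span-isSubspace b)
      module SL = LO.IsSubspace (LO.span-isSubspace (v ∷ []))

    hasDim : ∀ {d} → FO.Basis (λ y → FO.Span b y × Line v y) d → HasDim U (spanSubspace b ∩ₛ X) d
    hasDim B = toHasDim B (λ {y} (p , r) → p , proj₂ (h y) r) (λ {y} (p , r) → p , proj₁ (h y) r)

    at-most-one : ∃ (FO.Basis (λ y → FO.Span b y × Line v y)) → ∃[ d ] d ≤ 1 × HasDim U (spanSubspace b ∩ₛ X) d
    at-most-one (zero        , B) = 0 , z≤n , hasDim B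
    at-most-one (suc zero    , B) = 1 , s≤s z≤n , hasDim B
    at-most-one (suc (suc d) , B) = contradict vectors independent members
      where
      open FO.Basis B
      contradict : (xs : Vec Carrierᴹ (suc (suc d))) → FO.Ind xs → VAll (λ y → FO.Span b y × Line v y) xs → _
      contradict (x ∷ y ∷ zs) (x∉ , y∉ , _) ((x∈b , x∈v) ∷ (y∈b , y∈v) ∷ _) =
        contradiction (line⊆ (line-sym (ind⇒≢0 y-ind) y∈v) x∈v)
          (proj₁ (block-pair-ind {t = x ∷ y ∷ []} b∈ (x∉ ∘ FO.span-mono (FO.span-here ∷ []) , y-ind) (x∈b ∷ y∈b ∷ [])))
        where
        y-ind : FO.Ind (y ∷ [])
        y-ind = y∉ ∘ FO.span-mono [] , tt

  module _ {Λ : ℕ} (#containing≡Λ : ∀ {t} → LO.Ind t → # contains? t ∈ blockTuples ≡ Λ) where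

    -- A basis x, y of T is independent over GF(q^l): otherwise x would lie on the line of y, a
    -- group containing T. So the count of blocks through an independent pair applies.
    balanced-blocks : ∀ T → HasDim U T 2 → (∀ {X} → Desarguesian φ m X → ¬ (T ⊆ₛ X)) → Exactly (λ B → T ⊆ₛ B) Λ blocks
    balanced-blocks T T-dim avoids = through (fromHasDim {T} T-dim)
      where
      through : FO.Basis (Subspace.carrier T) 2 → Exactly (λ B → T ⊆ₛ B) Λ blocks
      through record { vectors = x ∷ y ∷ [] ; independent = ind ; members = mem ; spanning = sp } =
        subst (λ n → Exactly (λ B → T ⊆ₛ B) n blocks) (#containing≡Λ L-ind)
          (exactly-map {P = λ B → T ⊆ₛ B} (contains? (x ∷ y ∷ [])) spanSubspace (λ b t⊆b {z} z∈ → FO.span-mono t⊆b (sp z∈)) (λ b T⊆b → VAll.map (λ z∈ → T⊆b z∈) mem) blockTuples)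
        where
        y≢0 : y ≢ 0ᴹ
        y≢0 = ind⇒≢0 (proj₂ ind)

        L-ind : LO.Ind (x ∷ y ∷ [])
        L-ind = (λ x∈y → avoids {restrictSubspace φ (lineSubspace y)} (line⇒group {restrictSubspace φ (lineSubspace y)} y≢0 (λ _ → id , id))
                  (λ z∈ → FO.span-least (L-sub⇒F-sub (LO.span-isSubspace (y ∷ []))) (x∈y ∷ LO.span-here ∷ []) (sp z∈))) , ≢0⇒L-ind y≢0

    isGDD : IsGDD {F = F} {V = U} (m * l) l k Λ (Desarguesian φ m) blocks
    isGDD = record
      { dim-V           = hasDim-count (λ _ → yes tt) (whole U) (λ _ → id , id)
                            (trans (#-all (λ _ → yes tt) V.elems (λ _ → tt)) (trans (length-tuples finite m) (trans (cong (_^ m) size≡) (trans (ℕ.^-*-assoc q l m) (cong (q ^_) (ℕ.*-comm l m))))))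
      ; groups-resp     = λ (X⊆Y , Y⊆X) (Z , dim , X⊆Z , Z⊆X) → Z , dim , (λ y∈ → X⊆Z (Y⊆X y∈)) , (λ z∈ → X⊆Y (Z⊆X z∈))
      ; groups-dim      = λ {X} X∈ → let v , v≢0 , h = group⇒line {X} X∈ in
                            hasDim-count (LO.span? (v ∷ [])) X h (trans (LO.card-span (≢0⇒L-ind v≢0)) (trans (ℕ.*-identityʳ _) (whole-card L)))
      ; groups-cover    = λ P P-dim → cover P (fromHasDim {P} P-dim)
      ; groups-disjoint = λ P P-dim {X} {Y} X∈ Y∈ → disjoint P (fromHasDim {P} P-dim) {X} {Y} X∈ Y∈
      ; blocks-dim      = All.map⁺ (All.tabulate (λ {b} b∈ → let ind = good⇒F-ind (blockTuples-good b∈) in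
                            toHasDim {X = spanSubspace b} (record { vectors = b ; independent = ind ; members = FO.span-members b ; spanning = id }) id id))
      ; block∩group     = All.map⁺ (All.tabulate (λ b∈ {X} → block∩line b∈ {X}))
      ; balanced        = balanced-blocks
      }
      where
      cover : ∀ P → FO.Basis (Subspace.carrier P) 1 → ∃[ X ] Desarguesian φ m X × P ⊆ₛ X
      cover P record { vectors = v ∷ [] ; independent = ind ; spanning = sp } =
        restrictSubspace φ (lineSubspace v) , line⇒group {restrictSubspace φ (lineSubspace v)} (ind⇒≢0 ind) (λ _ → id , id) ,
        λ z∈ → FO.span-least (L-sub⇒F-sub (LO.span-isSubspace (v ∷ []))) (LO.span-here ∷ []) (sp z∈)

      disjoint : ∀ P → FO.Basis (Subspace.carrier P) 1 → ∀ {X Y} → Desarguesian φ m X → Desarguesian φ m Y → P ⊆ₛ X → P ⊆ₛ Y → X ≐ₛ Y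
      disjoint P record { vectors = v ∷ [] ; independent = ind ; members = v∈ ∷ [] } {X} {Y} X∈ Y∈ P⊆X P⊆Y with group⇒line {X} X∈ | group⇒line {Y} Y∈
      ... | x , _ , hx | y , _ , hy =
        (λ {z} z∈ → proj₂ (hy z) (line⊆ (proj₁ (hy v) (P⊆Y v∈)) (line⊆ (line-sym v≢0 (proj₁ (hx v) (P⊆X v∈))) (proj₁ (hx z) z∈)))) ,
        (λ {z} z∈ → proj₂ (hx z) (line⊆ (proj₁ (hx v) (P⊆X v∈)) (line⊆ (line-sym v≢0 (proj₁ (hy v) (P⊆Y v∈))) (proj₁ (hy z) z∈))))
        where v≢0 = ind⇒≢0 ind

  isSimple : IsSimple {F = F} blocks
  isSimple = AllPairs.map⁺ (AllPairs.map (λ {b} {b′} b≉b′ (b⊆b′ , b′⊆b) → b≉b′ (VAll.map b⊆b′ (FO.span-members b) , VAll.map b′⊆b (FO.span-members b′))) (Reps.reps-inequivalent _))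

  -- Invariance under GL(m, q^l)

  module Automorphism (g : GL U) (g∈ : GeneralLinear φ m g) where
    open import Algebra.Module.Morphism.Structures using (module LeftModuleMorphisms)
    private
      module g = GL g
      module gL = LeftModuleMorphisms.IsLeftModuleIsomorphism g∈

    linear : IsLinear (spaceModule L m) (spaceModule L m) g.apply
    linear = record { map-+ = gL.+ᴹ-homo ; map-* = gL.*ₗ-homo }
    open IsLinear linear using (map-0; map-*)

    preserves-group : ∀ X → Desarguesian φ m X ⇔ Desarguesian φ m (image g X)
    preserves-group X = mk⇔ forth back
      where
      forth : Desarguesian φ m X → Desarguesian φ m (image g X)
      forth X∈ with group⇒line {X} X∈
      ... | v , v≢0 , h = line⇒group {image g X} {g.apply v} (λ gv≡0 → v≢0 (gL.injective (trans gv≡0 (sym map-0)))) λ y →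
        (λ { (x , x∈ , refl) → to-line (proj₁ (h x) x∈) }) , λ { (e ∷ [] , _ , refl) → e *ₗ v , proj₂ (h _) (e ∷ [] , coef (e ∷ []) , line-lc e v) , trans (line-lc e _) (sym (map-* e v)) }
        where
        to-line : ∀ {x} → Line v x → Line (g.apply v) (g.apply x)
        to-line (e ∷ [] , _ , refl) = e ∷ [] , coef (e ∷ []) , trans (line-lc e _) (trans (sym (map-* e v)) (cong g.apply (sym (line-lc e v))))

      back : Desarguesian φ m (image g X) → Desarguesian φ m X
      back gX∈ with group⇒line {image g X} gX∈
      ... | v , v≢0 , h with proj₂ (h v) LO.span-here
      ... | u , u∈ , refl = line⇒group {X} {u} (λ { refl → v≢0 map-0 }) λ y →
        (λ y∈ → from-line (proj₁ (h (g.apply y)) (y , y∈ , refl))) , λ { (e ∷ [] , _ , refl) → multiple e (proj₂ (h _) (e ∷ [] , coef (e ∷ []) , line-lc e (g.apply u))) }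
        where
        from-line : ∀ {y} → Line (g.apply u) (g.apply y) → Line u y
        from-line (e ∷ [] , _ , eq) = e ∷ [] , coef (e ∷ []) , trans (line-lc e u) (gL.injective (trans (map-* e u) (trans (sym (line-lc e _)) eq)))

        multiple : ∀ e → ∃[ x ] Subspace.carrier X x × e *ₗ g.apply u ≡ g.apply x → Subspace.carrier X (lc (e ∷ []) (u ∷ []))
        multiple e (x , x∈ , eq) = subst (Subspace.carrier X) (trans (gL.injective (trans (sym eq) (sym (map-* e u)))) (sym (line-lc e u))) x∈

    image-span : ∀ b → image g (spanSubspace b) ≐ₛ spanSubspace (Vec.map g.apply b)
    image-span b = (λ { (x , (c , m , refl) , refl) → c , m , IsLinear.lc-map linear c b }) ,
                   (λ { (c , m , refl) → lc c b , (c , m , refl) , IsLinear.lc-map linear c b })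

    private
      ⊆-image : ∀ {X Y} → image g X ⊆ₛ image g Y → X ⊆ₛ Y
      ⊆-image {X} {Y} sub {x} x∈ = let y , y∈ , e = sub (x , x∈ , refl) in subst (Subspace.carrier Y) (sym (gL.injective e)) y∈

    -- By `good-map` and `image-span` the image of a block is a block; `image g` is injective on
    -- subspaces, so the list of images is a rearrangement of the list of blocks.
    preserves-blocks : Permutation._↭_ (subspaceSetoid U) (map (image g) blocks) blocks
    preserves-blocks = unique-⊆⇒↭ (subspaceSetoid U)
      (AllPairs.map⁺ (AllPairs.map (λ {X} {Y} X≢Y (p , r) → X≢Y (⊆-image {X} {Y} p , ⊆-image {Y} {X} r)) isSimple))
      sub (ℕ.≤-reflexive (sym (List.length-map (image g) blocks)))
      where
      sub : ∀ {X} → X ∈ map (image g) blocks → Membership._∈_ (subspaceSetoid U) X blocks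
      sub X∈ with ∈-map⁻ (image g) X∈
      ... | Y , Y∈ , refl with ∈-map⁻ spanSubspace Y∈
      ... | b , b∈ , refl with blockTuples-cover (good-map linear gL.injective (blockTuples-good b∈))
      ... | b′ , b′∈ , gb⊆b′ , b′⊆gb = Any.map⁺ (lose b′∈
        ((λ y∈ → FO.span-mono gb⊆b′ (proj₁ (image-span b) y∈)) , (λ y∈ → proj₂ (image-span b) (FO.span-mono b′⊆gb y∈))))

  admits : AdmitsAutomorphisms {F = F} (GeneralLinear φ m) (Desarguesian φ m) blocks
  admits = record
    { preserves-groups = λ {g} g∈ → Automorphism.preserves-group g g∈
    ; preserves-blocks = λ {g} g∈ → Automorphism.preserves-blocks g g∈
    }

-- λ is taken to be the number of blocks through one sample pair `t₀`. The right side of `equation`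
-- does not involve the pair, so all pairs independent over GF(q^l) lie in the same number of
-- blocks.
design : (q m l i : ℕ) → 0 < l → suc i + 2 ≤ (m + 1) ⊓ l →
         (F : FiniteField q) (L : FiniteField (q ^ l)) (φ : F ↪ L) →
         (w : ℕ) → w ≤ 1 → (ws : ℕ → ℕ → ℤ) →
         (∀ r u → .{{_ : NonZero u}} → 2 ≤ r → r < suc i + 2 → u ∣ gcd (suc r) l →
           0ℤ ℤ.≤ ws r u × fromℤ (ws r u) ℚ.≤ orbitNumber q l (suc r) u) →
         Σ[ Λ ∈ ℕ ] fromℕ Λ ≡ multiplicity q m l (suc i + 2) w ws ×
           (Σ[ ℬ ∈ List (Subspace (restrict φ (space L m))) ]
             IsGDD {F = F} (m * l) l (suc i + 2) Λ (Desarguesian φ m) ℬ ×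
             IsSimple {F = F} ℬ ×
             AdmitsAutomorphisms {F = F} (GeneralLinear φ m) (Desarguesian φ m) ℬ)
design q m l i 0<l k≤ F L φ w w≤1 ws ws-bound =
  # contains? t₀ ∈ blockTuples , Mult.multiplicity≡ {# contains? t₀ ∈ blockTuples} (equation t₀-ind) , GDD.blocks , GDD.isGDD #containing≡ , GDD.isSimple , GDD.admits
  where
  k≤m+1 : suc i + 2 ≤ suc m
  k≤m+1 = ℕ.≤-trans k≤ (ℕ.≤-trans (ℕ.m⊓n≤m (m + 1) l) (ℕ.≤-reflexive (ℕ.+-comm m 1)))

  module Ext = Extension {q} {l} φ
  module Mult = Multiplicity {q} {l} φ m i w 0<l w≤1 k≤m+1 (ℕ.≤-trans k≤ (ℕ.m⊓n≤n (m + 1) l)) ws ws-bound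
  open ClassSelection {q} {l} φ (suc i + 2) (λ r u → ℤ.∣ ws r u ∣) using (selection)
  open BlockCount {q} {l} φ (spaceModule L m) i selection (w ℕ.≟ 1)
  module GDD = Design {q} {l} φ m 0<l i selection (w ℕ.≟ 1)
  open FinModule (spaceModule L m) using (Carrierᴹ; finiteᴹ)

  Q = q ^ l

  1<Q : 1 < Q
  1<Q = ℕ.^-monoʳ-< q Ext.1<q 0<l

  dim : Finite.size finiteᴹ ≡ Q ^ m
  dim = trans (length-tuples (FieldTheory.finite L) m) (cong (_^ m) (FieldTheory.size≡ L))

  equation : ∀ {t} → LO.Ind t → # contains? t ∈ blockTuples * extensions q (suc i + 2) 2 (suc i) * (Q ∸ 1) ≡
             ⟦ w ℕ.≟ 1 ⟧ * extensions Q m 2 (suc i) * (Q ∸ 1) + #selected * extensions Q m 2 i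
  equation {t} ind = trans (cong (_* (Q ∸ 1)) (#containing ind)) (#good≡ {m} dim ind)

  -- An independent pair exists because 3 ≤ k ≤ m + 1 gives m ≥ 2.
  pair : ∃[ t ] t ∈ tuples finiteᴹ 2 × LO.Ind (t Vec.++ [])
  pair = #-witness (λ t → LO.ind? (t Vec.++ [])) (tuples finiteᴹ 2)
    (subst (0 <_) (sym (LinearRelations.Relations.#-ind-extensions L (spaceModule L m) {m} dim [] tt 2))
      (ℕ.*-mono-< (ℕ.*-mono-< {0} {1} z<s (grow (ℕ.<-trans z<s 2≤m))) (grow 2≤m)))
    where
    2≤m : 1 < m
    2≤m = ℕ.s≤s⁻¹ (ℕ.≤-trans (ℕ.m≤n+m 3 i) (ℕ.≤-trans (ℕ.≤-reflexive (ℕ.+-suc i 2)) k≤m+1))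

    grow : ∀ {n} → n < m → 0 < Q ^ m ∸ Q ^ (n + 0)
    grow {n} n<m = ℕ.m<n⇒0<n∸m (ℕ.^-monoʳ-< Q 1<Q (ℕ.≤-trans (ℕ.≤-reflexive (cong suc (ℕ.+-identityʳ n))) n<m))

  t₀ : Vec Carrierᴹ 2
  t₀ = proj₁ pair

  t₀-ind : LO.Ind t₀
  t₀-ind = LO.ind-++[]⁻ t₀ (proj₂ (proj₂ pair))

  #containing≡ : ∀ {t} → LO.Ind t → # contains? t ∈ blockTuples ≡ # contains? t₀ ∈ blockTuples
  #containing≡ {t} ind = ℕ.*-cancelʳ-≡ _ _ (extensions q (suc i + 2) 2 (suc i)) {{ℕ.≢-nonZero (λ e → Mult.E≢0 (cong fromℕ e))}}
    (ℕ.*-cancelʳ-≡ _ _ (Q ∸ 1) {{ℕ.>-nonZero (ℕ.m<n⇒0<n∸m 1<Q)}} (trans (equation ind) (sym (equation t₀-ind))))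

theorem5p1 : (q m l k : ℕ) → IsPrimePower q → 0 < m → 0 < l → 0 < k →
    3 ≤ k → k ≤ (m + 1) ⊓ l →
    (F : FiniteField q) (L : FiniteField (q ^ l)) (φ : F ↪ L) →
    (w : ℕ) → w ≤ 1 →
    (ws : ℕ → ℕ → ℤ) →
    (∀ r u → .{{_ : NonZero u}} → 2 ≤ r → r < k → u ∣ gcd (suc r) l →
    0ℤ Int.≤ ws r u × fromℤ (ws r u) Rat.≤ orbitNumber q l (suc r) u) →
    Σ[ Λ ∈ ℕ ] fromℕ Λ ≡ multiplicity q m l k w ws ×
    (Σ[ ℬ ∈ List (Subspace (restrict φ (space L m))) ]
    IsGDD {F = F} (m * l) l k Λ (Desarguesian φ m) ℬ ×
    IsSimple {F = F} ℬ ×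
    AdmitsAutomorphisms {F = F} (GeneralLinear φ m) (Desarguesian φ m) ℬ)
theorem5p1 q m l k _ _ 0<l _ 3≤k k≤ F L φ w w≤1 ws = by-prefix (k ∸ 3) (trans (sym (ℕ.+-suc (k ∸ 3) 2)) (ℕ.m∸n+n≡m 3≤k)) k≤
  where
  -- k is generalised so that it can be replaced by its form `suc i + 2`, with i = k - 3.
  by-prefix : ∀ {k} i → suc i + 2 ≡ k → k ≤ (m + 1) ⊓ l →
    (∀ r u → .{{_ : NonZero u}} → 2 ≤ r → r < k → u ∣ gcd (suc r) l →
      0ℤ Int.≤ ws r u × fromℤ (ws r u) Rat.≤ orbitNumber q l (suc r) u) →
    Σ[ Λ ∈ ℕ ] fromℕ Λ ≡ multiplicity q m l k w ws ×
      (Σ[ ℬ ∈ List (Subspace (restrict φ (space L m))) ]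
        IsGDD {F = F} (m * l) l k Λ (Desarguesian φ m) ℬ ×
        IsSimple {F = F} ℬ ×
        AdmitsAutomorphisms {F = F} (GeneralLinear φ m) (Desarguesian φ m) ℬ)
  by-prefix i refl k≤ ws-bound = design q m l i 0<l k≤ F L φ w w≤1 ws ws-bound
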